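{- For every $\varepsilon>0$ and every chordal graph $G$ on $n$ vertices with maximum degree $\Delta$, the Glauber dynamics on the $k$-colourings of $G$, where $k\ge(1+\varepsilon)(\Delta+1)$, has mixing time at most $n^{\mathcal{O}(1+\log(1+\frac1\varepsilon))}$.
   Context: A graph is chordal if it has no induced cycle of length at least $4$. A $k$-colouring of $G$ is a map $\sigma:V\to\{1,\dots,k\}$ with $\sigma(u)\ne\sigma(w)$ for every edge $uw$. The Glauber dynamics on the $k$-colourings picks at each step a vertex $v$ uniformly at random and a colour $c\in\{1,\dots,k\}$ uniformly at random, and recolours $v$ with $c$ if no neighbour of $v$ has colour $c$ (otherwise nothing changes); its stationary distribution $\pi$ is uniform. The mixing time is $\min\{t : \max_{x}\|\nu^t_x-\pi\|_{TV}\le 1/4\}$, where $\nu^t_x$ is the distribution after $t$ steps from $x$ and $\|\mu-\nu\|_{TV}=\frac12\sum_x|\mu(x)-\nu(x)|$. The constant in the $\mathcal O$ is absolute. -}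

module Defs where

open import Data.Bool using (Bool; true; false; if_then_else_; not; _∨_; _∧_)
open import Data.Nat using (ℕ; zero; suc; _⊔_; _≤_) renaming (_+_ to _+ℕ_; _*_ to _*ℕ_; _^_ to _^ℕ_)
open import Data.Fin using (Fin; toℕ)
open import Data.Fin.Properties using () renaming (_≟_ to _≟ᶠ_)
open import Data.List using (List; []; _∷_; map; concatMap; foldr; length; filterᵇ; allFin)
open import Data.Vec using (Vec; lookup; _[_]≔_) renaming ([] to []ᵛ; _∷_ to _∷ᵛ_)
open import Data.Vec.Properties using (≡-dec)
open import Data.Integer using (+_)
open import Data.Rational using (ℚ; 0ℚ; 1ℚ; ½; _+_; _*_; _-_; ∣_∣; _/_) renaming (_≤_ to _≤ℚ_)
open import Data.Product using (Σ; _×_; _,_)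
open import Data.Sum using (_⊎_)
open import Function.Bundles using (_⇔_)
open import Function.Definitions using (Injective)
open import Relation.Binary.PropositionalEquality using (_≡_)
open import Relation.Nullary using (¬_)
open import Relation.Nullary.Decidable using (isYes)

record Graph (n : ℕ) : Set where
  field
    Adj    : Fin n → Fin n → Bool
    sym    : ∀ u w → Adj u w ≡ Adj w u
    irrefl : ∀ u → Adj u u ≡ false
open Graph public

degree : ∀ {n} → Graph n → Fin n → ℕ
degree {n} G v = length (filterᵇ (Adj G v) (allFin n))

maxDegree : ∀ {n} → Graph n → ℕ
maxDegree {n} G = foldr _⊔_ 0 (map (degree G) (allFin n))

CycAdj : (m : ℕ) → Fin m → Fin m → Set
CycAdj m i j =
  (toℕ j ≡ suc (toℕ i)) ⊎ (toℕ i ≡ suc (toℕ j))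
  ⊎ ((toℕ i ≡ 0 × suc (toℕ j) ≡ m) ⊎ (toℕ j ≡ 0 × suc (toℕ i) ≡ m))

IsInducedCycle : ∀ {n} → Graph n → (m : ℕ) → (Fin m → Fin n) → Set
IsInducedCycle G m f =
  Injective _≡_ _≡_ f × (∀ i j → (Adj G (f i) (f j) ≡ true) ⇔ CycAdj m i j)

Chordal : ∀ {n} → Graph n → Set
Chordal {n} G = ∀ m → 4 ≤ m → (f : Fin m → Fin n) → ¬ IsInducedCycle G m f

allᵇ : ∀ {A : Set} → (A → Bool) → List A → Bool
allᵇ p = foldr (λ x b → p x ∧ b) true

Col : ℕ → ℕ → Set
Col k n = Vec (Fin k) n

allCols : (k n : ℕ) → List (Col k n)
allCols k zero    = []ᵛ ∷ []
allCols k (suc n) = concatMap (λ c → map (c ∷ᵛ_) (allCols k n)) (allFin k)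

_==ᶠ_ : ∀ {k} → Fin k → Fin k → Bool
a ==ᶠ b = isYes (a ≟ᶠ b)

_==ᶜ_ : ∀ {k n} → Col k n → Col k n → Bool
x ==ᶜ y = isYes (≡-dec _≟ᶠ_ x y)

proper : ∀ {n k} → Graph n → Col k n → Bool
proper {n} G σ =
  allᵇ (λ u → allᵇ (λ w → not (Adj G u w) ∨ not (lookup σ u ==ᶠ lookup σ w)) (allFin n)) (allFin n)

properCols : ∀ {n} → Graph n → (k : ℕ) → List (Col k n)
properCols {n} G k = filterᵇ (proper G) (allCols k n)

step : ∀ {n k} → Graph n → Col k n → Fin n → Fin k → Col k n
step {n} G σ v c =
  if allᵇ (λ w → not (Adj G v w) ∨ not (lookup σ w ==ᶠ c)) (allFin n)
  then σ [ v ]≔ c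
  else σ

inv : ℕ → ℚ
inv zero    = 0ℚ
inv (suc m) = + 1 / suc m

sumℚ : List ℚ → ℚ
sumℚ = foldr _+_ 0ℚ

-- ν^t_x(y): probability that the Glauber dynamics started at x is at y after t steps
-- (each of the n*k pairs (v,c) is chosen with probability 1/(n k))
dist : ∀ {n} → Graph n → (k : ℕ) → ℕ → Col k n → Col k n → ℚ
dist G k zero    x y = if x ==ᶜ y then 1ℚ else 0ℚ
dist {n} G k (suc t) x y =
  inv (n *ℕ k) * sumℚ (concatMap (λ v → map (λ c → dist G k t (step G x v c) y) (allFin k)) (allFin n))

-- uniform distribution π on Ω (value at any proper colouring)
πval : ∀ {n} → Graph n → (k : ℕ) → ℚ
πval G k = inv (length (properCols G k))

tvDist : ∀ {n} → Graph n → (k : ℕ) → ℕ → Col k n → ℚ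
tvDist G k t x = ½ * sumℚ (map (λ y → ∣ dist G k t x y - πval G k ∣) (properCols G k))

-- "mixing time ≤ T": the minimum t with max_x ‖ν^t_x − π‖_TV ≤ 1/4 exists and is ≤ T
MixingTimeAtMost : ∀ {n} → Graph n → (k : ℕ) → ℕ → Set
MixingTimeAtMost {n} G k T =
  Σ ℕ λ t → t ≤ T × (∀ (x : Col k n) → proper G x ≡ true → tvDist G k t x ≤ℚ (+ 1 / 4))

-- m ≥ log₂(1 + 1/ε), written without division: 1 + ε ≤ 2^m ε
Log2Bound : ℚ → ℕ → Set
Log2Bound ε m = 1ℚ + ε ≤ℚ (+ (2 ^ℕ m) / 1) * ε

{-# OPTIONS --safe #-}
module Submission where

-- Order the vertices so that the earlier neighbours of every vertex form a clique. Two colour classes then induce a rooted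
-- forest, and exchanging the two colours on the tree below a root keeps the colouring proper. Resampling the vertices in order
-- by random such Kempe changes ends in an exactly uniform colouring, which bounds the variance by a polynomial times the
-- energy of Kempe changes.
-- A Kempe change of a tree is simulated by Glauber steps along its heavy path. The current vertex y of the path holds a random
-- temporary colour while the light subtrees hanging from y, each of at most half the size, are changed recursively. A light
-- subtree together with the intermediate colouring determines everything except which of at most Δ earlier neighbours of its
-- root is y, whereas the temporary colour is spread over at least k - Δ - 1 values. Each halving of the size thus costs a factor
-- O(Δ / (k - Δ - 1)) = O(1 + 1/ε), and the log n halvings give n^O(1 + log(1 + 1/ε)).
-- For k ≥ 8n, where log k is not O(log n), a coupling contracts the Hamming distance.

-- Three choices keep the loss per halving at O(1 + 1/ε). Every squared difference attached to a
-- tree is divided by the size of that tree: in Cauchy-Schwarz over the pieces hanging from a vertex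
-- the sizes serve as weights, and they add up to at most the size of the whole, so cutting a tree
-- up costs nothing. The temporary colour lies outside the two exchanged colours and thereby
-- detaches its vertex: each light subtree becomes a Kempe component of the intermediate colouring,
-- and its change is an instance of the same quantity at a smaller size. Single Glauber moves are
-- decoded wastefully, with factors `k` and `n`, but they enter each doubling additively and so
-- contribute only a polynomial.
--
-- Norms are plain sums over the proper colourings. Evaluating at one colouring therefore costs the
-- number of colourings, at most `k ^ n`, and this is made up by O(k n) halvings of the variance.
-- Logarithms never appear: `m` stands for log(1 + 1/ε), and powers of 1 - 1/B are bounded by B/(B +
-- j).
--
-- The vertex order comes from Dirac's theorem that a chordal graph has a simplicial vertex.

open import Defs hiding (sym)
open import Data.Nat using (ℕ; suc; zero; >-nonZero; s≤s; z≤n) renaming (_*_ to _*ℕ_; _^_ to _^ℕ_; _+_ to _+ℕ_; _∸_ to _∸ℕ_; _≤_ to _≤ℕ_; _<_ to _<ℕ_; _⊔_ to _⊔ℕ_)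
import Data.Nat.Properties as ℕₚ
open import Data.Integer using (ℤ; +_)
import Data.Integer as ℤ
import Data.Integer.Properties as ℤₚ
import Data.Rational as ℚ
open import Data.Rational using (ℚ; _≤_; _<_)
open import Data.Rational.Properties using (≤-trans; ≤-refl; ≤-reflexive)
import Data.Rational.Properties as ℚₚ
import Data.Rational.Unnormalised as ℚᵘ
import Data.Rational.Unnormalised.Properties as ℚᵘₚ
open import Algebra.Structures using (IsCommutativeRing)
open import Algebra.Solver.Ring.AlmostCommutativeRing using (AlmostCommutativeRing; fromCommutativeRing; _-Raw-AlmostCommutative⟶_)
import Algebra.Solver.Ring
open import Data.Maybe using (Maybe; just; nothing)
open import Data.Product using (Σ; _×_; _,_; proj₁; proj₂; ∃)
open import Data.Sum using (_⊎_; inj₁; inj₂)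
open import Data.Empty using (⊥; ⊥-elim)
open import Data.Bool using (Bool; true; false; if_then_else_; not; _∧_; _∨_)
open import Data.Fin using (Fin; zero; suc; toℕ)
import Data.Fin.Properties as Finₚ
open import Data.List using (List; []; _∷_; map; concatMap; foldr; length; filterᵇ; allFin; _++_; tabulate)
import Data.List.Properties as Listₚ
open import Data.Vec using (Vec; lookup; _[_]≔_) renaming ([] to []ᵛ; _∷_ to _∷ᵛ_; tabulate to tabulateᵛ)
import Data.Vec.Properties as Vecₚ
open import Relation.Binary.PropositionalEquality using (_≡_; _≢_; refl; trans; cong; cong₂; subst; subst₂) renaming (sym to symm)
open import Relation.Nullary using (¬_; Dec; yes; no; does)
open import Relation.Nullary.Decidable using (map′; dec-true; dec-false; _×-dec_; _⊎-dec_; ¬?)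
open import Relation.Binary.Definitions using (DecidableEquality; tri<; tri≈; tri>)
open import Function using (_∘_; id; case_of_)
import Data.Bool.Properties as Boolₚ
open import Data.List using (downFrom)
open import Function.Bundles using (mk⇔)
open import Data.Fin using (fromℕ)
open import Data.Nat.Tactic.RingSolver using (solve-∀)

-- Rational arithmetic and finite sums

infixl 6 _+_ _-_
infixl 7 _*_
infix  8 -_

private
  ιᵘ : ∀ i → ℚ.toℚᵘ (i ℚ./ 1) ℚᵘ.≃ ℚᵘ.mkℚᵘ i 0
  ιᵘ i = ℚₚ.toℚᵘ-fromℚᵘ (ℚᵘ.mkℚᵘ i 0)

-- The operations are abstract: the library's definitions unfold on variables, which makes unification diverge.
abstract
  _+_ _*_ : ℚ → ℚ → ℚ
  _+_ = ℚ._+_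
  _*_ = ℚ._*_

  -_ : ℚ → ℚ
  -_ = ℚ.-_

  ιℤ : ℤ → ℚ
  ιℤ i = i ℚ./ 1

  inv′ : ℕ → ℚ
  inv′ = inv

  +≡ : ∀ p q → p + q ≡ p ℚ.+ q
  +≡ p q = refl

  *≡ : ∀ p q → p * q ≡ p ℚ.* q
  *≡ p q = refl

  -≡ : ∀ p → - p ≡ ℚ.- p
  -≡ p = refl

  ιℤ≡ : ∀ i → ιℤ i ≡ i ℚ./ 1
  ιℤ≡ i = refl

  inv≡ : ∀ n → inv′ n ≡ inv n
  inv≡ n = refl

  ιℤ-+ : ∀ i j → ιℤ (i ℤ.+ j) ≡ ιℤ i + ιℤ j
  ιℤ-+ i j = ℚₚ.toℚᵘ-injective (ℚᵘₚ.≃-trans (ιᵘ (i ℤ.+ j)) (ℚᵘₚ.≃-trans base (ℚᵘₚ.≃-sym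
      (ℚᵘₚ.≃-trans (ℚₚ.toℚᵘ-homo-+ (ιℤ i) (ιℤ j)) (ℚᵘₚ.+-cong (ιᵘ i) (ιᵘ j))))))
    where
    base : ℚᵘ.mkℚᵘ (i ℤ.+ j) 0 ℚᵘ.≃ ℚᵘ.mkℚᵘ i 0 ℚᵘ.+ ℚᵘ.mkℚᵘ j 0
    base = ℚᵘ.*≡* (cong (ℤ._* + 1)
             (cong₂ ℤ._+_ (symm (ℤₚ.*-identityʳ i)) (symm (ℤₚ.*-identityʳ j))))

  ιℤ-* : ∀ i j → ιℤ (i ℤ.* j) ≡ ιℤ i * ιℤ j
  ιℤ-* i j = ℚₚ.toℚᵘ-injective (ℚᵘₚ.≃-trans (ιᵘ (i ℤ.* j)) (ℚᵘₚ.≃-sym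
      (ℚᵘₚ.≃-trans (ℚₚ.toℚᵘ-homo-* (ιℤ i) (ιℤ j)) (ℚᵘₚ.*-cong (ιᵘ i) (ιᵘ j)))))

  ιℤ-neg : ∀ i → ιℤ (ℤ.- i) ≡ - ιℤ i
  ιℤ-neg i = ℚₚ.toℚᵘ-injective (ℚᵘₚ.≃-trans (ιᵘ (ℤ.- i)) (ℚᵘₚ.≃-sym
      (ℚᵘₚ.≃-trans (ℚₚ.toℚᵘ-homo‿- (ιℤ i)) (ℚᵘₚ.-‿cong (ιᵘ i)))))

  ℚ-isCommutativeRing : IsCommutativeRing _≡_ _+_ _*_ -_ (ιℤ (+ 0)) (ιℤ (+ 1))
  ℚ-isCommutativeRing = ℚₚ.+-*-isCommutativeRing

  ιℤ-mono : ∀ {i j} → i ℤ.≤ j → ιℤ i ≤ ιℤ j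
  ιℤ-mono {i} {j} i≤j = ℚₚ.toℚᵘ-cancel-≤ (ℚᵘₚ.≤-respˡ-≃ (ℚᵘₚ.≃-sym (ιᵘ i)) (ℚᵘₚ.≤-respʳ-≃ (ℚᵘₚ.≃-sym (ιᵘ j))
     (ℚᵘ.*≤* (ℤₚ.*-monoʳ-≤-nonNeg (+ 1) i≤j))))

  ιℤ-cancel : ∀ {i j} → ιℤ i ≤ ιℤ j → i ℤ.≤ j
  ιℤ-cancel {i} {j} p with ℚᵘₚ.≤-respˡ-≃ (ιᵘ i) (ℚᵘₚ.≤-respʳ-≃ (ιᵘ j) (ℚₚ.toℚᵘ-mono-≤ p))
  ... | ℚᵘ.*≤* q = ℤₚ.*-cancelʳ-≤-pos i j (+ 1) q

  *-inv : ∀ n → inv′ (suc n) * ιℤ (+ suc n) ≡ ιℤ (+ 1)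
  *-inv n = ℚₚ.toℚᵘ-injective (ℚᵘₚ.≃-trans (ℚₚ.toℚᵘ-homo-* (inv (suc n)) (ιℤ (+ suc n)))
    (ℚᵘₚ.≃-trans (ℚᵘₚ.*-cong (ℚₚ.toℚᵘ-fromℚᵘ (ℚᵘ.mkℚᵘ (+ 1) n)) (ιᵘ (+ suc n)))
     (ℚᵘ.*≡* (trans (ℤₚ.*-identityʳ _) (trans (ℤₚ.*-identityˡ (+ suc n))
       (symm (trans (ℤₚ.*-identityˡ _) (cong +_ (ℕₚ.*-identityʳ (suc n))))))))))

  0≤inv : ∀ n → ιℤ (+ 0) ≤ inv′ n
  0≤inv zero = ≤-refl
  0≤inv (suc n) = ℚₚ.nonNegative⁻¹ (inv (suc n)) {{ℚₚ.normalize-nonNeg 1 (suc n)}}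

  +-mono-≤ : ∀ {p q r s} → p ≤ q → r ≤ s → p + r ≤ q + s
  +-mono-≤ = ℚₚ.+-mono-≤

  *-monoˡ : ∀ {r p q} → ιℤ (+ 0) ≤ r → p ≤ q → r * p ≤ r * q
  *-monoˡ {r} h = ℚₚ.*-monoˡ-≤-nonNeg r {{ℚ.nonNegative h}}

  *-cancelˡ : ∀ {r p q} → ιℤ (+ 0) < r → r * p ≤ r * q → p ≤ q
  *-cancelˡ {r} h = ℚₚ.*-cancelˡ-≤-pos r {{ℚ.positive h}}

  neg-antimono : ∀ {p q} → p ≤ q → - q ≤ - p
  neg-antimono = ℚₚ.neg-antimono-≤

_-_ : ℚ → ℚ → ℚ
p - q = p + (- q)

0ℚ 1ℚ : ℚ
0ℚ = ιℤ (+ 0)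
1ℚ = ιℤ (+ 1)

ι : ℕ → ℚ
ι n = ιℤ (+ n)

open IsCommutativeRing ℚ-isCommutativeRing public
  using (+-assoc; +-comm; *-assoc; *-comm; +-identityˡ; +-identityʳ; *-identityˡ; *-identityʳ; distribˡ; zeroˡ; zeroʳ)

private
  ℚ-ring : AlmostCommutativeRing _ _
  ℚ-ring = fromCommutativeRing (record { isCommutativeRing = ℚ-isCommutativeRing })

  ℤ⟶ℚ : ℤ.+-*-rawRing -Raw-AlmostCommutative⟶ ℚ-ring
  ℤ⟶ℚ = record { ⟦_⟧ = ιℤ ; +-homo = ιℤ-+ ; *-homo = ιℤ-* ; -‿homo = ιℤ-neg ; 0-homo = refl ; 1-homo = refl }

  coeff≟ : ∀ i j → Maybe (ιℤ i ≡ ιℤ j)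
  coeff≟ i j with i ℤ.≟ j
  ... | yes p = just (cong ιℤ p)
  ... | no _ = nothing

open Algebra.Solver.Ring ℤ.+-*-rawRing ℚ-ring ℤ⟶ℚ coeff≟ public using (solve; _:=_; _:+_; _:*_; _:-_; :-_; con)

ι-+ : ∀ m n → ι (m +ℕ n) ≡ ι m + ι n
ι-+ m n = ιℤ-+ (+ m) (+ n)

ι-* : ∀ m n → ι (m *ℕ n) ≡ ι m * ι n
ι-* m n = trans (cong ιℤ (ℤₚ.pos-* m n)) (ιℤ-* (+ m) (+ n))

ι-mono : ∀ {m n} → m ≤ℕ n → ι m ≤ ι n
ι-mono m≤n = ιℤ-mono (ℤ.+≤+ m≤n)

ι-cancel : ∀ {m n} → ι m ≤ ι n → m ≤ℕ n
ι-cancel p = ℤₚ.drop‿+≤+ (ιℤ-cancel p)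

0≤ι : ∀ n → 0ℚ ≤ ι n
0≤ι n = ι-mono {0} {n} z≤n

+ˡ : ∀ a {b c : ℚ} → b ≡ c → a + b ≡ a + c
+ˡ a = cong (λ x → a + x)

ι-suc : ∀ n → ι (suc n) ≡ 1ℚ + ι n
ι-suc n = ι-+ 1 n

inv-cancel : ∀ n → 1 ≤ℕ n → inv′ n * ι n ≡ 1ℚ
inv-cancel (suc n) _ = *-inv n

≤-diff : ∀ {p q} r → 0ℚ ≤ r → q ≡ p + r → p ≤ q
≤-diff {p} r h refl = subst (_≤ p + r) (+-identityʳ p) (+-mono-≤ (≤-refl {p}) h)

diff-≤ : ∀ {p q} → p ≤ q → 0ℚ ≤ q - p
diff-≤ {p} {q} h = subst (_≤ q - p) (solve 1 (λ a → a :- a := con (+ 0)) refl p) (+-mono-≤ h (≤-refl { - p}))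

0≤+ : ∀ {p q} → 0ℚ ≤ p → 0ℚ ≤ q → 0ℚ ≤ p + q
0≤+ {p} {q} h₁ h₂ = subst (_≤ p + q) (+-identityˡ 0ℚ) (+-mono-≤ h₁ h₂)

*-monoʳ : ∀ {r p q} → 0ℚ ≤ r → p ≤ q → p * r ≤ q * r
*-monoʳ {r} {p} {q} h pq = subst₂ _≤_ (*-comm r p) (*-comm r q) (*-monoˡ h pq)

0≤* : ∀ {p q} → 0ℚ ≤ p → 0ℚ ≤ q → 0ℚ ≤ p * q
0≤* {p} {q} h₁ h₂ = subst (_≤ p * q) (zeroʳ p) (*-monoˡ h₁ h₂)

*-mono : ∀ {p q r s} → 0ℚ ≤ r → 0ℚ ≤ q → p ≤ q → r ≤ s → p * r ≤ q * s
*-mono h₁ h₂ pq rs = ≤-trans (*-monoʳ h₁ pq) (*-monoˡ h₂ rs)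

sq : ℚ → ℚ
sq x = x * x

0≤sq : ∀ x → 0ℚ ≤ sq x
0≤sq x with ℚₚ.≤-total 0ℚ x
... | inj₁ h = 0≤* h h
... | inj₂ h = subst (0ℚ ≤_) (solve 1 (λ a → (:- a) :* (:- a) := a :* a) refl x) (0≤* neg neg)
  where
  neg : 0ℚ ≤ - x
  neg = subst (_≤ - x) (solve 0 (:- con (+ 0) := con (+ 0)) refl) (neg-antimono h)

sq-flip : ∀ x y → sq (x - y) ≡ sq (y - x)
sq-flip = solve 2 (λ a b → (a :- b) :* (a :- b) := (b :- a) :* (b :- a)) refl

sq-+ : ∀ x y → sq (x + y) ≤ ι 2 * (sq x + sq y)
sq-+ x y = ≤-diff (sq (x - y)) (0≤sq (x - y))
  (solve 2 (λ a b → con (+ 2) :* (a :* a :+ b :* b) := (a :+ b) :* (a :+ b) :+ (a :- b) :* (a :- b)) refl x y)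

∑ : {A : Set} → List A → (A → ℚ) → ℚ
∑ [] f = 0ℚ
∑ (x ∷ xs) f = f x + ∑ xs f

∑-zero : ∀ {A : Set} (xs : List A) → ∑ xs (λ _ → 0ℚ) ≡ 0ℚ
∑-zero [] = refl
∑-zero (x ∷ xs) = trans (+-identityˡ _) (∑-zero xs)

∑-+ : ∀ {A : Set} (xs : List A) (f g : A → ℚ) → ∑ xs (λ x → f x + g x) ≡ ∑ xs f + ∑ xs g
∑-+ [] f g = symm (+-identityˡ 0ℚ)
∑-+ (x ∷ xs) f g = trans (+ˡ ((f x + g x)) (∑-+ xs f g))
  (solve 4 (λ a b c d → (a :+ b) :+ (c :+ d) := (a :+ c) :+ (b :+ d)) refl (f x) (g x) (∑ xs f) (∑ xs g))

module _ {A : Set} where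

  ∑-cong : ∀ (xs : List A) {f g : A → ℚ} → (∀ x → f x ≡ g x) → ∑ xs f ≡ ∑ xs g
  ∑-cong [] h = refl
  ∑-cong (x ∷ xs) h = cong₂ _+_ (h x) (∑-cong xs h)

  ∑-mono : ∀ (xs : List A) {f g : A → ℚ} → (∀ x → f x ≤ g x) → ∑ xs f ≤ ∑ xs g
  ∑-mono [] h = ≤-refl
  ∑-mono (x ∷ xs) h = +-mono-≤ (h x) (∑-mono xs h)

  0≤∑ : ∀ (xs : List A) {f : A → ℚ} → (∀ x → 0ℚ ≤ f x) → 0ℚ ≤ ∑ xs f
  0≤∑ [] h = ≤-refl
  0≤∑ (x ∷ xs) h = 0≤+ (h x) (0≤∑ xs h)

  ∑-*ˡ : ∀ (xs : List A) c (f : A → ℚ) → ∑ xs (λ x → c * f x) ≡ c * ∑ xs f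
  ∑-*ˡ [] c f = symm (zeroʳ c)
  ∑-*ˡ (x ∷ xs) c f = trans (+ˡ (c * f x) (∑-*ˡ xs c f)) (symm (distribˡ c (f x) (∑ xs f)))

  ∑-*ʳ : ∀ (xs : List A) c (f : A → ℚ) → ∑ xs (λ x → f x * c) ≡ ∑ xs f * c
  ∑-*ʳ xs c f = trans (∑-cong xs (λ x → *-comm (f x) c)) (trans (∑-*ˡ xs c f) (*-comm c _))

  ∑-- : ∀ (xs : List A) (f g : A → ℚ) → ∑ xs (λ x → f x - g x) ≡ ∑ xs f - ∑ xs g
  ∑-- [] f g = solve 0 (con (+ 0) := con (+ 0) :- con (+ 0)) refl
  ∑-- (x ∷ xs) f g = trans (+ˡ ((f x - g x)) (∑-- xs f g))
    (solve 4 (λ a b c d → (a :- b) :+ (c :- d) := (a :+ c) :- (b :+ d)) refl (f x) (g x) (∑ xs f) (∑ xs g))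

  ∑-const : ∀ (xs : List A) c → ∑ xs (λ _ → c) ≡ ι (length xs) * c
  ∑-const [] c = symm (zeroˡ c)
  ∑-const (x ∷ xs) c = trans (+ˡ (c) (∑-const xs c)) (trans
    (solve 2 (λ a b → a :+ b :* a := (con (+ 1) :+ b) :* a) refl c (ι (length xs)))
    (cong (_* c) (symm (ι-suc (length xs)))))

  ∑-swap : ∀ {B : Set} (xs : List A) (ys : List B) (f : A → B → ℚ) →
           ∑ xs (λ x → ∑ ys (f x)) ≡ ∑ ys (λ y → ∑ xs (λ x → f x y))
  ∑-swap [] ys f = symm (∑-zero ys)
  ∑-swap (x ∷ xs) ys f = trans (+ˡ (∑ ys (f x)) (∑-swap xs ys f)) (symm (∑-+ ys (f x) (λ y → ∑ xs (λ x' → f x' y))))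

  ∑-++ : ∀ (xs ys : List A) (f : A → ℚ) → ∑ (xs ++ ys) f ≡ ∑ xs f + ∑ ys f
  ∑-++ [] ys f = symm (+-identityˡ _)
  ∑-++ (x ∷ xs) ys f = trans (+ˡ (f x) (∑-++ xs ys f)) (symm (+-assoc (f x) _ _))

  ∑-map : ∀ {B : Set} (h : B → A) (xs : List B) (f : A → ℚ) → ∑ (map h xs) f ≡ ∑ xs (λ x → f (h x))
  ∑-map h [] f = refl
  ∑-map h (x ∷ xs) f = +ˡ (f (h x)) (∑-map h xs f)

  ∑-concatMap : ∀ {B : Set} (h : B → List A) (xs : List B) (f : A → ℚ) →
                ∑ (concatMap h xs) f ≡ ∑ xs (λ x → ∑ (h x) f)
  ∑-concatMap h [] f = refl
  ∑-concatMap h (x ∷ xs) f = trans (∑-++ (h x) (concatMap h xs) f) (+ˡ (∑ (h x) f) (∑-concatMap h xs f))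

  -- The quadratic polynomial y ↦ ∑ w (f - y)² is nonnegative.
  ∑-quadratic : ∀ (xs : List A) (w f : A → ℚ) → (∀ x → 0ℚ ≤ w x) → ∀ y →
    0ℚ ≤ ∑ xs (λ x → w x * sq (f x)) - ι 2 * y * ∑ xs (λ x → w x * f x) + sq y * ∑ xs w
  ∑-quadratic [] w f h y = ≤-reflexive (solve 1 (λ a → con (+ 0) := con (+ 0) :- con (+ 2) :* a :* con (+ 0) :+ a :* a :* con (+ 0)) refl y)
  ∑-quadratic (x ∷ xs) w f h y = subst (0ℚ ≤_)
    (solve 6 (λ a b c r t s → a :* ((b :- c) :* (b :- c)) :+ (r :- con (+ 2) :* c :* t :+ c :* c :* s)
        := a :* (b :* b) :+ r :- con (+ 2) :* c :* (a :* b :+ t) :+ c :* c :* (a :+ s)) refl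
      (w x) (f x) y (∑ xs (λ x → w x * sq (f x))) (∑ xs (λ x → w x * f x)) (∑ xs w))
    (0≤+ (0≤* (h x) (0≤sq (f x - y))) (∑-quadratic xs w f h y))

  -- The induction step evaluates the nonnegative quadratic of the tail at `f x`. This avoids
  -- dividing by the total weight, which may be zero.
  cauchy-schwarz : ∀ (xs : List A) (w f : A → ℚ) → (∀ x → 0ℚ ≤ w x) →
    sq (∑ xs (λ x → w x * f x)) ≤ ∑ xs w * ∑ xs (λ x → w x * sq (f x))
  cauchy-schwarz [] w f h = ≤-refl
  cauchy-schwarz (x ∷ xs) w f h = ≤-diff
    (a * (r - ι 2 * b * t + sq b * s) + (s * r - sq t))
    (0≤+ (0≤* (h x) (∑-quadratic xs w f h b)) (diff-≤ (cauchy-schwarz xs w f h)))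
    (solve 5 (λ a b r t s → (a :+ s) :* (a :* (b :* b) :+ r) :=
        (a :* b :+ t) :* (a :* b :+ t) :+ (a :* (r :- con (+ 2) :* b :* t :+ b :* b :* s) :+ (s :* r :- t :* t)))
      refl a b r t s)
    where
    a b r t s : ℚ
    a = w x
    b = f x
    r = ∑ xs (λ x → w x * sq (f x))
    t = ∑ xs (λ x → w x * f x)
    s = ∑ xs w

  jensen : ∀ (xs : List A) (w f : A → ℚ) → (∀ x → 0ℚ ≤ w x) → ∑ xs w ≤ 1ℚ →
    sq (∑ xs (λ x → w x * f x)) ≤ ∑ xs (λ x → w x * sq (f x))
  jensen xs w f h h₁ = ≤-trans (cauchy-schwarz xs w f h)
    (subst (∑ xs w * r ≤_) (*-identityˡ r) (*-monoʳ (0≤∑ xs (λ x → 0≤* (h x) (0≤sq (f x)))) h₁))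
    where
    r : ℚ
    r = ∑ xs (λ x → w x * sq (f x))

-- Indicators, finite enumerations and reindexing of sums

χ : Bool → ℚ
χ true  = 1ℚ
χ false = 0ℚ

0≤χ : ∀ b → 0ℚ ≤ χ b
0≤χ true  = 0≤ι 1
0≤χ false = ≤-refl

χ≤1 : ∀ b → χ b ≤ 1ℚ
χ≤1 true  = ≤-refl
χ≤1 false = 0≤ι 1

χ-* : ∀ b {p q} → (b ≡ true → p ≡ q) → χ b * p ≡ χ b * q
χ-* true  h = cong (1ℚ *_) (h refl)
χ-* false {p} {q} h = trans (zeroˡ p) (symm (zeroˡ q))

χ-≤ : ∀ b {p q} → (b ≡ true → p ≤ q) → χ b * p ≤ χ b * q
χ-≤ true  h = *-monoˡ (0≤ι 1) (h refl)
χ-≤ false {p} {q} h = ≤-reflexive (trans (zeroˡ p) (symm (zeroˡ q)))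

χ*-drop : ∀ b {p} → 0ℚ ≤ p → χ b * p ≤ p
χ*-drop b {p} h = subst (χ b * p ≤_) (*-identityˡ p) (*-monoʳ h (χ≤1 b))

χ-∧ : ∀ a b → χ (a ∧ b) ≡ χ a * χ b
χ-∧ true  b = symm (*-identityˡ (χ b))
χ-∧ false b = symm (zeroˡ (χ b))

χ-mono : ∀ {a b} → (a ≡ true → b ≡ true) → χ a ≤ χ b
χ-mono {true} h rewrite h refl = ≤-refl
χ-mono {false} {b} h = 0≤χ b

≡-bool : ∀ {a b} → (a ≡ true → b ≡ true) → (b ≡ true → a ≡ true) → a ≡ b
≡-bool {true} f g = symm (f refl)
≡-bool {false} {true} f g = symm (symm (g refl))
≡-bool {false} {false} f g = refl

does⁺ : ∀ {P : Set} (d : Dec P) → P → does d ≡ true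
does⁺ = dec-true

does⁻ : ∀ {P : Set} (d : Dec P) → does d ≡ true → P
does⁻ (yes p) _ = p

-- The field `delta` says that every element occurs exactly once in `elems`, phrased as evaluation
-- of a sum so that it can be used inside exchanged sums.
record Enum (A : Set) : Set where
  field
    elems : List A
    _≟ᵉ_  : DecidableEquality A
    delta : ∀ a (f : A → ℚ) → ∑ elems (λ x → χ (does (x ≟ᵉ a)) * f x) ≡ f a
open Enum public

∑-allFin-suc : ∀ n (f : Fin (suc n) → ℚ) → ∑ (allFin (suc n)) f ≡ f zero + ∑ (allFin n) (λ i → f (suc i))
∑-allFin-suc n f = +ˡ (f zero) (trans (cong (λ l → ∑ l f) (symm (Listₚ.map-tabulate id suc))) (∑-map suc (allFin n) f))

δ-suc : ∀ {n} (x a : Fin n) → does (suc x Finₚ.≟ suc a) ≡ does (x Finₚ.≟ a)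
δ-suc x a = ≡-bool (λ h → does⁺ (x Finₚ.≟ a) (Finₚ.suc-injective (does⁻ (suc x Finₚ.≟ suc a) h)))
                   (λ h → does⁺ (suc x Finₚ.≟ suc a) (cong suc (does⁻ (x Finₚ.≟ a) h)))

deltaFin : ∀ n (a : Fin n) (f : Fin n → ℚ) → ∑ (allFin n) (λ x → χ (does (x Finₚ.≟ a)) * f x) ≡ f a
deltaFin (suc n) zero f = trans (∑-allFin-suc n _) (trans (cong₂ _+_ (*-identityˡ (f zero))
  (trans (∑-cong (allFin n) (λ i → zeroˡ (f (suc i)))) (∑-zero (allFin n)))) (+-identityʳ (f zero)))
deltaFin (suc n) (suc a) f = trans (∑-allFin-suc n _) (trans (cong₂ _+_ (zeroˡ (f zero))
  (trans (∑-cong (allFin n) (λ i → cong (λ b → χ b * f (suc i)) (δ-suc i a))) (deltaFin n a (λ i → f (suc i)))))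
  (+-identityˡ (f (suc a))))

enumFin : ∀ n → Enum (Fin n)
enumFin n = record { elems = allFin n ; _≟ᵉ_ = Finₚ._≟_ ; delta = deltaFin n }

_≟ᶜ_ : ∀ {k n} → DecidableEquality (Col k n)
_≟ᶜ_ = Vecₚ.≡-dec Finₚ._≟_

deltaCol : ∀ k n (a : Col k n) (f : Col k n → ℚ) → ∑ (allCols k n) (λ x → χ (does (x ≟ᶜ a)) * f x) ≡ f a
deltaCol k zero []ᵛ f = trans (+-identityʳ _) (*-identityˡ (f []ᵛ))
deltaCol k (suc n) (a ∷ᵛ as) f = trans (∑-concatMap _ (allFin k) _) (trans
  (∑-cong (allFin k) (λ c → trans (∑-map (c ∷ᵛ_) (allCols k n) _)
    (trans (∑-cong (allCols k n) (λ σ → trans (cong (_* f (c ∷ᵛ σ)) (split c σ)) (*-assoc _ _ _)))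
      (trans (∑-*ˡ (allCols k n) (χ (does (c Finₚ.≟ a))) _) (cong (χ (does (c Finₚ.≟ a)) *_) (deltaCol k n as (λ σ → f (c ∷ᵛ σ))))))))
  (deltaFin k a (λ c → f (c ∷ᵛ as))))
  where
  split : ∀ c σ → χ (does ((c ∷ᵛ σ) ≟ᶜ (a ∷ᵛ as))) ≡ χ (does (c Finₚ.≟ a)) * χ (does (σ ≟ᶜ as))
  split c σ = trans (cong χ (≡-bool
     (λ h → case Vecₚ.∷-injective (does⁻ ((c ∷ᵛ σ) ≟ᶜ (a ∷ᵛ as)) h) of λ { (p , q) → cong₂ _∧_ (does⁺ (c Finₚ.≟ a) p) (does⁺ (σ ≟ᶜ as) q) })
     (λ h → does⁺ ((c ∷ᵛ σ) ≟ᶜ (a ∷ᵛ as)) (cong₂ _∷ᵛ_ (does⁻ (c Finₚ.≟ a) (∧ˡ h)) (does⁻ (σ ≟ᶜ as) (∧ʳ {does (c Finₚ.≟ a)} h))))))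
     (χ-∧ (does (c Finₚ.≟ a)) (does (σ ≟ᶜ as)))
    where
    ∧ˡ : ∀ {x y} → x ∧ y ≡ true → x ≡ true
    ∧ˡ {true} _ = refl
    ∧ʳ : ∀ {x y} → x ∧ y ≡ true → y ≡ true
    ∧ʳ {true} h = h

enumCol : ∀ k n → Enum (Col k n)
enumCol k n = record { elems = allCols k n ; _≟ᵉ_ = _≟ᶜ_ ; delta = deltaCol k n }

_×ᵉ_ : ∀ {A B} → Enum A → Enum B → Enum (A × B)
_×ᵉ_ {A} {B} E F = record { elems = concatMap (λ a → map (a ,_) (elems F)) (elems E) ; _≟ᵉ_ = _≟×_ ; delta = δ× }
  where
  _≟×_ : DecidableEquality (A × B)
  (a , b) ≟× (a' , b') with _≟ᵉ_ E a a' | _≟ᵉ_ F b b'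
  ... | yes refl | yes refl = yes refl
  ... | no ¬p | _ = no λ { refl → ¬p refl }
  ... | yes _ | no ¬q = no λ { refl → ¬q refl }
  split : ∀ a b a' b' → χ (does ((a , b) ≟× (a' , b'))) ≡ χ (does (_≟ᵉ_ E a a')) * χ (does (_≟ᵉ_ F b b'))
  split a b a' b' with _≟ᵉ_ E a a' | _≟ᵉ_ F b b'
  ... | yes refl | yes refl = symm (*-identityˡ 1ℚ)
  ... | no ¬p | q = symm (zeroˡ (χ (does q)))
  ... | yes refl | no ¬q = symm (*-identityˡ 0ℚ)
  δ× : ∀ a (f : A × B → ℚ) → ∑ (concatMap (λ a → map (a ,_) (elems F)) (elems E)) (λ x → χ (does (x ≟× a)) * f x) ≡ f a
  δ× (a' , b') f = trans (∑-concatMap _ (elems E) _) (trans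
    (∑-cong (elems E) (λ a → trans (∑-map (a ,_) (elems F) _)
      (trans (∑-cong (elems F) (λ b → trans (cong (_* f (a , b)) (split a b a' b')) (*-assoc _ _ _)))
        (trans (∑-*ˡ (elems F) (χ (does (_≟ᵉ_ E a a'))) _) (cong (χ (does (_≟ᵉ_ E a a')) *_) (delta F b' (λ b → f (a , b))))))))
    (delta E a' (λ a → f (a , b'))))

∑-× : ∀ {A B} (E : Enum A) (F : Enum B) (f : A × B → ℚ) → ∑ (elems (E ×ᵉ F)) f ≡ ∑ (elems E) (λ a → ∑ (elems F) (λ b → f (a , b)))
∑-× E F f = trans (∑-concatMap _ (elems E) f) (∑-cong (elems E) (λ a → ∑-map (a ,_) (elems F) f))

module _ {A B : Set} (E : Enum A) (F : Enum B) where

  private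
    expand : (p : A → Bool) (φ : A → B) (g : B → ℚ) →
      ∑ (elems E) (λ a → χ (p a) * g (φ a)) ≡
      ∑ (elems F) (λ b → ∑ (elems E) (λ a → χ (p a) * (χ (does (_≟ᵉ_ F b (φ a))) * g b)))
    expand p φ g = trans
      (∑-cong (elems E) (λ a → trans (cong (χ (p a) *_) (symm (delta F (φ a) g))) (symm (∑-*ˡ (elems F) (χ (p a)) _))))
      (∑-swap (elems E) (elems F) _)

  -- A left inverse on the support of `p` makes `φ` injective there; the values of `g` off the image
  -- are dropped, whence their nonnegativity. This is the counting tool behind the congestion bound:
  -- `ψ` decodes an intermediate colouring.
  reindex-≤ : (p : A → Bool) (φ : A → B) (ψ : B → A) → (∀ a → p a ≡ true → ψ (φ a) ≡ a) →
    (g : B → ℚ) → (∀ b → 0ℚ ≤ g b) →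
    ∑ (elems E) (λ a → χ (p a) * g (φ a)) ≤ ∑ (elems F) g
  reindex-≤ p φ ψ inv' g 0≤g = ≤-trans (≤-reflexive (expand p φ g))
    (∑-mono (elems F) (λ b → ≤-trans (∑-mono (elems E) (bound b)) (≤-reflexive (delta E (ψ b) (λ _ → g b)))))
    where
    bound : ∀ b a → χ (p a) * (χ (does (_≟ᵉ_ F b (φ a))) * g b) ≤ χ (does (_≟ᵉ_ E a (ψ b))) * g b
    bound b a with p a in pa | _≟ᵉ_ F b (φ a) | _≟ᵉ_ E a (ψ b)
    ... | true  | yes refl | yes _ = ≤-reflexive (*-identityˡ (1ℚ * g b))
    ... | true  | yes refl | no ¬q = ⊥-elim (¬q (symm (inv' a pa)))
    ... | true  | no _     | d = ≤-trans (≤-reflexive (trans (*-identityˡ (0ℚ * g b)) (zeroˡ (g b)))) (0≤* (0≤χ (does d)) (0≤g b))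
    ... | false | x        | d = ≤-trans (≤-reflexive (zeroˡ (χ (does x) * g b))) (0≤* (0≤χ (does d)) (0≤g b))

module _ {A : Set} (E : Enum A) where

  -- Meant for pairs of a colouring and a move, with `φ` passing to the reversed move. Reversibility
  -- of the Kempe resampling and of the Glauber steps enters in this form.
  reindex-involution : (p : A → Bool) (φ : A → A) → (∀ a → p a ≡ true → p (φ a) ≡ true) →
    (∀ a → p a ≡ true → φ (φ a) ≡ a) → (g : A → ℚ) →
    ∑ (elems E) (λ a → χ (p a) * g (φ a)) ≡ ∑ (elems E) (λ a → χ (p a) * g a)
  reindex-involution p φ closed inv' g = trans
    (∑-cong (elems E) (λ a → trans (cong (χ (p a) *_) (symm (delta E (φ a) g))) (symm (∑-*ˡ (elems E) (χ (p a)) _))))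
    (trans (∑-swap (elems E) (elems E) _)
    (trans (∑-cong (elems E) (λ b → ∑-cong (elems E) (λ a → flip-δ a b)))
    (∑-cong (elems E) (λ b → delta E (φ b) (λ _ → χ (p b) * g b)))))
    where
    flip-δ : ∀ a b → χ (p a) * (χ (does (_≟ᵉ_ E b (φ a))) * g b) ≡ χ (does (_≟ᵉ_ E a (φ b))) * (χ (p b) * g b)
    flip-δ a b with p a in pa | p b in pb | _≟ᵉ_ E b (φ a) | _≟ᵉ_ E a (φ b)
    ... | true | true | yes refl | yes _ = refl
    ... | true | true | yes refl | no ¬q = ⊥-elim (¬q (symm (inv' a pa)))
    ... | true | true | no ¬q | yes refl = ⊥-elim (¬q (symm (inv' b pb)))
    ... | true | true | no _ | no _ = solve 1 (λ x → con (+ 1) :* (con (+ 0) :* x) := con (+ 0) :* (con (+ 1) :* x)) refl (g b)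
    ... | true | false | yes refl | _ = case trans (symm pb) (closed a pa) of λ ()
    ... | true | false | no _ | d = solve 2 (λ x y → con (+ 1) :* (con (+ 0) :* x) := y :* (con (+ 0) :* x)) refl (g b) (χ (does d))
    ... | false | true | d | yes refl = case trans (symm pa) (closed b pb) of λ ()
    ... | false | true | d | no _ = solve 2 (λ x y → con (+ 0) :* (y :* x) := con (+ 0) :* (con (+ 1) :* x)) refl (g b) (χ (does d))
    ... | false | false | d | d' = solve 3 (λ x y z → con (+ 0) :* (y :* x) := z :* (con (+ 0) :* x)) refl (g b) (χ (does d)) (χ (does d'))

-- Rooted forests in a perfect elimination ordering

∧⁻ : ∀ {a b} → a ∧ b ≡ true → (a ≡ true) × (b ≡ true)
∧⁻ {true} h = refl , h

ι-count : ∀ {A : Set} (p : A → Bool) xs → ι (length (filterᵇ p xs)) ≡ ∑ xs (λ x → χ (p x))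
ι-count p [] = refl
ι-count p (x ∷ xs) with p x
... | true  = trans (ι-suc _) (+ˡ 1ℚ (ι-count p xs))
... | false = trans (ι-count p xs) (symm (+-identityˡ _))

single-≤-∑ : ∀ {A} (E : Enum A) (f : A → ℚ) → (∀ x → 0ℚ ≤ f x) → ∀ a → f a ≤ ∑ (elems E) f
single-≤-∑ E f h a = ≤-trans (≤-reflexive (symm (delta E a f)))
  (∑-mono (elems E) (λ x → χ*-drop (does (_≟ᵉ_ E x a)) (h x)))

pair-≤-∑ : ∀ {A} (E : Enum A) (f : A → ℚ) → (∀ x → 0ℚ ≤ f x) → ∀ a b → a ≢ b → f a + f b ≤ ∑ (elems E) f
pair-≤-∑ E f h a b a≢b = ≤-trans (≤-reflexive (trans (symm (cong₂ _+_ (delta E a f) (delta E b f))) (symm (∑-+ (elems E) _ _))))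
  (∑-mono (elems E) bound)
  where
  bound : ∀ x → χ (does (_≟ᵉ_ E x a)) * f x + χ (does (_≟ᵉ_ E x b)) * f x ≤ f x
  bound x with _≟ᵉ_ E x a | _≟ᵉ_ E x b
  ... | yes p | yes q = ⊥-elim (a≢b (trans (symm p) q))
  ... | yes _ | no _ = ≤-reflexive (solve 1 (λ y → con (+ 1) :* y :+ con (+ 0) :* y := y) refl (f x))
  ... | no _ | yes _ = ≤-reflexive (solve 1 (λ y → con (+ 0) :* y :+ con (+ 1) :* y := y) refl (f x))
  ... | no _ | no _ = ≤-trans (≤-reflexive (solve 1 (λ y → con (+ 0) :* y :+ con (+ 0) :* y := con (+ 0)) refl (f x))) (h x)

unique-∑ : ∀ {n} (p : Fin n → Bool) (q : Bool) → (∀ u v → p u ≡ true → p v ≡ true → u ≡ v) →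
  (∀ u → p u ≡ true → q ≡ true) → ∑ (allFin n) (λ u → χ (p u)) ≤ χ q
unique-∑ {n} p q uniq impl with Finₚ.any? (λ u → p u Boolₚ.≟ true)
... | yes (u , pu) = ≤-trans (∑-mono (allFin n) bound)
        (≤-reflexive (trans (deltaFin n u (λ _ → 1ℚ)) (cong χ (symm (impl u pu)))))
  where
  bound : ∀ x → χ (p x) ≤ χ (does (x Finₚ.≟ u)) * 1ℚ
  bound x with p x in px
  ... | false = 0≤* (0≤χ (does (x Finₚ.≟ u))) (0≤ι 1)
  ... | true rewrite does⁺ (x Finₚ.≟ u) (uniq x u px pu) = ≤-reflexive (symm (*-identityʳ 1ℚ))
... | no none = ≤-trans (≤-reflexive (trans (∑-cong (allFin n) zeros) (∑-zero (allFin n)))) (0≤χ q)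
  where
  zeros : ∀ x → χ (p x) ≡ 0ℚ
  zeros x with p x in px
  ... | false = refl
  ... | true = ⊥-elim (none (x , px))

-- The reverse of the usual elimination order: the vertex of highest rank is simplicial, and
-- removing vertices from the top keeps the property.
record PEO {n} (G : Graph n) : Set where
  field
    rank     : Fin n → ℕ
    rank<n   : ∀ x → rank x <ℕ n
    rank-inj : ∀ {x y} → rank x ≡ rank y → x ≡ y
    clique   : ∀ {x y z} → Adj G x y ≡ true → Adj G x z ≡ true →
               rank y <ℕ rank x → rank z <ℕ rank x → y ≢ z → Adj G y z ≡ true

-- Given a set X of vertices in which every vertex has at most one earlier neighbour, Par makes X a rooted forest.
module Forest {n} (G : Graph n) (O : PEO G) where
  open PEO O public

  record Par (X : Vec Bool n) (p x : Fin n) : Set where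
    constructor par
    field
      parent∈  : lookup X p ≡ true
      child∈   : lookup X x ≡ true
      adjacent : Adj G p x ≡ true
      earlier  : rank p <ℕ rank x

  abstract
    Par? : ∀ X p x → Dec (Par X p x)
    Par? X p x = map′ (λ { ((a , b) , (c , d)) → par a b c d }) (λ { (par a b c d) → (a , b) , (c , d) })
      (((lookup X p Boolₚ.≟ true) ×-dec (lookup X x Boolₚ.≟ true)) ×-dec ((Adj G p x Boolₚ.≟ true) ×-dec (rank p ℕₚ.<? rank x)))

  Uniq : Vec Bool n → Set
  Uniq X = ∀ {x p q} → Par X p x → Par X q x → p ≡ q

  -- The reflexive ancestor relation, grown at its lower end `x`, so that under `Uniq` a proof is
  -- peeled off one forced parent at a time.
  data _⊢_⊑_ (X : Vec Bool n) (y : Fin n) : Fin n → Set where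
    here : X ⊢ y ⊑ y
    up   : ∀ {p x} → Par X p x → X ⊢ y ⊑ p → X ⊢ y ⊑ x

  Par-rank : ∀ {X p x} → Par X p x → rank p <ℕ rank x
  Par-rank (par _ _ _ r) = r

  ⊑-rank : ∀ {X y x} → X ⊢ y ⊑ x → rank y ≤ℕ rank x
  ⊑-rank here = ℕₚ.≤-refl
  ⊑-rank (up r s) = ℕₚ.≤-trans (⊑-rank s) (ℕₚ.<⇒≤ (Par-rank r))

  ⊑-trans : ∀ {X z y x} → X ⊢ z ⊑ y → X ⊢ y ⊑ x → X ⊢ z ⊑ x
  ⊑-trans s here = s
  ⊑-trans s (up r t) = up r (⊑-trans s t)

  ⊑-∈ : ∀ {X y x} → X ⊢ y ⊑ x → lookup X y ≡ true → lookup X x ≡ true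
  ⊑-∈ here h = h
  ⊑-∈ (up (par _ h _ _) _) _ = h

  abstract
    ⊑-fuel : ∀ X m y x → rank x <ℕ m → Dec (X ⊢ y ⊑ x)
    ⊑-fuel X (suc m) y x r with y Finₚ.≟ x
    ... | yes refl = yes here
    ... | no y≢x with Finₚ.any? step?
      where
      step? : ∀ p → Dec (Par X p x × X ⊢ y ⊑ p)
      step? p with Par? X p x
      ... | no ¬q = no (λ s → ¬q (proj₁ s))
      ... | yes q with ⊑-fuel X m y p (ℕₚ.<-≤-trans (Par-rank q) (ℕₚ.≤-pred r))
      ...   | yes s = yes (q , s)
      ...   | no ¬s = no (λ s → ¬s (proj₂ s))
    ...   | yes (p , q , s) = yes (up q s)
    ...   | no ¬s = no (λ { here → y≢x refl ; (up q s) → ¬s (_ , q , s) })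

    ⊑? : ∀ X y x → Dec (X ⊢ y ⊑ x)
    ⊑? X y x = ⊑-fuel X (suc (rank x)) y x ℕₚ.≤-refl

  ⊑-par : ∀ {X y p x} → Uniq X → Par X p x → X ⊢ y ⊑ x → y ≢ x → X ⊢ y ⊑ p
  ⊑-par U q here y≢x = ⊥-elim (y≢x refl)
  ⊑-par U q (up q' s) y≢x rewrite U q q' = s

  ⊑-antisym-par : ∀ {X y u} → Par X y u → ¬ X ⊢ u ⊑ y
  ⊑-antisym-par q s = ℕₚ.<-irrefl refl (ℕₚ.<-≤-trans (Par-rank q) (⊑-rank s))

  ⊑-chain : ∀ {X y z x} → Uniq X → X ⊢ y ⊑ x → X ⊢ z ⊑ x → (X ⊢ y ⊑ z) ⊎ (X ⊢ z ⊑ y)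
  ⊑-chain U here t = inj₂ t
  ⊑-chain U (up q s) here = inj₁ (up q s)
  ⊑-chain U (up q s) (up q' t) rewrite U q q' = ⊑-chain U s t

  -- Both children lie on the chain of ancestors of `x`. If they were distinct, one would lie above
  -- the parent of the other, which is `y`, against the ranks.
  siblings : ∀ {X y u v x} → Uniq X → Par X y u → Par X y v → X ⊢ u ⊑ x → X ⊢ v ⊑ x → u ≡ v
  siblings {X} {y} {u} {v} U q r s t with u Finₚ.≟ v | ⊑-chain U s t
  ... | yes e | _ = e
  ... | no u≢v | inj₁ w = ⊥-elim (⊑-antisym-par q (⊑-par U r w u≢v))
  ... | no u≢v | inj₂ w = ⊥-elim (⊑-antisym-par r (⊑-par U q w (u≢v ∘ symm)))

  Root : Vec Bool n → Fin n → Set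
  Root X v = (lookup X v ≡ true) × (∀ p → ¬ Par X p v)

  abstract
    Root? : ∀ X v → Dec (Root X v)
    Root? X v = (lookup X v Boolₚ.≟ true) ×-dec Finₚ.all? (λ p → ¬? (Par? X p v))

  root-unique : ∀ {X v w x} → Uniq X → Root X v → Root X w → X ⊢ v ⊑ x → X ⊢ w ⊑ x → v ≡ w
  root-unique U rv rw s t with ⊑-chain U s t
  ... | inj₁ here = refl
  ... | inj₁ (up q _) = ⊥-elim (proj₂ rw _ q)
  ... | inj₂ here = refl
  ... | inj₂ (up q _) = ⊥-elim (proj₂ rv _ q)

  abstract
    size : Vec Bool n → Fin n → ℕ
    size X y = length (filterᵇ (λ x → does (⊑? X y x)) (allFin n))

    ι-size : ∀ X y → ι (size X y) ≡ ∑ (allFin n) (λ x → χ (does (⊑? X y x)))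
    ι-size X y = ι-count (λ x → does (⊑? X y x)) (allFin n)

    size≤n : ∀ X y → size X y ≤ℕ n
    size≤n X y = ℕₚ.≤-trans (Listₚ.length-filter _ (allFin n)) (ℕₚ.≤-reflexive (Listₚ.length-tabulate id))

  size≥1 : ∀ X y → 1 ≤ℕ size X y
  size≥1 X y = ι-cancel (≤-trans (≤-reflexive (symm (cong χ (does⁺ (⊑? X y y) here))))
    (subst (χ (does (⊑? X y y)) ≤_) (symm (ι-size X y)) (single-≤-∑ (enumFin n) _ (λ x → 0≤χ (does (⊑? X y x))) y)))

  -- Double counting: a vertex below `y` is `y` itself or lies below at most one child, by
  -- `siblings`. The left side is the total weight in the Cauchy-Schwarz estimate `combine`.
  size-children : ∀ {X} → Uniq X → ∀ y → 1ℚ + ∑ (allFin n) (λ u → χ (does (Par? X y u)) * ι (size X u)) ≤ ι (size X y)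
  size-children {X} U y = ≤-trans (≤-reflexive lhs)
      (≤-trans (∑-mono (allFin n) pointwise) (≤-reflexive (symm (ι-size X y))))
    where
    isy : Fin n → ℚ
    isy x = χ (does (x Finₚ.≟ y)) * 1ℚ
    below : Fin n → Fin n → Bool
    below x u = does (Par? X y u) ∧ does (⊑? X u x)
    lhs : 1ℚ + ∑ (allFin n) (λ u → χ (does (Par? X y u)) * ι (size X u)) ≡
          ∑ (allFin n) (λ x → isy x + ∑ (allFin n) (λ u → χ (below x u)))
    lhs = trans (cong₂ _+_ (symm (deltaFin n y (λ _ → 1ℚ))) (trans
      (∑-cong (allFin n) (λ u → trans (cong (χ (does (Par? X y u)) *_) (ι-size X u)) (trans (symm (∑-*ˡ (allFin n) _ _))
        (∑-cong (allFin n) (λ x → symm (χ-∧ (does (Par? X y u)) (does (⊑? X u x))))))))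
      (∑-swap (allFin n) (allFin n) (λ u x → χ (below x u))))) (symm (∑-+ (allFin n) isy (λ x → ∑ (allFin n) (λ u → χ (below x u)))))
    below⁻ : ∀ x u → below x u ≡ true → Par X y u × X ⊢ u ⊑ x
    below⁻ x u h = does⁻ (Par? X y u) (proj₁ (∧⁻ h)) , does⁻ (⊑? X u x) (proj₂ (∧⁻ {does (Par? X y u)} h))
    sum≤ : ∀ x → ∑ (allFin n) (λ u → χ (below x u)) ≤ χ (does (⊑? X y x) ∧ not (does (x Finₚ.≟ y)))
    sum≤ x = unique-∑ (below x) _
      (λ u v hu hv → siblings U (proj₁ (below⁻ x u hu)) (proj₁ (below⁻ x v hv)) (proj₂ (below⁻ x u hu)) (proj₂ (below⁻ x v hv)))
      impl
      where
      impl : ∀ u → below x u ≡ true → does (⊑? X y x) ∧ not (does (x Finₚ.≟ y)) ≡ true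
      impl u hu with below⁻ x u hu
      ... | q , s rewrite does⁺ (⊑? X y x) (⊑-trans (up q here) s) with x Finₚ.≟ y
      ...   | yes refl = ⊥-elim (⊑-antisym-par q s)
      ...   | no _ = refl
    pointwise : ∀ x → isy x + ∑ (allFin n) (λ u → χ (below x u)) ≤ χ (does (⊑? X y x))
    pointwise x = ≤-trans (+-mono-≤ (≤-refl {isy x}) (sum≤ x)) (fin x)
      where
      fin : ∀ x → isy x + χ (does (⊑? X y x) ∧ not (does (x Finₚ.≟ y))) ≤ χ (does (⊑? X y x))
      fin x with x Finₚ.≟ y
      ... | yes refl rewrite does⁺ (⊑? X y y) here = ≤-reflexive (solve 0 (con (+ 1) :* con (+ 1) :+ con (+ 0) := con (+ 1)) refl)
      ... | no _ = ≤-reflexive (trans (cong₂ _+_ (zeroˡ 1ℚ) (cong χ (Boolₚ.∧-identityʳ (does (⊑? X y x))))) (+-identityˡ _))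

  size-child-< : ∀ {X y u} → Uniq X → Par X y u → size X u <ℕ size X y
  size-child-< {X} {y} {u} U q = ι-cancel (≤-trans (≤-reflexive (ι-suc (size X u)))
    (≤-trans (+-mono-≤ (≤-refl {1ℚ}) (≤-trans (≤-reflexive (symm (trans (cong (λ b → χ b * ι (size X u)) (does⁺ (Par? X y u) q)) (*-identityˡ _))))
      (single-≤-∑ (enumFin n) (λ u → χ (does (Par? X y u)) * ι (size X u)) (λ u → 0≤* (0≤χ (does (Par? X y u))) (0≤ι (size X u))) u)))
      (size-children U y)))

  size-⊑ : ∀ {X y x} → Uniq X → X ⊢ y ⊑ x → size X x ≤ℕ size X y
  size-⊑ U here = ℕₚ.≤-refl
  size-⊑ U (up q s) = ℕₚ.≤-trans (ℕₚ.<⇒≤ (size-child-< U q)) (size-⊑ U s)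

  -- Two heavy children would already account for more than `s + s` vertices. Because one threshold
  -- serves the whole tree, its heavy vertices form a single path from the root.
  heavy-child-unique : ∀ {X s y u w} → Uniq X → size X y ≤ℕ s +ℕ s → Par X y u → Par X y w →
    s <ℕ size X u → s <ℕ size X w → u ≡ w
  heavy-child-unique {X} {s} {y} {u} {w} U bound qu qw hu hw with u Finₚ.≟ w
  ... | yes e = e
  ... | no u≢w = ⊥-elim (ℕₚ.<-irrefl refl (ℕₚ.<-≤-trans (ℕₚ.+-mono-< hu hw) (ℕₚ.≤-trans (ℕₚ.n≤1+n _) (ℕₚ.≤-trans total bound))))
    where
    f : Fin n → ℚ
    f v = χ (does (Par? X y v)) * ι (size X v)
    f≡ : ∀ v → Par X y v → ι (size X v) ≡ f v
    f≡ v q = symm (trans (cong (λ b → χ b * ι (size X v)) (does⁺ (Par? X y v) q)) (*-identityˡ _))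
    total : suc (size X u +ℕ size X w) ≤ℕ size X y
    total = ι-cancel (≤-trans (≤-reflexive (trans (ι-suc _) (+ˡ 1ℚ (trans (ι-+ (size X u) (size X w)) (cong₂ _+_ (f≡ u qu) (f≡ w qw))))))
      (≤-trans (+-mono-≤ (≤-refl {1ℚ}) (pair-≤-∑ (enumFin n) f (λ v → 0≤* (0≤χ (does (Par? X y v))) (0≤ι (size X v))) u w u≢w)) (size-children U y)))

-- Kempe changes

inv-≤1 : ∀ m → 1 ≤ℕ m → inv′ m ≤ 1ℚ
inv-≤1 m h = subst₂ _≤_ (*-identityʳ (inv′ m)) (inv-cancel m h) (*-monoˡ (0≤inv m) (ι-mono h))

≡-dec-bool : ∀ {P Q : Set} (d : Dec P) (e : Dec Q) → (P → Q) → (Q → P) → does d ≡ does e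
≡-dec-bool d e f g = ≡-bool (λ h → does⁺ e (f (does⁻ d h))) (λ h → does⁺ d (g (does⁻ e h)))

allᵇ⁻ : ∀ {A : Set} {n} (p : A → Bool) (f : Fin n → A) → allᵇ p (tabulate f) ≡ true → ∀ i → p (f i) ≡ true
allᵇ⁻ p f h zero = proj₁ (∧⁻ h)
allᵇ⁻ p f h (suc i) = allᵇ⁻ p (f ∘ suc) (proj₂ (∧⁻ {p (f zero)} h)) i

allᵇ⁺ : ∀ {A : Set} {n} (p : A → Bool) (f : Fin n → A) → (∀ i → p (f i) ≡ true) → allᵇ p (tabulate f) ≡ true
allᵇ⁺ {n = zero} p f h = refl
allᵇ⁺ {n = suc n} p f h rewrite h zero = allᵇ⁺ p (f ∘ suc) (h ∘ suc)

module _ {n k : ℕ} (G : Graph n) where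

  record Proper (σ : Col k n) : Set where
    constructor mkProper
    field differ : ∀ u w → Adj G u w ≡ true → lookup σ u ≢ lookup σ w
  open Proper public

  record Free (σ : Col k n) (v : Fin n) (c : Fin k) : Set where
    constructor mkFree
    field unused : ∀ w → Adj G v w ≡ true → lookup σ w ≢ c
  open Free public

  private
    clause⁻ : ∀ {a} {x y : Fin k} → not a ∨ not (x ==ᶠ y) ≡ true → a ≡ true → x ≢ y
    clause⁻ {x = x} {y} h refl x≡y with x Finₚ.≟ y
    ... | yes _ = case h of λ ()
    ... | no x≢y = x≢y x≡y

    clause⁺ : ∀ {a} {x y : Fin k} → (a ≡ true → x ≢ y) → not a ∨ not (x ==ᶠ y) ≡ true
    clause⁺ {false} h = refl
    clause⁺ {true} {x} {y} h with x Finₚ.≟ y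
    ... | yes x≡y = ⊥-elim (h refl x≡y)
    ... | no _ = refl

  abstract
    isProper : Col k n → Bool
    isProper = proper G

    isFree : Col k n → Fin n → Fin k → Bool
    isFree σ v c = allᵇ (λ w → not (Adj G v w) ∨ not (lookup σ w ==ᶠ c)) (allFin n)

    isProper≡ : ∀ σ → isProper σ ≡ proper G σ
    isProper≡ σ = refl

    step≡ : ∀ σ v c → step G σ v c ≡ (if isFree σ v c then σ [ v ]≔ c else σ)
    step≡ σ v c = refl

    proper⁻ : ∀ {σ} → isProper σ ≡ true → Proper σ
    proper⁻ {σ} h = mkProper λ u w → clause⁻ (allᵇ⁻ _ id (allᵇ⁻ _ id h u) w)

    proper⁺ : ∀ {σ} → Proper σ → isProper σ ≡ true
    proper⁺ {σ} h = allᵇ⁺ _ id (λ u → allᵇ⁺ _ id (λ w → clause⁺ (differ h u w)))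

    free⁻ : ∀ {σ v c} → isFree σ v c ≡ true → Free σ v c
    free⁻ h = mkFree λ w → clause⁻ (allᵇ⁻ _ id h w)

    free⁺ : ∀ {σ v c} → Free σ v c → isFree σ v c ≡ true
    free⁺ h = allᵇ⁺ _ id (λ w → clause⁺ (unused h w))

  step-free : ∀ {σ v c} → Free σ v c → step G σ v c ≡ σ [ v ]≔ c
  step-free {σ} {v} {c} h = trans (step≡ σ v c) (cong (λ r → if r then σ [ v ]≔ c else σ) (free⁺ h))

  Adj-sym : ∀ {x y} → Adj G x y ≡ true → Adj G y x ≡ true
  Adj-sym {x} {y} h = trans (Graph.sym G y x) h

  Adj-≢ : ∀ {x y} → Adj G x y ≡ true → x ≢ y
  Adj-≢ {x} h refl = case trans (symm (Graph.irrefl G x)) h of λ ()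

  update-proper : ∀ {σ : Col k n} {y c} → (∀ u w → u ≢ y → w ≢ y → Adj G u w ≡ true → lookup σ u ≢ lookup σ w) →
    Free σ y c → Proper (σ [ y ]≔ c)
  differ (update-proper {σ} {y} {c} h fr) u w a e with u Finₚ.≟ y | w Finₚ.≟ y
  ... | yes refl | yes refl = Adj-≢ a refl
  ... | yes refl | no w≢y = unused fr w a (trans (symm (Vecₚ.lookup∘update′ w≢y σ c)) (trans (symm e) (Vecₚ.lookup∘update u σ c)))
  ... | no u≢y | yes refl = unused fr u (Adj-sym a) (trans (symm (Vecₚ.lookup∘update′ u≢y σ c)) (trans e (Vecₚ.lookup∘update w σ c)))
  ... | no u≢y | no w≢y = h u w u≢y w≢y a (trans (symm (Vecₚ.lookup∘update′ u≢y σ c)) (trans e (Vecₚ.lookup∘update′ w≢y σ c)))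

  update-proper′ : ∀ {σ : Col k n} {y c} → Proper σ → Free σ y c → Proper (σ [ y ]≔ c)
  update-proper′ h = update-proper (λ u w _ _ → differ h u w)

Vec-ext : ∀ {A : Set} {n} {u v : Vec A n} → (∀ i → lookup u i ≡ lookup v i) → u ≡ v
Vec-ext {u = u} {v} h = trans (symm (Vecₚ.tabulate∘lookup u)) (trans (Vecₚ.tabulate-cong h) (Vecₚ.tabulate∘lookup v))

module _ {k : ℕ} where

  InAB : Fin k → Fin k → Fin k → Set
  InAB a b c = (c ≡ a) ⊎ (c ≡ b)

  abstract
    inAB? : ∀ a b c → Dec (InAB a b c)
    inAB? a b c = (c Finₚ.≟ a) ⊎-dec (c Finₚ.≟ b)

    sw : Fin k → Fin k → Fin k → Fin k
    sw a b c = if does (c Finₚ.≟ a) then b else (if does (c Finₚ.≟ b) then a else c)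

    inAB : Fin k → Fin k → Fin k → Bool
    inAB a b c = does (inAB? a b c)

    inAB⁻ : ∀ a b c → inAB a b c ≡ true → InAB a b c
    inAB⁻ a b c = does⁻ (inAB? a b c)

    inAB⁺ : ∀ {a b c} → InAB a b c → inAB a b c ≡ true
    inAB⁺ {a} {b} {c} = does⁺ (inAB? a b c)

    sw-a : ∀ a b → sw a b a ≡ b
    sw-a a b rewrite does⁺ (a Finₚ.≟ a) refl = refl

    sw-b : ∀ a b → sw a b b ≡ a
    sw-b a b with b Finₚ.≟ a
    ... | yes b≡a = b≡a
    ... | no _ rewrite does⁺ (b Finₚ.≟ b) refl = refl

    sw-∉ : ∀ {a b c} → ¬ InAB a b c → sw a b c ≡ c
    sw-∉ {a} {b} {c} h with c Finₚ.≟ a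
    ... | yes p = ⊥-elim (h (inj₁ p))
    ... | no _ with c Finₚ.≟ b
    ...   | yes p = ⊥-elim (h (inj₂ p))
    ...   | no _ = refl

    sw-∈ : ∀ {a b c} → InAB a b c → InAB a b (sw a b c)
    sw-∈ {a} {b} (inj₁ refl) = inj₂ (sw-a a b)
    sw-∈ {a} {b} (inj₂ refl) = inj₁ (sw-b a b)

    sw-invol : ∀ a b c → sw a b (sw a b c) ≡ c
    sw-invol a b c with inAB? a b c
    ... | yes (inj₁ refl) = trans (cong (sw a b) (sw-a a b)) (sw-b a b)
    ... | yes (inj₂ refl) = trans (cong (sw a b) (sw-b a b)) (sw-a a b)
    ... | no h = trans (cong (sw a b) (sw-∉ h)) (sw-∉ h)

    sw-sym : ∀ a b c → sw a b c ≡ sw b a c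
    sw-sym a b c with inAB? a b c
    ... | yes (inj₁ refl) = trans (sw-a a b) (symm (sw-b b a))
    ... | yes (inj₂ refl) = trans (sw-b a b) (symm (sw-a b a))
    ... | no h = trans (sw-∉ h) (symm (sw-∉ (λ { (inj₁ p) → h (inj₂ p) ; (inj₂ p) → h (inj₁ p) })))

    sw-inAB : ∀ a b c → inAB a b (sw a b c) ≡ inAB a b c
    sw-inAB a b c = ≡-dec-bool (inAB? a b (sw a b c)) (inAB? a b c)
      (λ h → subst (InAB a b) (sw-invol a b c) (sw-∈ h)) sw-∈

    sw-other : ∀ {a b c d} → a ≢ b → InAB a b c → InAB a b d → c ≢ d → sw a b c ≡ d
    sw-other {a} {b} a≢b (inj₁ refl) (inj₁ refl) c≢d = ⊥-elim (c≢d refl)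
    sw-other {a} {b} a≢b (inj₁ refl) (inj₂ refl) c≢d = sw-a a b
    sw-other {a} {b} a≢b (inj₂ refl) (inj₁ refl) c≢d = sw-b a b
    sw-other {a} {b} a≢b (inj₂ refl) (inj₂ refl) c≢d = ⊥-elim (c≢d refl)

    module _ {n : ℕ} (a b : Fin k) where

      bi : Col k n → Vec Bool n
      bi σ = tabulateᵛ (λ x → inAB a b (lookup σ x))

      bi⁻ : ∀ {σ x} → lookup (bi σ) x ≡ true → InAB a b (lookup σ x)
      bi⁻ {σ} {x} h = inAB⁻ a b (lookup σ x) (trans (symm (Vecₚ.lookup∘tabulate _ x)) h)

      bi⁺ : ∀ {σ x} → InAB a b (lookup σ x) → lookup (bi σ) x ≡ true
      bi⁺ {σ} {x} h = trans (Vecₚ.lookup∘tabulate _ x) (inAB⁺ h)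

      flip : (Fin n → Bool) → Col k n → Col k n
      flip R σ = tabulateᵛ (λ x → if R x then sw a b (lookup σ x) else lookup σ x)

      flip-lookup : ∀ R σ x → lookup (flip R σ) x ≡ (if R x then sw a b (lookup σ x) else lookup σ x)
      flip-lookup R σ x = Vecₚ.lookup∘tabulate _ x

      flip-true : ∀ R σ {x} → R x ≡ true → lookup (flip R σ) x ≡ sw a b (lookup σ x)
      flip-true R σ {x} h = trans (flip-lookup R σ x) (cong (λ r → if r then sw a b (lookup σ x) else lookup σ x) h)

      flip-false : ∀ R σ {x} → R x ≡ false → lookup (flip R σ) x ≡ lookup σ x
      flip-false R σ {x} h = trans (flip-lookup R σ x) (cong (λ r → if r then sw a b (lookup σ x) else lookup σ x) h)

      flip-∈ : ∀ R σ x → InAB a b (lookup σ x) → InAB a b (lookup (flip R σ) x)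
      flip-∈ R σ x h with R x in r
      ... | true = subst (InAB a b) (symm (flip-true R σ r)) (sw-∈ h)
      ... | false = subst (InAB a b) (symm (flip-false R σ r)) h

      flip-∉ : ∀ R σ x → ¬ InAB a b (lookup σ x) → lookup (flip R σ) x ≡ lookup σ x
      flip-∉ R σ x h with R x in r
      ... | true = trans (flip-true R σ r) (sw-∉ h)
      ... | false = flip-false R σ r

      flip-cong : ∀ {R S} σ → (∀ x → R x ≡ S x) → flip R σ ≡ flip S σ
      flip-cong σ h = Vecₚ.tabulate-cong (λ x → cong (λ r → if r then sw a b (lookup σ x) else lookup σ x) (h x))

      -- On vertices coloured `a` or `b` the hypotheses make `R` the symmetric difference of `S` and
      -- `T`; elsewhere the exchange does nothing. With `T` empty it undoes a flip, with `R` and `S`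
      -- disjoint it merges two flips.
      flip-flip : ∀ R S T σ → (∀ x → InAB a b (lookup σ x) → S x ≡ true → (R x ≡ not (T x))) →
        (∀ x → InAB a b (lookup σ x) → S x ≡ false → R x ≡ T x) → flip S (flip R σ) ≡ flip T σ
      flip-flip R S T σ h₁ h₂ = Vec-ext pt
        where
        pt : ∀ x → lookup (flip S (flip R σ)) x ≡ lookup (flip T σ) x
        pt x with inAB? a b (lookup σ x)
        ... | no ∉ = trans (flip-∉ S (flip R σ) x (subst (λ c → ¬ InAB a b c) (symm (flip-∉ R σ x ∉)) ∉)) (trans (flip-∉ R σ x ∉) (symm (flip-∉ T σ x ∉)))
        ... | yes ∈ with S x in s | T x in t
        ...   | true | true = trans (flip-true S (flip R σ) s) (trans (cong (sw a b) (flip-false R σ (trans (h₁ x ∈ s) (cong not t)))) (symm (flip-true T σ t)))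
        ...   | true | false = trans (flip-true S (flip R σ) s) (trans (cong (sw a b) (flip-true R σ (trans (h₁ x ∈ s) (cong not t)))) (trans (sw-invol a b _) (symm (flip-false T σ t))))
        ...   | false | true = trans (flip-false S (flip R σ) s) (trans (flip-true R σ (trans (h₂ x ∈ s) t)) (symm (flip-true T σ t)))
        ...   | false | false = trans (flip-false S (flip R σ) s) (trans (flip-false R σ (trans (h₂ x ∈ s) t)) (symm (flip-false T σ t)))

      bi-flip : ∀ R σ → bi (flip R σ) ≡ bi σ
      bi-flip R σ = Vecₚ.tabulate-cong pt
        where
        pt : ∀ x → inAB a b (lookup (flip R σ) x) ≡ inAB a b (lookup σ x)
        pt x with R x in r
        ... | true = trans (cong (inAB a b) (flip-true R σ r)) (sw-inAB a b _)
        ... | false = cong (inAB a b) (flip-false R σ r)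

      flip-edge : ∀ R σ {x z} → lookup σ x ≢ lookup σ z →
        (InAB a b (lookup σ x) → InAB a b (lookup σ z) → R x ≡ R z) → lookup (flip R σ) x ≢ lookup (flip R σ) z
      flip-edge R σ {x} {z} x≢z h e with inAB? a b (lookup σ x) | inAB? a b (lookup σ z)
      ... | no p | no q = x≢z (trans (symm (flip-∉ R σ x p)) (trans e (flip-∉ R σ z q)))
      ... | no p | yes q = p (subst (InAB a b) (trans (symm e) (flip-∉ R σ x p)) (flip-∈ R σ z q))
      ... | yes p | no q = q (subst (InAB a b) (trans e (flip-∉ R σ z q)) (flip-∈ R σ x p))
      ... | yes p | yes q with R x in r | h p q
      ...   | true | s = x≢z (trans (symm (sw-invol a b _)) (trans (cong (sw a b) (trans (symm (flip-true R σ r)) (trans e (flip-true R σ (symm s))))) (sw-invol a b _)))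
      ...   | false | s = x≢z (trans (symm (flip-false R σ r)) (trans e (flip-false R σ (symm s))))

    bi-sym : ∀ {n} a b (σ : Col k n) → bi a b σ ≡ bi b a σ
    bi-sym a b σ = Vecₚ.tabulate-cong (λ x → ≡-dec-bool (inAB? a b (lookup σ x)) (inAB? b a (lookup σ x))
       (λ { (inj₁ p) → inj₂ p ; (inj₂ p) → inj₁ p }) (λ { (inj₁ p) → inj₂ p ; (inj₂ p) → inj₁ p }))

    flip-sym : ∀ {n} a b R (σ : Col k n) → flip a b R σ ≡ flip b a R σ
    flip-sym a b R σ = Vecₚ.tabulate-cong (λ x → cong (λ c → if R x then c else lookup σ x) (sw-sym a b (lookup σ x)))

module Colourings {n} (G : Graph n) (k : ℕ) where

  Ω : List (Col k n)
  Ω = allCols k n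

  -- `Ω` lists all colourings, proper or not. Properness is carried as a weight, so that the
  -- evaluation rule of the full enumeration remains available.
  ∑Ω : (Col k n → ℚ) → ℚ
  ∑Ω g = ∑ Ω (λ σ → χ (isProper G σ) * g σ)

  ∑Ω-mono : ∀ {f g} → (∀ σ → Proper G σ → f σ ≤ g σ) → ∑Ω f ≤ ∑Ω g
  ∑Ω-mono h = ∑-mono Ω (λ σ → χ-≤ (isProper G σ) (λ p → h σ (proper⁻ G p)))

  ∑Ω-cong : ∀ {f g} → (∀ σ → Proper G σ → f σ ≡ g σ) → ∑Ω f ≡ ∑Ω g
  ∑Ω-cong h = ∑-cong Ω (λ σ → χ-* (isProper G σ) (λ p → h σ (proper⁻ G p)))

  0≤∑Ω : ∀ {f} → (∀ σ → 0ℚ ≤ f σ) → 0ℚ ≤ ∑Ω f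
  0≤∑Ω h = 0≤∑ Ω (λ σ → 0≤* (0≤χ (isProper G σ)) (h σ))

  ∑Ω-*ˡ : ∀ c f → ∑Ω (λ σ → c * f σ) ≡ c * ∑Ω f
  ∑Ω-*ˡ c f = trans (∑-cong Ω (λ σ → solve 3 (λ x y z → x :* (y :* z) := y :* (x :* z)) refl (χ (isProper G σ)) c (f σ))) (∑-*ˡ Ω c _)

  ∑Ω-+ : ∀ f g → ∑Ω (λ σ → f σ + g σ) ≡ ∑Ω f + ∑Ω g
  ∑Ω-+ f g = trans (∑-cong Ω (λ σ → distribˡ (χ (isProper G σ)) (f σ) (g σ))) (∑-+ Ω _ _)

  ∑Ω-- : ∀ f h → ∑Ω (λ σ → f σ - h σ) ≡ ∑Ω f - ∑Ω h
  ∑Ω-- f h = trans (∑-cong Ω (λ σ → solve 3 (λ x y z → x :* (y :- z) := x :* y :- x :* z) refl (χ (isProper G σ)) (f σ) (h σ))) (∑-- Ω _ _)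

  ∑Ω-∑ : ∀ {A : Set} (xs : List A) (f : Col k n → A → ℚ) → ∑Ω (λ σ → ∑ xs (f σ)) ≡ ∑ xs (λ x → ∑Ω (λ σ → f σ x))
  ∑Ω-∑ xs f = trans (∑-cong Ω (λ σ → symm (∑-*ˡ xs (χ (isProper G σ)) (f σ)))) (∑-swap Ω xs _)

module Kempe {n} (G : Graph n) (O : PEO G) (k : ℕ) where
  open Forest G O public

  open Colourings G k public

  -- Two parents of `x` would be adjacent by `clique`, giving a triangle coloured with two colours.
  -- This is where the elimination order makes Kempe components trees.
  colours-uniq : ∀ a b {σ : Col k n} → Proper G σ → Uniq (bi a b σ)
  colours-uniq a b {σ} P {x} {p} {q} (par h₁ h₂ h₃ h₄) (par g₁ g₂ g₃ g₄) with p Finₚ.≟ q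
  ... | yes e = e
  ... | no p≢q = ⊥-elim (pigeon (bi⁻ a b {σ} {x} h₂) (bi⁻ a b {σ} {p} h₁) (bi⁻ a b {σ} {q} g₁)
         (differ P x p (Adj-sym {k = k} G h₃)) (differ P x q (Adj-sym {k = k} G g₃)) (differ P p q (clique (Adj-sym {k = k} G h₃) (Adj-sym {k = k} G g₃) h₄ g₄ p≢q)))
    where
    pigeon : ∀ {x y z : Fin k} → InAB a b x → InAB a b y → InAB a b z → x ≢ y → x ≢ z → y ≢ z → ⊥
    pigeon (inj₁ refl) (inj₁ refl) _ h _ _ = h refl
    pigeon (inj₁ refl) _ (inj₁ refl) _ h _ = h refl
    pigeon _ (inj₁ refl) (inj₁ refl) _ _ h = h refl
    pigeon (inj₂ refl) (inj₂ refl) _ h _ _ = h refl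
    pigeon (inj₂ refl) _ (inj₂ refl) _ h _ = h refl
    pigeon _ (inj₂ refl) (inj₂ refl) _ _ h = h refl

  edge-par : ∀ {X x z} → lookup X x ≡ true → lookup X z ≡ true → Adj G x z ≡ true → Par X x z ⊎ Par X z x
  edge-par {X} {x} {z} hx hz a with ℕₚ.<-cmp (rank x) (rank z)
  ... | tri< l _ _ = inj₁ (par hx hz a l)
  ... | tri≈ _ e _ = ⊥-elim (Adj-≢ {k = k} G a (rank-inj e))
  ... | tri> _ _ g = inj₂ (par hz hx (Adj-sym {k = k} G a) g)

  subtree : Vec Bool n → Fin n → Fin n → Bool
  subtree X v x = does (⊑? X v x)

  root-link : ∀ {X v p x} → Uniq X → Root X v → Par X p x → subtree X v p ≡ subtree X v x
  root-link {X} {v} {p} {x} U (_ , r) q = ≡-dec-bool (⊑? X v p) (⊑? X v x) (up q)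
    (λ s → ⊑-par U q s (λ { refl → r _ q }))

  -- An edge inside the two colour classes joins a parent and a child, and the subtree of a root
  -- contains both of them or neither.
  flip-root-proper : ∀ a b {σ v} → Proper G σ → Root (bi a b σ) v → Proper G (flip a b (subtree (bi a b σ) v) σ)
  differ (flip-root-proper a b {σ} {v} P r) x z adj = flip-edge a b (subtree X v) σ (differ P x z adj)
    (λ hx hz → case edge-par {X} (bi⁺ a b {σ} {x} hx) (bi⁺ a b {σ} {z} hz) adj of λ
       { (inj₁ q) → root-link (colours-uniq a b P) r q ; (inj₂ q) → symm (root-link (colours-uniq a b P) r q) })
    where
    X : Vec Bool n
    X = bi a b σ

  -- Only earlier neighbours forbid a colour: a later neighbour coloured `b` becomes a child of `v`
  -- and is exchanged along with it. Hence the choice at `v` depends on the colours of earlier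
  -- vertices alone.
  Avail : Col k n → Fin n → Fin k → Set
  Avail σ v b = ∀ z → ¬ (Adj G v z ≡ true × rank z <ℕ rank v × lookup σ z ≡ b)

  abstract
    Avail? : ∀ σ v b → Dec (Avail σ v b)
    Avail? σ v b = Finₚ.all? (λ z → ¬? ((Adj G v z Boolₚ.≟ true) ×-dec ((rank z ℕₚ.<? rank v) ×-dec (lookup σ z Finₚ.≟ b))))

  avail : Col k n → Fin n → Fin k → Bool
  avail σ v b = does (Avail? σ v b)

  avail-root : ∀ {σ v b} → Proper G σ → Avail σ v b → Root (bi (lookup σ v) b σ) v
  avail-root {σ} {v} {b} P h = bi⁺ (lookup σ v) b {σ} {v} (inj₁ refl) ,
    λ { p (par h₁ _ h₃ h₄) → case bi⁻ (lookup σ v) b {σ} {p} h₁ of λ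
       { (inj₁ e) → differ P p v h₃ e ; (inj₂ e) → h p (Adj-sym {k = k} G h₃ , h₄ , e) } }

  kempe : Col k n → Fin n → Fin k → Col k n
  kempe σ v b = flip (lookup σ v) b (subtree (bi (lookup σ v) b σ) v) σ

  kempe-proper : ∀ {σ v b} → Proper G σ → Avail σ v b → Proper G (kempe σ v b)
  kempe-proper {σ} {v} {b} P h = flip-root-proper (lookup σ v) b {σ} P (avail-root P h)

  kempe-at : ∀ σ v b → lookup (kempe σ v b) v ≡ b
  kempe-at σ v b = trans (flip-true (lookup σ v) b _ σ (does⁺ (⊑? (bi (lookup σ v) b σ) v v) here)) (sw-a (lookup σ v) b)

  kempe-earlier : ∀ σ v b {x} → rank x <ℕ rank v → lookup (kempe σ v b) x ≡ lookup σ x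
  kempe-earlier σ v b {x} lt = flip-false (lookup σ v) b _ σ
    (dec-false (⊑? (bi (lookup σ v) b σ) v x) (λ s → ℕₚ.<-irrefl refl (ℕₚ.<-≤-trans lt (⊑-rank s))))

  kempe-kempe : ∀ σ v b → kempe (kempe σ v b) v (lookup σ v) ≡ σ
  kempe-kempe σ v b rewrite kempe-at σ v b = trans
    (cong (λ X → flip b a (subtree X v) τ) (trans (bi-sym b a τ) (bi-flip a b _ σ)))
    (trans (flip-sym b a _ τ) (trans (flip-flip a b R R (λ _ → false) σ (λ x _ h → h) (λ x _ h → h))
      (Vec-ext (λ x → flip-false a b (λ _ → false) σ refl))))
    where
    a : Fin k
    a = lookup σ v
    R : Fin n → Bool
    R = subtree (bi a b σ) v
    τ : Col k n
    τ = flip a b R σ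

  avail-local : ∀ {σ τ v} → (∀ x → rank x <ℕ rank v → lookup σ x ≡ lookup τ x) → ∀ b → avail σ v b ≡ avail τ v b
  avail-local {σ} {τ} {v} h b = ≡-dec-bool (Avail? σ v b) (Avail? τ v b)
    (λ f z → λ { (p , q , r) → f z (p , q , trans (h z q) r) }) (λ f z → λ { (p , q , r) → f z (p , q , trans (symm (h z q)) r) })

  avail-kempe : ∀ σ v b c → avail (kempe σ v b) v c ≡ avail σ v c
  avail-kempe σ v b = avail-local (λ x → kempe-earlier σ v b)

  avail-self : ∀ {σ v} → Proper G σ → avail σ v (lookup σ v) ≡ true
  avail-self {σ} {v} P = does⁺ (Avail? σ v (lookup σ v)) (λ { z (p , _ , e) → differ P z v (Adj-sym {k = k} G p) e })

  #avail : Col k n → Fin n → ℕ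
  #avail σ v = length (filterᵇ (avail σ v) (allFin k))

  ι-#avail : ∀ σ v → ι (#avail σ v) ≡ ∑ (allFin k) (λ b → χ (avail σ v b))
  ι-#avail σ v = ι-count (avail σ v) (allFin k)

  #avail-local : ∀ {σ τ v} → (∀ x → rank x <ℕ rank v → lookup σ x ≡ lookup τ x) → #avail σ v ≡ #avail τ v
  #avail-local {σ} {τ} {v} h = ℕₚ.≤-antisym (ι-cancel (le σ τ h)) (ι-cancel (le τ σ (λ x l → symm (h x l))))
    where
    le : ∀ σ τ → (∀ x → rank x <ℕ rank v → lookup σ x ≡ lookup τ x) → ι (#avail σ v) ≤ ι (#avail τ v)
    le σ τ h = ≤-reflexive (trans (ι-#avail σ v) (trans (∑-cong (allFin k) (λ b → cong χ (avail-local h b))) (symm (ι-#avail τ v))))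

  #avail≥1 : ∀ {σ v} → Proper G σ → 1 ≤ℕ #avail σ v
  #avail≥1 {σ} {v} P = ι-cancel (≤-trans (≤-reflexive (symm (cong χ (avail-self P))))
    (subst (χ (avail σ v (lookup σ v)) ≤_) (symm (ι-#avail σ v)) (single-≤-∑ (enumFin k) _ (λ b → 0≤χ (avail σ v b)) (lookup σ v))))

  -- Resampling the colour of v by a random Kempe change; doing this for every vertex in order of rank yields an exactly uniform colouring.
  resample : Fin n → (Col k n → ℚ) → Col k n → ℚ
  resample v g σ = ∑ (allFin k) (λ b → (inv′ (#avail σ v) * χ (avail σ v b)) * g (kempe σ v b))

  0≤weight : ∀ σ v b → 0ℚ ≤ inv′ (#avail σ v) * χ (avail σ v b)
  0≤weight σ v b = 0≤* (0≤inv (#avail σ v)) (0≤χ (avail σ v b))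

  weight-sum : ∀ {σ} v → Proper G σ → ∑ (allFin k) (λ b → inv′ (#avail σ v) * χ (avail σ v b)) ≡ 1ℚ
  weight-sum {σ} v P = trans (∑-*ˡ (allFin k) _ _) (trans (cong (inv′ (#avail σ v) *_) (symm (ι-#avail σ v))) (inv-cancel _ (#avail≥1 P)))

  -- Reversibility: the pair of `σ` and `b` is exchanged with the pair of `kempe σ v b` and the old
  -- colour of `v`. Both ends have equally many available colours, since a Kempe change at `v`
  -- leaves earlier vertices alone.
  ∑Ω-resample : ∀ v g → ∑Ω (resample v g) ≡ ∑Ω g
  ∑Ω-resample v g = trans (∑-cong Ω lhs) (trans (symm (∑-× (enumCol k n) (enumFin k) _))
    (trans (reindex-involution E p φ closed invol h) (trans (∑-× (enumCol k n) (enumFin k) _) (∑-cong Ω rhs))))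
    where
    E : Enum (Col k n × Fin k)
    E = enumCol k n ×ᵉ enumFin k
    p : Col k n × Fin k → Bool
    p (σ , b) = isProper G σ ∧ avail σ v b
    φ : Col k n × Fin k → Col k n × Fin k
    φ (σ , b) = kempe σ v b , lookup σ v
    h : Col k n × Fin k → ℚ
    h (σ , b) = inv′ (#avail σ v) * g σ
    closed : ∀ x → p x ≡ true → p (φ x) ≡ true
    closed (σ , b) e with ∧⁻ {isProper G σ} {avail σ v b} e
    ... | e₁ , e₂ = cong₂ _∧_ (proper⁺ G (kempe-proper (proper⁻ G e₁) (does⁻ (Avail? σ v b) e₂)))
      (trans (avail-kempe σ v b (lookup σ v)) (avail-self (proper⁻ G e₁)))
    invol : ∀ x → p x ≡ true → φ (φ x) ≡ x
    invol (σ , b) e = cong₂ _,_ (kempe-kempe σ v b) (kempe-at σ v b)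
    lhs : ∀ σ → χ (isProper G σ) * resample v g σ ≡ ∑ (allFin k) (λ b → χ (p (σ , b)) * h (φ (σ , b)))
    lhs σ = trans (symm (∑-*ˡ (allFin k) _ _)) (∑-cong (allFin k) (λ b → trans
      (solve 4 (λ x y z w → x :* ((y :* z) :* w) := (x :* z) :* (y :* w)) refl (χ (isProper G σ)) (inv′ (#avail σ v)) (χ (avail σ v b)) (g (kempe σ v b)))
      (cong₂ _*_ (symm (χ-∧ (isProper G σ) (avail σ v b)))
        (cong (λ m → inv′ m * g (kempe σ v b)) (#avail-local (λ x l → symm (kempe-earlier σ v b l)))))))
    rhs : ∀ σ → ∑ (allFin k) (λ b → χ (p (σ , b)) * h (σ , b)) ≡ χ (isProper G σ) * g σ
    rhs σ = trans (∑-cong (allFin k) (λ b → trans (cong (_* h (σ , b)) (χ-∧ (isProper G σ) (avail σ v b)))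
      (solve 4 (λ x y z w → (x :* z) :* (y :* w) := (x :* w) :* (y :* z)) refl (χ (isProper G σ)) (inv′ (#avail σ v)) (χ (avail σ v b)) (g σ))))
      (trans (∑-*ˡ (allFin k) _ _) (trans (*-assoc _ _ _) (χ-* (isProper G σ) (λ e → trans (cong (g σ *_) (weight-sum v (proper⁻ G e))) (*-identityʳ (g σ))))))

  resample-jensen : ∀ v g σ → Proper G σ → sq (resample v g σ) ≤ resample v (λ τ → sq (g τ)) σ
  resample-jensen v g σ P = jensen (allFin k) _ (λ b → g (kempe σ v b)) (0≤weight σ v) (≤-reflexive (weight-sum v P))

  Local : ℕ → (Col k n → ℚ) → Set
  Local t g = ∀ σ τ → Proper G σ → Proper G τ → (∀ x → rank x <ℕ t → lookup σ x ≡ lookup τ x) → g σ ≡ g τ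

  -- The Kempe change keeps the earlier colours and sets `v` to `b`, and `g` reads nothing beyond
  -- `v`; so the old colour of `v` is forgotten.
  resample-local : ∀ v g → Local (suc (rank v)) g → Local (rank v) (resample v g)
  resample-local v g L σ τ Pσ Pτ h = ∑-cong (allFin k) (λ b → trans
    (cong (λ m → (inv′ m * χ (avail σ v b)) * g (kempe σ v b)) (#avail-local h))
    (trans (*-assoc _ _ _) (trans (cong (inv′ (#avail τ v) *_) (trans (χ-* (avail σ v b) (go b)) (cong (λ x → χ x * g (kempe τ v b)) (avail-local h b)))) (symm (*-assoc _ _ _)))))
    where
    go : ∀ b → avail σ v b ≡ true → g (kempe σ v b) ≡ g (kempe τ v b)
    go b e = L _ _ (kempe-proper Pσ (does⁻ (Avail? σ v b) e)) (kempe-proper Pτ (does⁻ (Avail? τ v b) (trans (symm (avail-local h b)) e))) agree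
      where
      agree : ∀ x → rank x <ℕ suc (rank v) → lookup (kempe σ v b) x ≡ lookup (kempe τ v b) x
      agree x l with ℕₚ.m≤n⇒m<n∨m≡n (ℕₚ.≤-pred l)
      ... | inj₁ lt = trans (kempe-earlier σ v b lt) (trans (h x lt) (symm (kempe-earlier τ v b lt)))
      ... | inj₂ e' rewrite rank-inj e' = trans (kempe-at σ v b) (symm (kempe-at τ v b))

  at-rank? : ∀ t → Dec (∃ λ v → rank v ≡ t)
  at-rank? t = Finₚ.any? (λ v → rank v ℕₚ.≟ t)

  resampleAt : ℕ → (Col k n → ℚ) → Col k n → ℚ
  resampleAt t g with at-rank? t
  ... | yes (v , _) = resample v g
  ... | no _ = g

  -- On functions the operators act in decreasing order of rank, which describes the process that
  -- resamples in increasing order. Each one removes the dependence on one more vertex.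
  sweep : ℕ → (Col k n → ℚ) → Col k n → ℚ
  sweep zero f = f
  sweep (suc t) f = sweep t (resampleAt t f)

  resampleAt-local : ∀ t g → Local (suc t) g → Local t (resampleAt t g)
  resampleAt-local t g L with at-rank? t
  ... | yes (v , refl) = resample-local v g L
  ... | no h = λ σ τ P Q e → L σ τ P Q (λ x l → e x (ℕₚ.≤∧≢⇒< (ℕₚ.≤-pred l) (λ r → h (x , r))))

  sweep-local : ∀ t g → Local t g → Local 0 (sweep t g)
  sweep-local zero g L = L
  sweep-local (suc t) g L = sweep-local t _ (resampleAt-local t g L)

  sweep-const : ∀ f {σ τ} → Proper G σ → Proper G τ → sweep n f σ ≡ sweep n f τ
  sweep-const f P Q = sweep-local n f (λ σ τ _ _ h → cong f (Vec-ext (λ x → h x (rank<n x)))) _ _ P Q (λ _ ())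

  resampleAt-cong : ∀ t {f g} → (∀ σ → f σ ≡ g σ) → ∀ σ → resampleAt t f σ ≡ resampleAt t g σ
  resampleAt-cong t h σ with at-rank? t
  ... | yes (v , _) = ∑-cong (allFin k) (λ b → cong ((inv′ (#avail σ v) * χ (avail σ v b)) *_) (h (kempe σ v b)))
  ... | no _ = h σ

  sweep-cong : ∀ t {f g} → (∀ σ → f σ ≡ g σ) → ∀ σ → sweep t f σ ≡ sweep t g σ
  sweep-cong zero h = h
  sweep-cong (suc t) h = sweep-cong t (resampleAt-cong t h)

  resampleAt-- : ∀ t f g σ → resampleAt t (λ τ → f τ - g τ) σ ≡ resampleAt t f σ - resampleAt t g σ
  resampleAt-- t f g σ with at-rank? t
  ... | yes (v , _) = trans (∑-cong (allFin k) (λ b → solve 3 (λ x y z → x :* (y :- z) := x :* y :- x :* z) refl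
           (inv′ (#avail σ v) * χ (avail σ v b)) (f (kempe σ v b)) (g (kempe σ v b)))) (∑-- (allFin k) _ _)
  ... | no _ = refl

  sweep-- : ∀ t f g σ → sweep t (λ τ → f τ - g τ) σ ≡ sweep t f σ - sweep t g σ
  sweep-- zero f g σ = refl
  sweep-- (suc t) f g σ = trans (sweep-cong t (resampleAt-- t f g) σ) (sweep-- t (resampleAt t f) (resampleAt t g) σ)

  ∑Ω-resampleAt-sq : ∀ t g → ∑Ω (λ σ → sq (resampleAt t g σ)) ≤ ∑Ω (λ σ → sq (g σ))
  ∑Ω-resampleAt-sq t g with at-rank? t
  ... | yes (v , _) = ≤-trans (∑Ω-mono (resample-jensen v g)) (≤-reflexive (∑Ω-resample v (λ σ → sq (g σ))))
  ... | no _ = ≤-refl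

  ∑Ω-sweep-sq : ∀ t g → ∑Ω (λ σ → sq (sweep t g σ)) ≤ ∑Ω (λ σ → sq (g σ))
  ∑Ω-sweep-sq zero g = ≤-refl
  ∑Ω-sweep-sq (suc t) g = ≤-trans (∑Ω-sweep-sq t (resampleAt t g)) (∑Ω-resampleAt-sq t g)

  -- The differences are arranged so that `sweep s` stands outside, where it is a contraction by
  -- `∑Ω-sweep-sq`. What remains inside is the effect of a single resampling.
  telescope : ∀ t f σ → f σ - sweep t f σ ≡ ∑ (downFrom t) (λ s → sweep s (λ τ → f τ - resampleAt s f τ) σ)
  telescope zero f σ = solve 1 (λ x → x :- x := con (+ 0)) refl (f σ)
  telescope (suc t) f σ = trans (solve 3 (λ x y z → x :- z := (y :- z) :+ (x :- y)) refl (f σ) (sweep t f σ) (sweep t (resampleAt t f) σ))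
    (cong₂ _+_ (symm (sweep-- t f (resampleAt t f) σ)) (telescope t f σ))

  flipEnergy : (Col k n → ℚ) → ℚ
  flipEnergy f = ∑ (allFin n) (λ v → ∑Ω (λ σ → ∑ (allFin k) (λ b → χ (avail σ v b) * sq (f σ - f (kempe σ v b)))))

  resampleAt-energy : ∀ t f → ∑Ω (λ σ → sq (f σ - resampleAt t f σ)) ≤ flipEnergy f
  resampleAt-energy t f with at-rank? t
  ... | yes (v , _) = ≤-trans (∑Ω-mono bound) (single-≤-∑ (enumFin n) _ (λ u → 0≤∑Ω (λ σ → 0≤∑ (allFin k) (λ b → 0≤* (0≤χ (avail σ u b)) (0≤sq _)))) v)
    where
    bound : ∀ σ → Proper G σ → sq (f σ - resample v f σ) ≤ ∑ (allFin k) (λ b → χ (avail σ v b) * sq (f σ - f (kempe σ v b)))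
    bound σ P = ≤-trans (≤-reflexive (cong sq eq)) (≤-trans
      (jensen (allFin k) _ (λ b → f σ - f (kempe σ v b)) (0≤weight σ v) (≤-reflexive (weight-sum v P)))
      (∑-mono (allFin k) (λ b → *-monoʳ (0≤sq (f σ - f (kempe σ v b)))
        (subst (λ z → w b ≤ z) (*-identityˡ (χ (avail σ v b))) (*-monoʳ (0≤χ (avail σ v b)) (inv-≤1 (#avail σ v) (#avail≥1 P)))))))
      where
      w : Fin k → ℚ
      w b = inv′ (#avail σ v) * χ (avail σ v b)
      eq : f σ - resample v f σ ≡ ∑ (allFin k) (λ b → w b * (f σ - f (kempe σ v b)))
      eq = symm (trans (∑-cong (allFin k) (λ b → solve 3 (λ x y z → x :* (y :- z) := x :* y :- x :* z) refl (w b) (f σ) (f (kempe σ v b))))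
        (trans (∑-- (allFin k) _ _) (cong (_- resample v f σ) (trans (∑-*ʳ (allFin k) (f σ) w) (trans (cong (_* f σ) (weight-sum v P)) (*-identityˡ (f σ)))))))
  ... | no _ = ≤-trans (≤-reflexive (trans (∑-cong Ω (λ σ → solve 2 (λ x y → y :* ((x :- x) :* (x :- x)) := con (+ 0)) refl (f σ) (χ (isProper G σ)))) (∑-zero Ω)))
    (0≤∑ (allFin n) (λ u → 0≤∑Ω (λ σ → 0≤∑ (allFin k) (λ b → 0≤* (0≤χ (avail σ u b)) (0≤sq _)))))

  -- One factor `n` is Cauchy-Schwarz over the terms of `telescope`; the other comes from charging
  -- the whole `flipEnergy` to each term.
  flip-poincaré : ∀ f → ∑Ω (λ σ → sq (f σ - sweep n f σ)) ≤ ι n * (ι n * flipEnergy f)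
  flip-poincaré f = ≤-trans (∑Ω-mono bound) (≤-trans (≤-reflexive (trans (∑Ω-*ˡ (ι n) _) (cong (ι n *_) (∑Ω-∑ (downFrom n) _))))
    (*-monoˡ (0≤ι n) (≤-trans (∑-mono (downFrom n) (λ s → ≤-trans (∑Ω-sweep-sq s _) (resampleAt-energy s f)))
      (≤-reflexive (trans (∑-const (downFrom n) (flipEnergy f)) (cong (λ m → ι m * flipEnergy f) (Listₚ.length-downFrom n)))))))
    where
    d : Col k n → ℕ → ℚ
    d σ s = sweep s (λ τ → f τ - resampleAt s f τ) σ
    bound : ∀ σ → Proper G σ → sq (f σ - sweep n f σ) ≤ ι n * ∑ (downFrom n) (λ s → sq (d σ s))
    bound σ _ = ≤-trans (≤-reflexive (cong sq (trans (telescope n f σ) (∑-cong (downFrom n) (λ s → symm (*-identityˡ (d σ s)))))))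
      (≤-trans (cauchy-schwarz (downFrom n) (λ _ → 1ℚ) (d σ) (λ _ → 0≤ι 1)) (≤-reflexive (cong₂ _*_
        (trans (∑-const (downFrom n) 1ℚ) (trans (*-identityʳ _) (cong ι (Listₚ.length-downFrom n)))) (∑-cong (downFrom n) (λ s → *-identityˡ (sq (d σ s)))))))

-- Recolouring a Kempe tree along its heavy path

update-cong : ∀ {A : Set} {n} {u v : Vec A n} {y : Fin n} {c d : A} → c ≡ d →
  (∀ x → x ≢ y → lookup u x ≡ lookup v x) → u [ y ]≔ c ≡ v [ y ]≔ d
update-cong {u = u} {v} {y} {c} refl h = Vec-ext pt
  where
  pt : ∀ x → lookup (u [ y ]≔ c) x ≡ lookup (v [ y ]≔ c) x
  pt x with x Finₚ.≟ y
  ... | yes refl = trans (Vecₚ.lookup∘update x u c) (symm (Vecₚ.lookup∘update x v c))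
  ... | no x≢y = trans (Vecₚ.lookup∘update′ x≢y u c) (trans (h x x≢y) (symm (Vecₚ.lookup∘update′ x≢y v c)))

update-≡ : ∀ {A : Set} {n} {u v : Vec A n} {y : Fin n} {c : A} → lookup v y ≡ c →
  (∀ x → x ≢ y → lookup u x ≡ lookup v x) → u [ y ]≔ c ≡ v
update-≡ {u = u} {v} {y} {c} e h = Vec-ext pt
  where
  pt : ∀ x → lookup (u [ y ]≔ c) x ≡ lookup v x
  pt x with x Finₚ.≟ y
  ... | yes refl = trans (Vecₚ.lookup∘update x u c) (symm e)
  ... | no x≢y = trans (Vecₚ.lookup∘update′ x≢y u c) (h x x≢y)

module _ {n k : ℕ} (G : Graph n) where

  proper→free : ∀ {σ : Col k n} {y c} → Proper G (σ [ y ]≔ c) → Free G σ y c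
  unused (proper→free {σ} {y} {c} P) w a e = differ P y w a (trans (Vecₚ.lookup∘update y σ c)
    (symm (trans (Vecₚ.lookup∘update′ (λ w≡y → Adj-≢ {k = k} G a (symm w≡y)) σ c) e)))

module Walk {n} (G : Graph n) (O : PEO G) (k : ℕ) (a b : Fin k) (a≢b : a ≢ b) (s : ℕ) where
  open Kempe G O k public

  AB : Fin k → Set
  AB = InAB a b

  biᵃᵇ : Col k n → Vec Bool n
  biᵃᵇ = bi a b

  other : Fin k → Fin k
  other = sw a b

  child-of : ∀ {X y x} → X ⊢ y ⊑ x → y ≢ x → ∃ λ u → Par X y u × X ⊢ u ⊑ x
  child-of here y≢x = ⊥-elim (y≢x refl)
  child-of {X} {y} (up {p} q t) y≢x with y Finₚ.≟ p
  ... | yes refl = _ , q , here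
  ... | no y≢p with child-of t y≢p
  ...   | u , r , t' = u , r , up q t'

  size-cong : ∀ {X Y u} → (∀ x → subtree X u x ≡ subtree Y u x) → size X u ≡ size Y u
  size-cong {X} {Y} {u} h = ℕₚ.≤-antisym (ι-cancel (≤-reflexive eq)) (ι-cancel (≤-reflexive (symm eq)))
    where
    eq : ι (size X u) ≡ ι (size Y u)
    eq = trans (ι-size X u) (trans (∑-cong (allFin n) (λ x → cong χ (h x))) (symm (ι-size Y u)))

  -- The counter `t` runs over vertex indices rather than over children: at `t = 0` no light child
  -- of `y` is done, at `t = n` all are, and indices of other vertices are passed over without
  -- change.
  data Region (X : Vec Bool n) (v y : Fin n) (t : ℕ) (x : Fin n) : Set where
    above : X ⊢ v ⊑ x → ¬ X ⊢ y ⊑ x → Region X v y t x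
    light : ∀ {u} → Par X y u → size X u ≤ℕ s → toℕ u <ℕ t → X ⊢ u ⊑ x → Region X v y t x

  abstract
    Region? : ∀ X v y t x → Dec (Region X v y t x)
    Region? X v y t x = map′ (λ { (inj₁ (p , q)) → above p q ; (inj₂ (u , (p , q) , (r , z))) → light p q r z })
      (λ { (above p q) → inj₁ (p , q) ; (light p q r z) → inj₂ (_ , (p , q) , (r , z)) })
      ((⊑? X v x ×-dec ¬? (⊑? X y x)) ⊎-dec Finₚ.any? (λ u → (Par? X y u ×-dec (size X u ℕₚ.≤? s)) ×-dec ((toℕ u ℕₚ.<? t) ×-dec ⊑? X u x)))

  region : Vec Bool n → Fin n → Fin n → ℕ → Fin n → Bool
  region X v y t x = does (Region? X v y t x)

  -- The colouring reached on the way from σ to its Kempe change at the root v when y carries the temporary colour c: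
  -- everything not below y, and the light subtrees hanging from children u < t of y, has been recoloured.
  stage : Col k n → Fin n → Fin n → ℕ → Fin k → Col k n
  stage σ v y t c = flip a b (region (biᵃᵇ σ) v y t) σ [ y ]≔ c

  -- Freeness refers to the initial `σ`, not to a stage. Exchanging `a` and `b` never creates or
  -- removes a neighbour of colour `c` when `c` is neither, so the same temporary colours serve for
  -- all stages at `y`.
  record Ok (σ : Col k n) (y : Fin n) (c : Fin k) : Set where
    constructor mkOk
    field
      fresh : ¬ AB c
      freeᵒ : Free G σ y c
  open Ok public

  abstract
    Ok? : ∀ σ y c → Dec (Ok σ y c)
    Ok? σ y c with inAB? a b c | isFree G σ y c in e
    ... | yes h | _ = no (λ o → fresh o h)
    ... | no h | true = yes (mkOk h (free⁻ G e))
    ... | no h | false = no (λ o → case trans (symm (free⁺ G (freeᵒ o))) e of λ ())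

  ok : Col k n → Fin n → Fin k → Bool
  ok σ y c = does (Ok? σ y c)

  module _ {σ : Col k n} (P : Proper G σ) where
    private
      X : Vec Bool n
      X = biᵃᵇ σ
      U : Uniq X
      U = colours-uniq a b P

    ∈X : ∀ {v x} → Root X v → X ⊢ v ⊑ x → AB (lookup σ x)
    ∈X {v} {x} r h = bi⁻ a b {σ} {x} (⊑-∈ h (proj₁ r))

    -- Hence every tree edge leaving the region ends in `y`. As `y` carries a colour outside the
    -- pair, no edge becomes monochromatic.
    region-link : ∀ {v y t p x} → Root X v → X ⊢ v ⊑ y → Par X p x → p ≢ y → x ≢ y → region X v y t p ≡ region X v y t x
    region-link {v} {y} {t} {p} {x} r vy q p≢y x≢y = ≡-dec-bool (Region? X v y t p) (Region? X v y t x) down upw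
      where
      down : Region X v y t p → Region X v y t x
      down (above h g) = above (up q h) (λ yx → g (⊑-par U q yx (x≢y ∘ symm)))
      down (light h₁ h₂ h₃ h₄) = light h₁ h₂ h₃ (up q h₄)
      upw : Region X v y t x → Region X v y t p
      upw (above h g) = above (⊑-par U q h (λ { refl → proj₂ r _ q })) (λ yp → g (up q yp))
      upw (light h₁ h₂ h₃ h₄) = light h₁ h₂ h₃ (⊑-par U q h₄ (λ { refl → p≢y (U q h₁) }))

    flip-avoids : ∀ R {y c} → Ok σ y c → Free G (flip a b R σ) y c
    unused (flip-avoids R {y} {c} o) w adj e with inAB? a b (lookup σ w)
    ... | yes h = fresh o (subst AB e (flip-∈ a b R σ w h))
    ... | no h = unused (freeᵒ o) w adj (trans (symm (flip-∉ a b R σ w h)) e)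

    stage-proper : ∀ {v y t c} → Root X v → X ⊢ v ⊑ y → Ok σ y c → Proper G (stage σ v y t c)
    stage-proper {v} {y} {t} {c} r vy o = update-proper G (λ x z x≢y z≢y adj → flip-edge a b (region X v y t) σ (differ P x z adj)
        (λ hx hz → case edge-par {X} (bi⁺ a b {σ} {x} hx) (bi⁺ a b {σ} {z} hz) adj of λ
          { (inj₁ q) → region-link r vy q x≢y z≢y ; (inj₂ q) → symm (region-link r vy q z≢y x≢y) }))
      (flip-avoids (region X v y t) o)

    -- The temporary colour cuts `y` out of the forest and changes nothing else. The children of `y`
    -- thus become roots (`detached-root`), so that a light subtree is a Kempe component in its own
    -- right.
    stage-bi : ∀ {v y t c} → ¬ AB c → biᵃᵇ (stage σ v y t c) ≡ X [ y ]≔ false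
    stage-bi {v} {y} {t} {c} c∉ = symm (update-≡ at off)
      where
      ρ τ : Col k n
      ρ = flip a b (region X v y t) σ
      τ = stage σ v y t c
      at : lookup (biᵃᵇ τ) y ≡ false
      at with lookup (biᵃᵇ τ) y in e
      ... | false = refl
      ... | true = ⊥-elim (c∉ (subst AB (Vecₚ.lookup∘update y ρ c) (bi⁻ a b {τ} {y} e)))
      off : ∀ x → x ≢ y → lookup X x ≡ lookup (biᵃᵇ τ) x
      off x x≢y = ≡-bool
        (λ h → bi⁺ a b {τ} {x} (subst AB (symm (Vecₚ.lookup∘update′ x≢y ρ c)) (flip-∈ a b (region X v y t) σ x (bi⁻ a b {σ} {x} h))))
        (λ h → trans (cong (λ Y → lookup Y x) (symm (bi-flip a b (region X v y t) σ)))
          (bi⁺ a b {flip a b (region X v y t) σ} {x} (subst AB (Vecₚ.lookup∘update′ x≢y ρ c) (bi⁻ a b {τ} {x} h))))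

    stage-bi⁻ : ∀ {v y t c} → Root X v → X ⊢ v ⊑ y → ¬ AB c → biᵃᵇ (stage σ v y t c) [ y ]≔ true ≡ X
    stage-bi⁻ {v} {y} {t} {c} r vy c∉ = trans (cong (_[ y ]≔ true) (stage-bi {v} {y} {t} c∉))
      (update-≡ (⊑-∈ vy (proj₁ r)) (λ x x≢y → Vecₚ.lookup∘update′ x≢y X false))

    stage-start : ∀ v c → stage σ v v 0 c ≡ σ [ v ]≔ c
    stage-start v c = update-cong refl (λ x _ → flip-false a b (region X v v 0) σ (dec-false (Region? X v v 0 x) (λ { (above h g) → g h ; (light _ _ () _) })))

    module _ (y : Fin n) where
      private
        X' : Vec Bool n
        X' = X [ y ]≔ false

      Par⁻ : ∀ {p x} → Par X' p x → Par X p x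
      Par⁻ {p} {x} (par h₁ h₂ h₃ h₄) = par (weaken p h₁) (weaken x h₂) h₃ h₄
        where
        weaken : ∀ x → lookup X' x ≡ true → lookup X x ≡ true
        weaken x h with x Finₚ.≟ y
        ... | yes refl = case trans (symm h) (Vecₚ.lookup∘update x X false) of λ ()
        ... | no x≢y = trans (symm (Vecₚ.lookup∘update′ x≢y X false)) h

      Par⁺ : ∀ {p x} → p ≢ y → x ≢ y → Par X p x → Par X' p x
      Par⁺ p≢y x≢y (par h₁ h₂ h₃ h₄) = par (trans (Vecₚ.lookup∘update′ p≢y X false) h₁) (trans (Vecₚ.lookup∘update′ x≢y X false) h₂) h₃ h₄

      ⊑⁻ : ∀ {u x} → X' ⊢ u ⊑ x → X ⊢ u ⊑ x
      ⊑⁻ here = here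
      ⊑⁻ (up q h) = up (Par⁻ q) (⊑⁻ h)

      below-≢ : ∀ {u x} → Par X y u → X ⊢ u ⊑ x → x ≢ y
      below-≢ q h refl = ⊑-antisym-par q h

      ⊑⁺ : ∀ {u x} → Par X y u → X ⊢ u ⊑ x → X' ⊢ u ⊑ x
      ⊑⁺ q here = here
      ⊑⁺ q (up q' h) = up (Par⁺ (below-≢ q h) (below-≢ q (up q' h)) q') (⊑⁺ q h)

      detached-subtree : ∀ {u} → Par X y u → ∀ x → subtree X' u x ≡ subtree X u x
      detached-subtree {u} q x = ≡-dec-bool (⊑? X' u x) (⊑? X u x) ⊑⁻ (⊑⁺ q)

      detached-size : ∀ {u} → Par X y u → size X' u ≡ size X u
      detached-size {u} q = size-cong (detached-subtree q)

      detached-root : ∀ {u} → Par X y u → Root X' u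
      detached-root {u} q = trans (Vecₚ.lookup∘update′ (below-≢ q here) X false) (Par.child∈ q) ,
        λ p q' → case U (Par⁻ q') q of λ { refl → case trans (symm (Par.parent∈ q')) (Vecₚ.lookup∘update y X false) of λ () }

    -- When its turn comes, `u` still has its original colour; the decoding in `lightPart-sum` reads
    -- the original colour of `y` off it.
    region-self : ∀ {v y u} → Par X y u → ¬ Region X v y (toℕ u) u
    region-self q (above _ g) = g (up q here)
    region-self q (light q' _ l h) = case siblings U q' q h here of λ { refl → ℕₚ.<-irrefl refl l }

    -- The regions before and after the turn of `u` differ by exactly the subtree of `u`, which is
    -- disjoint from the former. The forest of the stage has this same subtree below `u`, so the
    -- step is a Kempe change of the stage itself.
    stage-flip : ∀ {v y u c} → Par X y u → size X u ≤ℕ s → ¬ AB c →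
      stage σ v y (suc (toℕ u)) c ≡ flip a b (subtree (biᵃᵇ (stage σ v y (toℕ u) c)) u) (stage σ v y (toℕ u) c)
    stage-flip {v} {y} {u} {c} q l c∉ = trans (update-≡ at off) (flip-cong a b τ (λ x → symm (trans (cong (λ Y → subtree Y u x) (stage-bi {v} {y} {toℕ u} c∉)) (detached-subtree y q x))))
      where
      τ : Col k n
      τ = stage σ v y (toℕ u) c
      S R T : Fin n → Bool
      S = subtree X u
      R = region X v y (toℕ u)
      T = region X v y (suc (toℕ u))
      at : lookup (flip a b S τ) y ≡ c
      at = trans (flip-false a b S τ (dec-false (⊑? X u y) (⊑-antisym-par q))) (Vecₚ.lookup∘update y (flip a b R σ) c)
      R⇒T : ∀ x → Region X v y (toℕ u) x → Region X v y (suc (toℕ u)) x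
      R⇒T x (above h g) = above h g
      R⇒T x (light h₁ h₂ h₃ h₄) = light h₁ h₂ (ℕₚ.m≤n⇒m≤1+n h₃) h₄
      T⇒ : ∀ x → Region X v y (suc (toℕ u)) x → Region X v y (toℕ u) x ⊎ X ⊢ u ⊑ x
      T⇒ x (above h g) = inj₁ (above h g)
      T⇒ x (light {u'} h₁ h₂ h₃ h₄) with ℕₚ.m≤n⇒m<n∨m≡n (ℕₚ.≤-pred h₃)
      ... | inj₁ lt = inj₁ (light h₁ h₂ lt h₄)
      ... | inj₂ e rewrite Finₚ.toℕ-injective e = inj₂ h₄
      disjoint : ∀ x → X ⊢ u ⊑ x → ¬ Region X v y (toℕ u) x
      disjoint x h (above _ g) = g (⊑-trans (up q here) h)
      disjoint x h (light q' _ l' h') = case siblings U q' q h' h of λ { refl → ℕₚ.<-irrefl refl l' }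
      FR : Col k n
      FR = flip a b R σ
      same : flip a b S FR ≡ flip a b T σ
      same = flip-flip a b R S T σ
        (λ x _ h → trans (dec-false (Region? X v y (toℕ u) x) (disjoint x (does⁻ (⊑? X u x) h)))
          (symm (cong not (does⁺ (Region? X v y (suc (toℕ u)) x) (light q l ℕₚ.≤-refl (does⁻ (⊑? X u x) h))))))
        (λ x _ h → ≡-dec-bool (Region? X v y (toℕ u) x) (Region? X v y (suc (toℕ u)) x) (R⇒T x)
          (λ t → case T⇒ x t of λ { (inj₁ r) → r ; (inj₂ g) → case trans (symm h) (does⁺ (⊑? X u x) g) of λ () }))
      off : ∀ x → x ≢ y → lookup (flip a b T σ) x ≡ lookup (flip a b S τ) x
      off x x≢y = trans (cong (λ ρ → lookup ρ x) (symm same)) (trans (flip-lookup a b S FR x)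
        (trans (cong (λ d → if S x then sw a b d else d) (symm (Vecₚ.lookup∘update′ x≢y FR c))) (symm (flip-lookup a b S τ x))))

    stage-skip : ∀ {v y u c} → ¬ (Par X y u × size X u ≤ℕ s) → stage σ v y (suc (toℕ u)) c ≡ stage σ v y (toℕ u) c
    stage-skip {v} {y} {u} {c} h = cong (_[ y ]≔ c) (flip-cong a b σ (λ x → ≡-dec-bool (Region? X v y (suc (toℕ u)) x) (Region? X v y (toℕ u) x) (T⇒ x) (R⇒T x)))
      where
      R⇒T : ∀ x → Region X v y (toℕ u) x → Region X v y (suc (toℕ u)) x
      R⇒T x (above h g) = above h g
      R⇒T x (light h₁ h₂ h₃ h₄) = light h₁ h₂ (ℕₚ.m≤n⇒m≤1+n h₃) h₄
      T⇒ : ∀ x → Region X v y (suc (toℕ u)) x → Region X v y (toℕ u) x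
      T⇒ x (above g g') = above g g'
      T⇒ x (light {u'} h₁ h₂ h₃ h₄) with ℕₚ.m≤n⇒m<n∨m≡n (ℕₚ.≤-pred h₃)
      ... | inj₁ lt = light h₁ h₂ lt h₄
      ... | inj₂ e rewrite Finₚ.toℕ-injective e = ⊥-elim (h (h₁ , h₂))

    -- With all light children of y done, the temporary colour passes from y to its heavy child w in two single-vertex steps.
    stage-pass : ∀ {v y w c c'} → Root X v → X ⊢ v ⊑ y → Par X y w → (∀ u → Par X y u → u ≢ w → size X u ≤ℕ s) → s <ℕ size X w →
      (stage σ v w 0 c') [ y ]≔ c ≡ (stage σ v y n c) [ w ]≔ c'
    stage-pass {v} {y} {w} {c} {c'} r vy q lights heavy = Vec-ext pt
      where
      w≢y : w ≢ y
      w≢y = below-≢ y q here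
      reg : ∀ x → x ≢ y → region X v w 0 x ≡ region X v y n x
      reg x x≢y = ≡-dec-bool (Region? X v w 0 x) (Region? X v y n x) to from
        where
        to : Region X v w 0 x → Region X v y n x
        to (light _ _ () _)
        to (above h g) with ⊑? X y x
        ... | no ¬h = above h ¬h
        ... | yes h' with child-of h' (x≢y ∘ symm)
        ...   | u , q' , ux = light q' (lights u q' (λ { refl → g ux })) (Finₚ.toℕ<n u) ux
        from : Region X v y n x → Region X v w 0 x
        from (above h g) = above h (λ wx → g (⊑-trans (up q here) wx))
        from (light q' l _ ux) = above (⊑-trans vy (⊑-trans (up q' here) ux))
          (λ wx → case siblings U q' q ux wx of λ { refl → ℕₚ.<-irrefl refl (ℕₚ.<-≤-trans heavy l) })
      fl : ∀ x → x ≢ y → lookup (flip a b (region X v w 0) σ) x ≡ lookup (flip a b (region X v y n) σ) x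
      fl x x≢y = trans (flip-lookup a b (region X v w 0) σ x) (trans (cong (λ r → if r then sw a b (lookup σ x) else lookup σ x) (reg x x≢y)) (symm (flip-lookup a b (region X v y n) σ x)))
      pt : ∀ x → lookup ((stage σ v w 0 c') [ y ]≔ c) x ≡ lookup ((stage σ v y n c) [ w ]≔ c') x
      A B : Col k n
      A = flip a b (region X v w 0) σ
      B = flip a b (region X v y n) σ
      pt x with x Finₚ.≟ y | x Finₚ.≟ w
      ... | yes refl | yes refl = ⊥-elim (w≢y refl)
      ... | yes refl | no x≢w = trans (Vecₚ.lookup∘update x (A [ w ]≔ c') c) (symm (trans (Vecₚ.lookup∘update′ x≢w (B [ y ]≔ c) c') (Vecₚ.lookup∘update x B c)))
      ... | no x≢y | yes refl = trans (Vecₚ.lookup∘update′ x≢y (A [ w ]≔ c') c) (trans (Vecₚ.lookup∘update x A c') (symm (Vecₚ.lookup∘update x (B [ y ]≔ c) c')))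
      ... | no x≢y | no x≢w = trans (Vecₚ.lookup∘update′ x≢y (A [ w ]≔ c') c) (trans (Vecₚ.lookup∘update′ x≢w A c') (trans (fl x x≢y)
              (symm (trans (Vecₚ.lookup∘update′ x≢w (B [ y ]≔ c) c') (Vecₚ.lookup∘update′ x≢y B c)))))

    stage-finish : ∀ {v y c} → Root X v → X ⊢ v ⊑ y → (∀ u → Par X y u → size X u ≤ℕ s) →
      (stage σ v y n c) [ y ]≔ other (lookup σ y) ≡ flip a b (subtree X v) σ
    stage-finish {v} {y} {c} r vy lights = update-≡ (flip-true a b (subtree X v) σ (does⁺ (⊑? X v y) vy)) off
      where
      reg : ∀ x → x ≢ y → region X v y n x ≡ subtree X v x
      reg x x≢y = ≡-dec-bool (Region? X v y n x) (⊑? X v x)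
        (λ { (above h _) → h ; (light q' _ _ ux) → ⊑-trans vy (⊑-trans (up q' here) ux) })
        to
        where
        to : X ⊢ v ⊑ x → Region X v y n x
        to h with ⊑? X y x
        ... | no ¬h = above h ¬h
        ... | yes h' with child-of h' (x≢y ∘ symm)
        ...   | u , q' , ux = light q' (lights u q') (Finₚ.toℕ<n u) ux
      off : ∀ x → x ≢ y → lookup (stage σ v y n c) x ≡ lookup (flip a b (subtree X v) σ) x
      off x x≢y = trans (Vecₚ.lookup∘update′ x≢y (flip a b (region X v y n) σ) c) (trans (flip-lookup a b (region X v y n) σ x)
        (trans (cong (λ r → if r then sw a b (lookup σ x) else lookup σ x) (reg x x≢y)) (symm (flip-lookup a b (subtree X v) σ x))))

    -- For decoding: the region is determined by the forest, the root and `y`, all recoverable from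
    -- the stage, so only the original colour of `y` has to be supplied.
    stage-unflip : ∀ {v y t c} → flip a b (region X v y t) (stage σ v y t c) [ y ]≔ lookup σ y ≡ σ
    stage-unflip {v} {y} {t} {c} = update-≡ refl off
      where
      R : Fin n → Bool
      R = region X v y t
      off : ∀ x → x ≢ y → lookup (flip a b R (stage σ v y t c)) x ≡ lookup σ x
      off x x≢y = trans (flip-lookup a b R (stage σ v y t c) x) (trans (cong (λ d → if R x then sw a b d else d) (Vecₚ.lookup∘update′ x≢y (flip a b R σ) c))
        (trans (symm (flip-lookup a b R (flip a b R σ) x)) (trans (cong (λ ρ → lookup ρ x) (flip-flip a b R R (λ _ → false) σ (λ _ _ h → h) (λ _ _ h → h)))
          (flip-false a b (λ _ → false) σ refl))))

-- Cauchy-Schwarz along the heavy path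

fin-telescope : ∀ n (g : ℕ → ℚ) → ∑ (allFin n) (λ u → g (toℕ u) - g (suc (toℕ u))) ≡ g 0 - g n
fin-telescope zero g = solve 1 (λ x → con (+ 0) := x :- x) refl (g 0)
fin-telescope (suc n) g = trans (∑-allFin-suc n _) (trans (+ˡ (g 0 - g 1) (fin-telescope n (g ∘ suc)))
  (solve 3 (λ x y z → (x :- y) :+ (y :- z) := x :- z) refl (g 0) (g 1) (g (suc n))))

-- The extra term has weight 1, standing for the vertex `y` itself in `size-children`.
cauchy-schwarz-cons : ∀ {A : Set} (xs : List A) (w f : A → ℚ) p → (∀ x → 0ℚ ≤ w x) →
  sq (p + ∑ xs (λ x → w x * f x)) ≤ (1ℚ + ∑ xs w) * (sq p + ∑ xs (λ x → w x * sq (f x)))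
cauchy-schwarz-cons xs w f p h = ≤-diff ((r - ι 2 * p * t + sq p * s) + (s * r - sq t))
  (0≤+ (∑-quadratic xs w f h p) (diff-≤ (cauchy-schwarz xs w f h)))
  (solve 4 (λ p r t s → (con (+ 1) :+ s) :* (p :* p :+ r) :=
     (p :+ t) :* (p :+ t) :+ ((r :- con (+ 2) :* p :* t :+ p :* p :* s) :+ (s :* r :- t :* t))) refl p r t s)
  where
  r t s : ℚ
  r = ∑ xs (λ x → w x * sq (f x))
  t = ∑ xs (λ x → w x * f x)
  s = ∑ xs w

inv-anti : ∀ {m n} → 1 ≤ℕ m → m ≤ℕ n → inv′ n ≤ inv′ m
inv-anti {m} {n} 1≤m m≤n = subst₂ _≤_ (trans (*-assoc _ _ _) (trans (cong (inv′ n *_) (trans (*-comm (ι m) (inv′ m)) (inv-cancel m 1≤m))) (*-identityʳ _)))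
    (trans (cong (_* inv′ m) (inv-cancel n (ℕₚ.≤-trans 1≤m m≤n))) (*-identityˡ _))
    (*-monoʳ (0≤inv m) (*-monoˡ (0≤inv n) (ι-mono m≤n)))

0<1 : 0ℚ < 1ℚ
0<1 = ℚₚ.≰⇒> (λ h → case ι-cancel {1} {0} h of λ ())

abstract
  Le? : ∀ m n → Dec (m ≤ℕ n)
  Le? = ℕₚ._≤?_

module Path {n} (G : Graph n) (O : PEO G) (k : ℕ) (a b : Fin k) (a≢b : a ≢ b) (s : ℕ) (1≤s : 1 ≤ℕ s)
            (f : Col k n → ℚ) (e : ℕ) (1≤e : 1 ≤ℕ e) where
  open Walk G O k a b a≢b s public

  Light? : ∀ X u → Dec (size X u ≤ℕ s)
  Light? X u = Le? (size X u) s

  V : List (Fin n)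
  V = allFin n

  C : List (Fin k)
  C = allFin k

  cost : Col k n → Fin n → Fin k → ℚ
  cost τ x d = sq (f τ - f (step G τ x d))

  energyAt : Col k n → ℚ
  energyAt τ = ∑ V (λ x → ∑ C (λ d → cost τ x d))

  0≤energyAt : ∀ τ → 0ℚ ≤ energyAt τ
  0≤energyAt τ = 0≤∑ V (λ x → 0≤∑ C (λ d → 0≤sq _))

  edge-cost : ∀ {τ x d} → Free G τ x d → sq (f τ - f (τ [ x ]≔ d)) ≤ energyAt τ
  edge-cost {τ} {x} {d} fr = ≤-trans (≤-reflexive (cong (λ ρ → sq (f τ - f ρ)) (symm (step-free G fr))))
    (≤-trans (single-≤-∑ (enumFin k) (cost τ x) (λ d → 0≤sq _) d)
      (single-≤-∑ (enumFin n) (λ x → ∑ C (cost τ x)) (λ x → 0≤∑ C (λ d → 0≤sq _)) x))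

  good : Col k n → Fin n → Fin k → Bool
  good τ w d = isFree G τ w d ∧ not (does (d Finₚ.≟ lookup τ w))

  good⁻ : ∀ {τ w d} → good τ w d ≡ true → Free G τ w d × d ≢ lookup τ w
  good⁻ {τ} {w} {d} h = free⁻ G (proj₁ (∧⁻ h)) , λ e' → case trans (symm (proj₂ (∧⁻ {isFree G τ w d} h))) (cong not (does⁺ (d Finₚ.≟ lookup τ w) e')) of λ ()

  #good : Col k n → Fin n → ℕ
  #good τ w = length (filterᵇ (good τ w) C)

  module Terms (σ : Col k n) (v : Fin n) where

    X : Vec Bool n
    X = biᵃᵇ σ

    target : Col k n
    target = flip a b (subtree X v) σ

    heavy : Fin n → Bool
    heavy y = does (s ℕₚ.<? size X y)

    -- The factor 1/`size X u` makes each summand an `atom` of the stage, that is, an instance of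
    -- the smaller problem; 1/`e` is the cap on the law of the temporary colour.
    lightTerm : Fin n → Fin n → ℚ
    lightTerm y u = χ (does (Par? X y u) ∧ does (Light? X u)) * (inv′ (size X u) *
      ∑ C (λ c → (inv′ e * χ (ok σ y c)) * sq (f (stage σ v y (toℕ u) c) - f (stage σ v y (suc (toℕ u)) c))))

    leaveTerm : Fin n → ℚ
    leaveTerm y = ∑ C (λ c → χ (ok σ y c) * energyAt (stage σ v y n c))

    enterTerm : Fin n → ℚ
    enterTerm w = ∑ C (λ c → χ (ok σ w c) * energyAt (stage σ v w 0 c))

    localTerm : Fin n → ℚ
    localTerm y = ι 2 * (leaveTerm y + ∑ V (λ w → χ (does (Par? X y w)) * enterTerm w))

    stepTerm : Fin n → ℚ
    stepTerm y = ∑ V (lightTerm y) + localTerm y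

    -- In a tree with at most `s + s` vertices the heavy vertices below `y` are the heavy path from
    -- `y`. Summing over all of them spares the construction of the path.
    pathTerm : Fin n → ℚ
    pathTerm y = ∑ V (λ y' → χ (does (⊑? X y y') ∧ heavy y') * stepTerm y')

    0≤lightTerm : ∀ y u → 0ℚ ≤ lightTerm y u
    0≤lightTerm y u = 0≤* (0≤χ (does (Par? X y u) ∧ does (Light? X u))) (0≤* (0≤inv (size X u)) (0≤∑ C (λ c → 0≤* (0≤* (0≤inv e) (0≤χ (ok σ y c))) (0≤sq _))))

    0≤leaveTerm : ∀ y → 0ℚ ≤ leaveTerm y
    0≤leaveTerm y = 0≤∑ C (λ c → 0≤* (0≤χ (ok σ y c)) (0≤energyAt _))

    0≤enterTerm : ∀ y → 0ℚ ≤ enterTerm y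
    0≤enterTerm y = 0≤∑ C (λ c → 0≤* (0≤χ (ok σ y c)) (0≤energyAt _))

    0≤enterTerms : ∀ y → 0ℚ ≤ ∑ V (λ w → χ (does (Par? X y w)) * enterTerm w)
    0≤enterTerms y = 0≤∑ V (λ w → 0≤* (0≤χ (does (Par? X y w))) (0≤enterTerm w))

    0≤localTerm : ∀ y → 0ℚ ≤ localTerm y
    0≤localTerm y = 0≤* (0≤ι 2) (0≤+ (0≤leaveTerm y) (0≤enterTerms y))

    0≤stepTerm : ∀ y → 0ℚ ≤ stepTerm y
    0≤stepTerm y = 0≤+ (0≤∑ V (0≤lightTerm y)) (0≤localTerm y)

    0≤pathTerm : ∀ y → 0ℚ ≤ pathTerm y
    0≤pathTerm y = 0≤∑ V (λ y' → 0≤* (0≤χ (does (⊑? X y y') ∧ heavy y')) (0≤stepTerm y'))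

  module _ (room : ∀ {τ} w → Proper G τ → e ≤ℕ #good τ w) where

    good-sum : ∀ {τ} w → Proper G τ → ∑ C (λ d → inv′ (#good τ w) * χ (good τ w d)) ≡ 1ℚ
    good-sum {τ} w P = trans (∑-*ˡ C _ _) (trans (cong (inv′ (#good τ w) *_) (symm (ι-count (good τ w) C)))
      (inv-cancel (#good τ w) (ℕₚ.≤-trans 1≤e (room w P))))

    child-exists : ∀ {X y} → s <ℕ size X y → ∃ λ u → Par X y u
    child-exists {X} {y} lt with Finₚ.any? (λ u → Par? X y u)
    ... | yes p = p
    ... | no none = ⊥-elim (ℕₚ.<-irrefl refl (ℕₚ.<-≤-trans (ℕₚ.≤-<-trans 1≤s lt) (ι-cancel
        (≤-trans (≤-reflexive (ι-size X y)) (≤-trans (∑-mono V bound) (≤-reflexive (deltaFin n y (λ _ → 1ℚ))))))))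
      where
      bound : ∀ x → χ (does (⊑? X y x)) ≤ χ (does (x Finₚ.≟ y)) * 1ℚ
      bound x = ≤-trans (χ-mono (λ h → does⁺ (x Finₚ.≟ y) (only x (does⁻ (⊑? X y x) h)))) (≤-reflexive (symm (*-identityʳ _)))
        where
        only : ∀ x → X ⊢ y ⊑ x → x ≡ y
        only x h with y Finₚ.≟ x
        ... | yes y≡x = symm y≡x
        ... | no y≢x = case child-of h y≢x of λ { (u , q , _) → ⊥-elim (none (u , q)) }

    module At {σ : Col k n} (P : Proper G σ) {v : Fin n} (r : Root (biᵃᵇ σ) v) (bound : size (biᵃᵇ σ) v ≤ℕ s +ℕ s) where

      open Terms σ v public

      U : Uniq X
      U = colours-uniq a b P

      pathTerm-self : ∀ {y} → s <ℕ size X y → stepTerm y ≤ pathTerm y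
      pathTerm-self {y} lt = ≤-trans (≤-reflexive (symm (trans (cong (λ r → χ r * stepTerm y)
          (cong₂ _∧_ (does⁺ (⊑? X y y) here) (does⁺ (s ℕₚ.<? size X y) lt))) (*-identityˡ _))))
        (single-≤-∑ (enumFin n) _ (λ y' → 0≤* (0≤χ (does (⊑? X y y') ∧ heavy y')) (0≤stepTerm y')) y)

      pathTerm-child : ∀ {y w} → s <ℕ size X y → Par X y w → stepTerm y + pathTerm w ≤ pathTerm y
      pathTerm-child {y} {w} lt q = ≤-trans (≤-reflexive (trans (cong (_+ pathTerm w) (symm (deltaFin n y stepTerm))) (symm (∑-+ V _ _)))) (∑-mono V pt)
        where
        pt : ∀ y' → χ (does (y' Finₚ.≟ y)) * stepTerm y' + χ (does (⊑? X w y') ∧ heavy y') * stepTerm y' ≤ χ (does (⊑? X y y') ∧ heavy y') * stepTerm y'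
        pt y' with y' Finₚ.≟ y
        ... | yes refl = ≤-reflexive (trans (cong₂ (λ x z → 1ℚ * stepTerm y + χ (x ∧ z) * stepTerm y) (dec-false (⊑? X w y) (⊑-antisym-par q)) (does⁺ (s ℕₚ.<? size X y) lt))
                (trans (solve 1 (λ x → con (+ 1) :* x :+ con (+ 0) :* x := con (+ 1) :* x) refl (stepTerm y))
                (cong₂ (λ x z → χ (x ∧ z) * stepTerm y) (symm (does⁺ (⊑? X y y) here)) (symm (does⁺ (s ℕₚ.<? size X y) lt)))))
        ... | no _ = ≤-trans (≤-reflexive (solve 2 (λ x z → con (+ 0) :* x :+ z := z) refl (stepTerm y') (χ (does (⊑? X w y') ∧ heavy y') * stepTerm y')))
                (*-monoʳ (0≤stepTerm y') (χ-mono (λ h → cong₂ _∧_ (does⁺ (⊑? X y y') (⊑-trans (up q here) (does⁻ (⊑? X w y') (proj₁ (∧⁻ h))))) (proj₂ (∧⁻ {does (⊑? X w y')} h)))))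

      -- The distribution of the temporary colour; the cap 1/e is what keeps the congestion of the path bounded.
      record Law (y : Fin n) : Set where
        field
          π     : Fin k → ℚ
          0≤π   : ∀ c → 0ℚ ≤ π c
          total : ∑ C π ≡ 1ℚ
          cap   : ∀ c → π c ≤ inv′ e * χ (ok σ y c)

        support : ∀ c → ok σ y c ≡ false → π c ≡ 0ℚ
        support c h = ℚₚ.≤-antisym (subst (π c ≤_) (zeroʳ (inv′ e)) (subst (λ x → π c ≤ inv′ e * χ x) h (cap c))) (0≤π c)

        π-cong : ∀ c {p q} → (Ok σ y c → p ≡ q) → π c * p ≡ π c * q
        π-cong c {p} {q} h with ok σ y c in eq
        ... | true = cong (π c *_) (h (does⁻ (Ok? σ y c) eq))
        ... | false = trans (cong (_* p) (support c eq)) (trans (zeroˡ p) (symm (trans (cong (_* q) (support c eq)) (zeroˡ q))))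

        π-≤ : ∀ c {p q} → (Ok σ y c → p ≤ q) → π c * p ≤ π c * q
        π-≤ c {p} {q} h with ok σ y c in eq
        ... | true = *-monoˡ (0≤π c) (h (does⁻ (Ok? σ y c) eq))
        ... | false = ≤-reflexive (trans (cong (_* p) (support c eq)) (trans (zeroˡ p) (symm (trans (cong (_* q) (support c eq)) (zeroˡ q)))))

        π≤χ : ∀ c → π c ≤ χ (ok σ y c)
        π≤χ c = ≤-trans (cap c) (subst (inv′ e * χ (ok σ y c) ≤_) (*-identityˡ _) (*-monoʳ (0≤χ (ok σ y c)) (inv-≤1 e 1≤e)))

        mean : (Fin k → ℚ) → ℚ
        mean g = ∑ C (λ c → π c * g c)

        mean-const : ∀ p → mean (λ _ → p) ≡ p
        mean-const p = trans (∑-*ʳ C p π) (trans (cong (_* p) total) (*-identityˡ p))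

        mean-- : ∀ g h → mean g - mean h ≡ mean (λ c → g c - h c)
        mean-- g h = trans (symm (∑-- C _ _)) (∑-cong C (λ c → solve 3 (λ x y z → x :* y :- x :* z := x :* (y :- z)) refl (π c) (g c) (h c)))

        mean-sq : ∀ g → sq (mean g) ≤ mean (λ c → sq (g c))
        mean-sq g = jensen C π g 0≤π (≤-reflexive total)
      open Law public

      -- The vertex `w` has one of the colours `a`, `b`, which is excluded as its own; a child of
      -- `w`, which exists because `w` is heavy, has the other and blocks it. So a good colour lies
      -- outside the pair.
      good-ok : ∀ {τ w c} → s <ℕ size X w →
        (∀ {u} → Par X w u → lookup τ u ≡ lookup σ u) → lookup τ w ≡ lookup σ w →
        (∀ z → ¬ AB (lookup σ z) → lookup τ z ≡ lookup σ z) → X ⊢ v ⊑ w → good τ w c ≡ true → Ok σ w c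
      good-ok {τ} {w} {c} lt children self outside vw g with good⁻ {τ} g | child-exists lt
      ... | fr , c≢ | u , q = mkOk c∉ (mkFree (λ z adj e' → unused fr z adj (trans (outside z (λ h → c∉ (subst AB e' h))) e')))
        where
        u∈ : AB (lookup σ u)
        u∈ = ∈X P r (up q vw)
        c∉ : ¬ AB c
        c∉ h = unused fr u (Par.adjacent q) (trans (children q) (trans (symm (sw-other a≢b (∈X P r vw) u∈ (differ P w u (Par.adjacent q))))
          (sw-other a≢b (∈X P r vw) h (λ e' → c≢ (trans (symm e') (symm self))))))

      startLaw : s <ℕ size X v → Law v
      startLaw lt = record
        { π = π₀
        ; 0≤π = λ c → 0≤* (0≤inv (#good σ v)) (0≤χ (good σ v c))
        ; total = good-sum v P
        ; cap = λ c → *-mono (0≤χ (good σ v c)) (0≤inv e) (inv-anti 1≤e (room v P))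
            (χ-mono (λ g → does⁺ (Ok? σ v c) (good-ok {σ} {v} lt (λ _ → refl) refl (λ _ _ → refl) here g))) }
        where
        π₀ : Fin k → ℚ
        π₀ c = inv′ (#good σ v) * χ (good σ v c)

      module Round {y : Fin n} (vy : X ⊢ v ⊑ y) (lt : s <ℕ size X y) (law : Law y) where

        F : ℕ → Fin k → ℚ
        F t c = f (stage σ v y t c)

        D : Fin n → Fin k → ℚ
        D u c = F (toℕ u) c - F (suc (toℕ u)) c

        Δ : Fin n → ℚ
        Δ u = mean law (D u)

        rounds : mean law (F 0) - mean law (F n) ≡ ∑ V Δ
        rounds = trans (mean-- law (F 0) (F n)) (trans (∑-cong C (λ c → trans (cong (π law c *_) (symm (fin-telescope n (λ t → F t c)))) (symm (∑-*ˡ V _ _)))) (∑-swap C V _))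

        skip : ∀ {u} → ¬ (Par X y u × size X u ≤ℕ s) → Δ u ≡ 0ℚ
        skip {u} h = trans (∑-cong C (λ c → trans (cong (λ ρ → π law c * (F (toℕ u) c - f ρ)) (stage-skip P h))
          (solve 2 (λ x z → x :* (z :- z) := con (+ 0)) refl (π law c) (F (toℕ u) c)))) (∑-zero C)

        -- Cauchy-Schwarz with weight 1 for `p` and weight `size X u` for the child `u`. By
        -- `size-children` the weights sum to at most `size X y`, so after division by tree sizes
        -- nothing is lost. A light child contributes only `Δ u`, a heavy one only `Q u`.
        combine : (p : ℚ) (Q B : Fin n → ℚ) → (∀ u → 0ℚ ≤ B u) → (∀ u → ¬ (Par X y u × s <ℕ size X u) → Q u ≡ 0ℚ) →
          (∀ u → Par X y u → s <ℕ size X u → sq (Q u) ≤ ι (size X u) * B u) →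
          sq (p + ∑ V (λ u → Δ u + Q u)) ≤ ι (size X y) * (sq p + (∑ V (lightTerm y) + ∑ V B))
        combine p Q B 0≤B Q0 QB = ≤-trans (≤-reflexive (cong (λ x → sq (p + x)) (symm (∑-cong V rescale))))
          (≤-trans (cauchy-schwarz-cons V W z p 0≤W)
            (*-mono (0≤+ (0≤sq p) (0≤∑ V (λ u → 0≤* (0≤W u) (0≤sq (z u))))) (0≤ι (size X y)) (size-children U y)
              (+-mono-≤ (≤-refl {sq p}) (≤-trans (∑-mono V each) (≤-reflexive (∑-+ V (lightTerm y) B))))))
          where
          W z : Fin n → ℚ
          W u = χ (does (Par? X y u)) * ι (size X u)
          z u = inv′ (size X u) * (Δ u + Q u)
          0≤W : ∀ u → 0ℚ ≤ W u
          0≤W u = 0≤* (0≤χ (does (Par? X y u))) (0≤ι (size X u))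
          cancel : ∀ u → inv′ (size X u) * ι (size X u) ≡ 1ℚ
          cancel u = inv-cancel (size X u) (size≥1 X u)
          rescale : ∀ u → W u * z u ≡ Δ u + Q u
          rescale u with Par? X y u
          ... | yes q = trans (solve 3 (λ x i d → (con (+ 1) :* x) :* (i :* d) := (i :* x) :* d) refl (ι (size X u)) (inv′ (size X u)) (Δ u + Q u))
                 (trans (cong (_* (Δ u + Q u)) (cancel u)) (*-identityˡ _))
          ... | no ¬q = trans (solve 2 (λ x y → (con (+ 0) :* x) :* y := con (+ 0)) refl (ι (size X u)) (z u))
                 (symm (trans (cong₂ _+_ (skip (¬q ∘ proj₁)) (Q0 u (¬q ∘ proj₁))) (+-identityˡ 0ℚ)))
          each : ∀ u → W u * sq (z u) ≤ lightTerm y u + B u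
          each u with Par? X y u | Light? X u
          ... | no _ | _ = ≤-trans (≤-reflexive (solve 2 (λ x y → (con (+ 0) :* x) :* y := con (+ 0)) refl (ι (size X u)) (sq (z u))))
                  (0≤+ (≤-reflexive (symm (zeroˡ _))) (0≤B u))
          ... | yes q | yes l = ≤-trans (≤-reflexive squares)
                  (≤-trans (*-monoˡ (0≤inv (size X u)) lightBound)
                    (≤-diff (B u) (0≤B u) (cong (_+ B u) (*-identityˡ _))))
            where
            noQ : Δ u + Q u ≡ Δ u
            noQ = trans (+ˡ (Δ u) (Q0 u (λ { (_ , g) → ℕₚ.<-irrefl refl (ℕₚ.<-≤-trans g l) }))) (+-identityʳ _)
            squares : (1ℚ * ι (size X u)) * sq (z u) ≡ inv′ (size X u) * sq (Δ u)
            squares = trans (solve 3 (λ x i d → (con (+ 1) :* x) :* ((i :* d) :* (i :* d)) := (i :* x) :* (i :* (d :* d))) refl (ι (size X u)) (inv′ (size X u)) (Δ u + Q u))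
              (trans (cong₂ (λ x d → x * (inv′ (size X u) * sq d)) (cancel u) noQ) (*-identityˡ _))
            lightBound : sq (Δ u) ≤ ∑ C (λ c → (inv′ e * χ (ok σ y c)) * sq (D u c))
            lightBound = ≤-trans (mean-sq law (D u)) (∑-mono C (λ c → *-monoʳ (0≤sq (D u c)) (cap law c)))
          ... | yes q | no ¬l = ≤-trans (≤-reflexive squares)
                  (≤-trans (*-monoˡ (0≤inv (size X u)) (QB u q (ℕₚ.≰⇒> ¬l)))
                    (≤-reflexive (trans (symm (*-assoc _ _ _)) (trans (cong (_* B u) (cancel u))
                      (solve 2 (λ x y → con (+ 1) :* x := con (+ 0) :* y :+ x) refl (B u) (inv′ (size X u) * ∑ C (λ c → (inv′ e * χ (ok σ y c)) * sq (D u c))))))))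
            where
            noΔ : Δ u + Q u ≡ Q u
            noΔ = trans (cong (_+ Q u) (skip (¬l ∘ proj₂))) (+-identityˡ _)
            squares : (1ℚ * ι (size X u)) * sq (z u) ≡ inv′ (size X u) * sq (Q u)
            squares = trans (solve 3 (λ x i d → (con (+ 1) :* x) :* ((i :* d) :* (i :* d)) := (i :* x) :* (i :* (d :* d))) refl (ι (size X u)) (inv′ (size X u)) (Δ u + Q u))
              (trans (cong₂ (λ x d → x * (inv′ (size X u) * sq d)) (cancel u) noΔ) (*-identityˡ _))

        finish : (∀ u → Par X y u → size X u ≤ℕ s) → sq (mean law (F n) - f target) ≤ localTerm y
        finish lights = ≤-trans (≤-reflexive (cong sq (trans (cong (λ x → mean law (F n) - x) (symm (mean-const law (f target)))) (mean-- law (F n) (λ _ → f target)))))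
          (≤-trans (mean-sq law (λ c → F n c - f target)) (≤-trans (∑-mono C each)
            (≤-diff (leaveTerm y + ι 2 * ∑ V (λ w → χ (does (Par? X y w)) * enterTerm w)) (0≤+ (0≤leaveTerm y) (0≤* (0≤ι 2) (0≤enterTerms y)))
              (solve 2 (λ x z → con (+ 2) :* (x :+ z) := x :+ (x :+ con (+ 2) :* z)) refl (leaveTerm y) (∑ V (λ w → χ (does (Par? X y w)) * enterTerm w))))))
          where
          each : ∀ c → π law c * sq (F n c - f target) ≤ χ (ok σ y c) * energyAt (stage σ v y n c)
          each c = ≤-trans (π-≤ law c (λ o → edge o)) (*-monoʳ (0≤energyAt (stage σ v y n c)) (π≤χ law c))
            where
            done : (stage σ v y n c) [ y ]≔ other (lookup σ y) ≡ target
            done = stage-finish P r vy lights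
            edge : Ok σ y c → sq (F n c - f target) ≤ energyAt (stage σ v y n c)
            edge o = subst (λ ρ → sq (F n c - f ρ) ≤ energyAt (stage σ v y n c)) done
              (edge-cost (proper→free G (subst (Proper G) (symm done) (flip-root-proper a b P r))))

        module Pass {w : Fin n} (q : Par X y w) (lw : s <ℕ size X w) (lights : ∀ u → Par X y u → u ≢ w → size X u ≤ℕ s) where

          ρ : Fin k → Col k n
          ρ c = stage σ v y n c

          κ : Fin k → Fin k → ℚ
          κ c c' = inv′ (#good (ρ c) w) * χ (good (ρ c) w c')

          0≤κ : ∀ c c' → 0ℚ ≤ κ c c'
          0≤κ c c' = 0≤* (0≤inv (#good (ρ c) w)) (0≤χ (good (ρ c) w c'))

          ρ-proper : ∀ {c} → Ok σ y c → Proper G (ρ c)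
          ρ-proper o = stage-proper P r vy o

          unmoved : ∀ {c x} → X ⊢ w ⊑ x → lookup (ρ c) x ≡ lookup σ x
          unmoved {c} {x} wx = trans (Vecₚ.lookup∘update′ (below-≢ P y q wx) (flip a b (region X v y n) σ) c)
            (flip-false a b (region X v y n) σ (dec-false (Region? X v y n x) (λ
              { (above _ g) → g (⊑-trans (up q here) wx)
              ; (light q' l _ ux) → case siblings U q' q ux wx of λ { refl → ℕₚ.<-irrefl refl (ℕₚ.<-≤-trans lw l) } })))

          good→ok : ∀ {c c'} → Ok σ y c → good (ρ c) w c' ≡ true → Ok σ w c'
          good→ok {c} o g = good-ok {ρ c} lw (λ q' → unmoved (up q' here)) (unmoved here)
            (λ z z∉ → trans (Vecₚ.lookup∘update′ (λ { refl → z∉ (∈X P r vy) }) (flip a b (region X v y n) σ) c) (flip-∉ a b (region X v y n) σ z z∉)) (up q vy) g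

          -- The cap survives the passage: given any old temporary colour, the new one is uniform on
          -- at least `e` good colours, and averaging over the old colour keeps each probability at
          -- most 1/`e`. No dependence on the length of the path builds up.
          nextLaw : Law w
          nextLaw = record
            { π = λ c' → mean law (λ c → κ c c')
            ; 0≤π = λ c' → 0≤∑ C (λ c → 0≤* (0≤π law c) (0≤κ c c'))
            ; total = trans (∑-swap C C _) (trans (∑-cong C (λ c → trans (∑-*ˡ C (π law c) (κ c)) (π-cong law c (λ o → good-sum w (ρ-proper o))))) (mean-const law 1ℚ))
            ; cap = λ c' → ≤-trans (∑-mono C (λ c → π-≤ law c (λ o → *-mono (0≤χ (good (ρ c) w c')) (0≤inv e) (inv-anti 1≤e (room w (ρ-proper o)))
                (χ-mono (λ g → does⁺ (Ok? σ w c') (good→ok o g)))))) (≤-reflexive (mean-const law (inv′ e * χ (ok σ w c')))) }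

          F' : Fin k → ℚ
          F' c' = f (stage σ v w 0 c')

          -- The two moves, `w` to `c'` and then `y` to its final colour, meet in `mid`. The second
          -- is charged backwards, as the move of `y` to `c` out of the first stage at `w`. Both
          -- charges thus fall on stages, and `mid` never has to be decoded.
          pass : sq (mean law (F n) - mean nextLaw F') ≤ localTerm y
          pass = ≤-trans (≤-reflexive (cong sq eq)) (≤-trans (mean-sq law _) (≤-trans (∑-mono C each)
              (≤-trans (≤-reflexive (∑-*ˡ C (ι 2) _)) (*-monoˡ (0≤ι 2) (≤-trans (≤-reflexive (∑-+ C _ _)) (+-mono-≤ leave≤ enter≤))))))
            where
            eq : mean law (F n) - mean nextLaw F' ≡ mean law (λ c → ∑ C (λ c' → κ c c' * (F n c - F' c')))
            eq = trans (cong (λ x → mean law (F n) - x) swapped) (trans (mean-- law (F n) (λ c → ∑ C (λ c' → κ c c' * F' c'))) (∑-cong C (λ c → π-cong law c (λ o → distribute c o))))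
              where
              swapped : mean nextLaw F' ≡ mean law (λ c → ∑ C (λ c' → κ c c' * F' c'))
              swapped = trans (∑-cong C (λ c' → trans (symm (∑-*ʳ C (F' c') _)) (∑-cong C (λ c → *-assoc (π law c) (κ c c') (F' c'))))) (trans (∑-swap C C _) (∑-cong C (λ c → ∑-*ˡ C (π law c) _)))
              distribute : ∀ c → Ok σ y c → F n c - ∑ C (λ c' → κ c c' * F' c') ≡ ∑ C (λ c' → κ c c' * (F n c - F' c'))
              distribute c o = trans (cong (_- ∑ C (λ c' → κ c c' * F' c')) (symm (trans (∑-*ʳ C (F n c) (κ c)) (trans (cong (_* F n c) (good-sum w (ρ-proper o))) (*-identityˡ _)))))
                (trans (symm (∑-- C _ _)) (∑-cong C (λ c' → solve 3 (λ x y z → x :* y :- x :* z := x :* (y :- z)) refl (κ c c') (F n c) (F' c'))))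
            cross : Fin k → Fin k → ℚ
            cross c c' = χ (ok σ w c') * cost (stage σ v w 0 c') y c
            leaveCost : Fin k → Fin k → ℚ
            leaveCost c c' = cost (ρ c) w c'
            each : ∀ c → π law c * sq (∑ C (λ c' → κ c c' * (F n c - F' c'))) ≤
              ι 2 * (χ (ok σ y c) * ∑ C (leaveCost c) + ∑ C (cross c))
            each c = ≤-trans (π-≤ law c bound₁) (≤-trans (*-monoʳ (0≤∑ C (λ c' → 0≤* (0≤ι 2) (0≤+ (0≤sq _) (0≤* (0≤χ (ok σ w c')) (0≤sq _))))) (π≤χ law c))
                (≤-trans (≤-reflexive (trans (cong (χ (ok σ y c) *_) (trans (∑-*ˡ C (ι 2) _) (cong (ι 2 *_) (∑-+ C (leaveCost c) (cross c)))))
                    (solve 3 (λ x p q → x :* (con (+ 2) :* (p :+ q)) := con (+ 2) :* (x :* p :+ x :* q)) refl (χ (ok σ y c)) (∑ C (leaveCost c)) (∑ C (cross c)))))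
                  (*-monoˡ (0≤ι 2) (+-mono-≤ ≤-refl (χ*-drop (ok σ y c) (0≤∑ C (λ c' → 0≤* (0≤χ (ok σ w c')) (0≤sq _))))))))
              where
              bound₁ : Ok σ y c → sq (∑ C (λ c' → κ c c' * (F n c - F' c'))) ≤ ∑ C (λ c' → ι 2 * (leaveCost c c' + cross c c'))
              bound₁ o = ≤-trans (jensen C (κ c) _ (0≤κ c) (≤-reflexive (good-sum w (ρ-proper o)))) (∑-mono C two)
                where
                two : ∀ c' → κ c c' * sq (F n c - F' c') ≤ ι 2 * (leaveCost c c' + cross c c')
                two c' with good (ρ c) w c' in g
                ... | false = ≤-trans (≤-reflexive (solve 2 (λ x y → (x :* con (+ 0)) :* y := con (+ 0)) refl (inv′ (#good (ρ c) w)) (sq (F n c - F' c'))))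
                      (0≤* (0≤ι 2) (0≤+ (0≤sq _) (0≤* (0≤χ (ok σ w c')) (0≤sq _))))
                ... | true = ≤-trans (*-monoʳ (0≤sq _) (subst (_≤ 1ℚ) (symm (*-identityʳ _)) (inv-≤1 (#good (ρ c) w) (ℕₚ.≤-trans 1≤e (room w (ρ-proper o))))))
                      (≤-trans (≤-reflexive (trans (*-identityˡ _) (cong sq (solve 3 (λ x y z → x :- z := (x :- y) :+ (y :- z)) refl (F n c) (f mid) (F' c')))))
                      (≤-trans (sq-+ (F n c - f mid) (f mid - F' c')) (*-monoˡ (0≤ι 2) (≤-reflexive (cong₂ _+_ first second)))))
                  where
                  mid : Col k n
                  mid = ρ c [ w ]≔ c'
                  o' : Ok σ w c'
                  o' = good→ok o g
                  fr : Free G (ρ c) w c'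
                  fr = proj₁ (good⁻ {ρ c} g)
                  meet : (stage σ v w 0 c') [ y ]≔ c ≡ mid
                  meet = stage-pass P r vy q lights lw
                  first : sq (F n c - f mid) ≡ leaveCost c c'
                  first = cong (λ τ → sq (F n c - f τ)) (symm (step-free G fr))
                  second : sq (f mid - F' c') ≡ cross c c'
                  second = trans (sq-flip (f mid) (F' c')) (trans (cong (λ τ → sq (F' c' - f τ)) (trans (symm meet) (symm (step-free G
                      (proper→free G (subst (Proper G) (symm meet) (update-proper′ G (ρ-proper o) fr)))))))
                    (trans (symm (*-identityˡ _)) (cong (λ x → χ x * cost (stage σ v w 0 c') y c) (symm (does⁺ (Ok? σ w c') o')))))
            leave≤ : ∑ C (λ c → χ (ok σ y c) * ∑ C (leaveCost c)) ≤ leaveTerm y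
            leave≤ = ∑-mono C (λ c → *-monoˡ (0≤χ (ok σ y c)) (single-≤-∑ (enumFin n) (λ x → ∑ C (cost (ρ c) x)) (λ x → 0≤∑ C (λ d → 0≤sq _)) w))
            enter≤ : ∑ C (λ c → ∑ C (cross c)) ≤ ∑ V (λ w → χ (does (Par? X y w)) * enterTerm w)
            enter≤ = ≤-trans (≤-reflexive (trans (∑-swap C C _) (∑-cong C (λ c' → ∑-*ˡ C (χ (ok σ w c')) _))))
              (≤-trans (∑-mono C (λ c' → *-monoˡ (0≤χ (ok σ w c')) (single-≤-∑ (enumFin n) (λ x → ∑ C (cost (stage σ v w 0 c') x)) (λ x → 0≤∑ C (λ d → 0≤sq _)) y)))
              (≤-trans (≤-reflexive (symm (trans (cong (λ x → χ x * enterTerm w) (does⁺ (Par? X y w) q)) (*-identityˡ _))))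
                (single-≤-∑ (enumFin n) (λ w → χ (does (Par? X y w)) * enterTerm w) (λ w → 0≤* (0≤χ (does (Par? X y w))) (0≤enterTerm w)) w)))

      -- Induction down the heavy path. The distance `rest` that remains after the passage to `w`
      -- enters `combine` as the share of the heavy child, whose weight `size X w` is exactly the
      -- factor in the induction hypothesis.
      descend : ∀ m {y} → size X y ≤ℕ m → X ⊢ v ⊑ y → s <ℕ size X y → (law : Law y) →
        sq (mean law (λ c → f (stage σ v y 0 c)) - f target) ≤ ι (size X y) * pathTerm y
      descend zero {y} h _ _ _ = ⊥-elim (ℕₚ.<-irrefl refl (ℕₚ.≤-trans (size≥1 X y) h))
      descend (suc m) {y} h vy lt law with Finₚ.any? (λ w → Par? X y w ×-dec (s ℕₚ.<? size X w))
      ... | no none = ≤-trans (≤-reflexive (cong sq eq)) (≤-trans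
            (combine p (λ _ → 0ℚ) (λ _ → 0ℚ) (λ _ → ≤-refl) (λ _ _ → refl) (λ u q l → ⊥-elim (none (u , q , l))))
            (*-monoˡ (0≤ι (size X y)) (≤-trans (≤-reflexive (trans (+ˡ (sq p) (trans (+ˡ (∑ V (lightTerm y)) (∑-zero V)) (+-identityʳ _))) (+-comm _ _)))
              (≤-trans (+-mono-≤ ≤-refl (finish (λ u q → ℕₚ.≮⇒≥ (λ l → none (u , q , l))))) (pathTerm-self lt)))))
        where
        open Round vy lt law
        p : ℚ
        p = mean law (F n) - f target
        eq : mean law (F 0) - f target ≡ p + ∑ V (λ u → Δ u + 0ℚ)
        eq = trans (solve 3 (λ x y z → x :- z := (y :- z) :+ (x :- y)) refl (mean law (F 0)) (mean law (F n)) (f target))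
          (+ˡ p (trans rounds (∑-cong V (λ u → symm (+-identityʳ (Δ u))))))
      ... | yes (w , q , lw) = ≤-trans (≤-reflexive (cong sq eq)) (≤-trans
            (combine p Q B (λ u → 0≤* (0≤χ (does (u Finₚ.≟ w))) (0≤pathTerm w)) Q0 QB)
            (*-monoˡ (0≤ι (size X y)) (≤-trans (+-mono-≤ pass (≤-reflexive (+ˡ (∑ V (lightTerm y)) (deltaFin n w (λ _ → pathTerm w)))))
              (≤-trans (≤-reflexive (solve 3 (λ x y z → x :+ (y :+ z) := (y :+ x) :+ z) refl (localTerm y) (∑ V (lightTerm y)) (pathTerm w))) (pathTerm-child lt q)))))
        where
        open Round vy lt law
        y≤2s : size X y ≤ℕ s +ℕ s
        y≤2s = ℕₚ.≤-trans (size-⊑ U vy) bound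
        open Pass q lw (λ u q' u≢w → ℕₚ.≮⇒≥ (λ l → u≢w (heavy-child-unique U y≤2s q' q l lw)))
        p rest : ℚ
        p = mean law (F n) - mean nextLaw F'
        rest = mean nextLaw F' - f target
        Q B : Fin n → ℚ
        Q u = χ (does (u Finₚ.≟ w)) * rest
        B u = χ (does (u Finₚ.≟ w)) * pathTerm w
        Q0 : ∀ u → ¬ (Par X y u × s <ℕ size X u) → Q u ≡ 0ℚ
        Q0 u h with u Finₚ.≟ w
        ... | yes refl = ⊥-elim (h (q , lw))
        ... | no _ = zeroˡ rest
        QB : ∀ u → Par X y u → s <ℕ size X u → sq (Q u) ≤ ι (size X u) * B u
        QB u q' l with u Finₚ.≟ w
        ... | no u≢w = ⊥-elim (u≢w (heavy-child-unique U y≤2s q' q l lw))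
        ... | yes refl = subst₂ _≤_ (cong sq (symm (*-identityˡ rest))) (cong (ι (size X w) *_) (symm (*-identityˡ (pathTerm w))))
              (descend m (ℕₚ.≤-pred (ℕₚ.≤-trans (size-child-< U q) h)) (up q vy) lw nextLaw)
        eq : mean law (F 0) - f target ≡ p + ∑ V (λ u → Δ u + Q u)
        eq = trans (solve 4 (λ x y z t → x :- t := (y :- z) :+ ((x :- y) :+ (z :- t))) refl (mean law (F 0)) (mean law (F n)) (mean nextLaw F') (f target))
          (+ˡ p (trans (cong₂ _+_ rounds (symm (deltaFin n w (λ _ → rest)))) (symm (∑-+ V Δ Q))))

      -- Dividing by the size cancels the factor of `descend`. The 2 splits off the very first move,
      -- which gives `v` its temporary colour and is charged to `σ`.
      root-path : s <ℕ size X v → inv′ (size X v) * sq (f σ - f target) ≤ ι 2 * (energyAt σ + pathTerm v)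
      root-path lt = ≤-trans (*-monoˡ (0≤inv (size X v)) (≤-trans (≤-reflexive (cong sq eq)) (≤-trans (sq-+ p q') (*-monoˡ (0≤ι 2) (+-mono-≤ first (descend (size X v) ℕₚ.≤-refl here lt law))))))
          (≤-trans (≤-reflexive (trans (solve 4 (λ i e s p → i :* (con (+ 2) :* (e :+ s :* p)) := con (+ 2) :* (i :* e :+ (i :* s) :* p)) refl (inv′ (size X v)) (energyAt σ) (ι (size X v)) (pathTerm v))
            (cong (λ x → ι 2 * (inv′ (size X v) * energyAt σ + x)) (trans (cong (_* pathTerm v) (inv-cancel (size X v) (size≥1 X v))) (*-identityˡ _)))))
          (*-monoˡ (0≤ι 2) (+-mono-≤ (subst (inv′ (size X v) * energyAt σ ≤_) (*-identityˡ _) (*-monoʳ (0≤energyAt σ) (inv-≤1 (size X v) (size≥1 X v)))) ≤-refl)))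
        where
        law : Law v
        law = startLaw lt
        S : Fin k → ℚ
        S c = f (stage σ v v 0 c)
        p q' : ℚ
        p = mean law (λ c → f σ - S c)
        q' = mean law S - f target
        eq : f σ - f target ≡ p + q'
        eq = trans (solve 3 (λ x y z → x :- z := (x :- y) :+ (y :- z)) refl (f σ) (mean law S) (f target))
          (cong (_+ q') (trans (cong (_- mean law S) (symm (mean-const law (f σ)))) (mean-- law (λ _ → f σ) S)))
        first : sq p ≤ energyAt σ
        first = ≤-trans (mean-sq law (λ c → f σ - S c)) (≤-trans (∑-mono C (λ c → π-≤ law c (λ o →
            subst (λ τ → sq (f σ - f τ) ≤ energyAt σ) (symm (stage-start P v c)) (edge-cost (freeᵒ o))))) (≤-reflexive (mean-const law (energyAt σ))))

-- Congestion and the doubling inequality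

module Congestion {n} (G : Graph n) (O : PEO G) (k : ℕ) (a b : Fin k) (a≢b : a ≢ b) (f : Col k n → ℚ) where
  open Kempe G O k

  -- The division by the size of the tree is what lets the recursion close without loss in
  -- `combine`. It is undone once, in `pair-sum`, for a single factor `n`.
  atom : Col k n → Fin n → ℚ
  atom σ v = inv′ (size (bi a b σ) v) * sq (f σ - f (flip a b (subtree (bi a b σ) v) σ))

  0≤atom : ∀ σ v → 0ℚ ≤ atom σ v
  0≤atom σ v = 0≤* (0≤inv (size (bi a b σ) v)) (0≤sq _)

  small : ℕ → Col k n → Fin n → Bool
  small t σ v = does (Root? (bi a b σ) v) ∧ does (Le? (size (bi a b σ) v) t)

  changes : ℕ → ℚ
  changes t = ∑Ω (λ σ → ∑ (allFin n) (λ v → χ (small t σ v) * atom σ v))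

  energy : ℚ
  energy = ∑Ω (λ τ → ∑ (allFin n) (λ x → ∑ (allFin k) (λ d → sq (f τ - f (step G τ x d)))))

  module Doubling (s : ℕ) (1≤s : 1 ≤ℕ s) (e : ℕ) (1≤e : 1 ≤ℕ e) (Δ : ℕ)
    (room : ∀ {τ : Col k n} w → Proper G τ → e ≤ℕ length (filterᵇ (λ d → isFree G τ w d ∧ not (does (d Finₚ.≟ lookup τ w))) (allFin k)))
    (deg≤ : ∀ u → ∑ (allFin n) (λ y → χ (Adj G y u)) ≤ ι Δ) where

    open Path G O k a b a≢b s 1≤s f e 1≤e using (V; C; AB; biᵃᵇ; other; region; stage; Ok; Ok?; ok; fresh; freeᵒ; ∈X; stage-proper; stage-bi; stage-bi⁻;
       stage-unflip; stage-flip; detached-root; detached-size; region-self; below-≢; energyAt; 0≤energyAt; Light?; module Terms; module At)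

    ∑ΩV : (Col k n → Fin n → ℚ) → ℚ
    ∑ΩV F = ∑Ω (λ σ → ∑ V (F σ))

    ∑ΩV-mono : ∀ {F H} → (∀ σ v → Proper G σ → F σ v ≤ H σ v) → ∑ΩV F ≤ ∑ΩV H
    ∑ΩV-mono h = ∑Ω-mono (λ σ P → ∑-mono V (λ v → h σ v P))

    ∑ΩV-+ : ∀ F H → ∑ΩV (λ σ v → F σ v + H σ v) ≡ ∑ΩV F + ∑ΩV H
    ∑ΩV-+ F H = trans (∑Ω-cong (λ σ _ → ∑-+ V (F σ) (H σ))) (∑Ω-+ _ _)

    ∑ΩV-*ˡ : ∀ c F → ∑ΩV (λ σ v → c * F σ v) ≡ c * ∑ΩV F
    ∑ΩV-*ˡ c F = trans (∑Ω-cong (λ σ _ → ∑-*ˡ V c (F σ))) (∑Ω-*ˡ c _)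

    ∑ΩV-∑ : ∀ {A : Set} (xs : List A) (F : Col k n → Fin n → A → ℚ) → ∑ΩV (λ σ v → ∑ xs (F σ v)) ≡ ∑ xs (λ x → ∑ΩV (λ σ v → F σ v x))
    ∑ΩV-∑ xs F = trans (∑Ω-cong (λ σ _ → ∑-swap V xs (F σ))) (∑Ω-∑ xs _)

    abstract
      rootOf : Vec Bool n → Fin n → Fin n
      rootOf X y with Finₚ.any? (λ v → Root? X v ×-dec ⊑? X v y)
      ... | yes (v , _) = v
      -- An arbitrary default: decoding applies `rootOf` to stages, where a root above `y` exists.
      ... | no _ = y

      rootOf-unique : ∀ {X v y} → Uniq X → Root X v → X ⊢ v ⊑ y → rootOf X y ≡ v
      rootOf-unique {X} {v} {y} U r h with Finₚ.any? (λ v → Root? X v ×-dec ⊑? X v y)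
      ... | yes (w , r' , h') = root-unique U r' r h' h
      ... | no none = ⊥-elim (none (v , r , h))

    record Valid (y : Fin n) (σ : Col k n) (v : Fin n) (c : Fin k) : Set where
      constructor valid
      field
        properᵛ : Proper G σ
        rootᵛ   : Root (biᵃᵇ σ) v
        aboveᵛ  : biᵃᵇ σ ⊢ v ⊑ y
        okᵛ     : Ok σ y c

    -- A stage determines the colouring it came from once the true colour α of the temporarily recoloured vertex is known.
    stage-sum : ∀ y t (α : Col k n → Fin k) (p : Col k n → Fin n → Fin k → Bool) (g : Col k n → ℚ) → (∀ τ → 0ℚ ≤ g τ) →
      (∀ σ v c → p σ v c ≡ true → Valid y σ v c × α (stage σ v y t c) ≡ lookup σ y) →
      ∑ Ω (λ σ → ∑ V (λ v → ∑ C (λ c → χ (p σ v c) * g (stage σ v y t c)))) ≤ ∑ Ω g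
    stage-sum y t α p g 0≤g h = ≤-trans (≤-reflexive (symm (trans (∑-× (enumCol k n) (enumFin n ×ᵉ enumFin k) _)
        (∑-cong Ω (λ σ → ∑-× (enumFin n) (enumFin k) _)))))
      (reindex-≤ (enumCol k n ×ᵉ (enumFin n ×ᵉ enumFin k)) (enumCol k n) (λ { (σ , v , c) → p σ v c }) (λ { (σ , v , c) → stage σ v y t c }) ψ decode g 0≤g)
      where
      ψ′ : Vec Bool n → Fin n → Col k n → Col k n × Fin n × Fin k
      ψ′ X v τ = (flip a b (region X v y t) τ [ y ]≔ α τ) , v , lookup τ y
      ψ : Col k n → Col k n × Fin n × Fin k
      ψ τ = ψ′ (biᵃᵇ τ [ y ]≔ true) (rootOf (biᵃᵇ τ [ y ]≔ true) y) τ
      decode : ∀ x → p (proj₁ x) (proj₁ (proj₂ x)) (proj₂ (proj₂ x)) ≡ true → ψ (stage (proj₁ x) (proj₁ (proj₂ x)) y t (proj₂ (proj₂ x))) ≡ x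
      decode (σ , v , c) e with h σ v c e
      ... | valid P r vy o , eα = trans (cong (λ X → ψ′ X (rootOf X y) τ) (stage-bi⁻ P {t = t} r vy (fresh o)))
            (trans (cong (λ v → ψ′ (biᵃᵇ σ) v τ) (rootOf-unique (colours-uniq a b P) r vy))
              (cong₂ (λ ρ d → ρ , v , d) (trans (cong (λ d → flip a b (region (biᵃᵇ σ) v y t) τ [ y ]≔ d) eα) (stage-unflip P))
                (Vecₚ.lookup∘update y (flip a b (region (biᵃᵇ σ) v y t) σ) c)))
        where
        τ : Col k n
        τ = stage σ v y t c

    stageEnergy : Fin n → ℕ → Col k n → Fin n → ℚ
    stageEnergy y t σ v = χ (does (Root? (biᵃᵇ σ) v)) * (χ (does (⊑? (biᵃᵇ σ) v y)) * ∑ C (λ c → χ (ok σ y c) * energyAt (stage σ v y t c)))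

    -- The stage alone does not reveal the original colour of `y`, so it is guessed, and the sum
    -- over the guesses costs the factor `k`. This is affordable because single moves enter
    -- `doubling` only additively.
    stageEnergy-sum : ∀ y t → ∑ΩV (stageEnergy y t) ≤ ι k * energy
    stageEnergy-sum y t = ≤-trans (≤-reflexive (trans split (∑-swap Ω C _)))
      (≤-trans (∑-mono C (λ α → ≤-trans (∑-mono Ω (λ σ → ∑-mono V (λ v → ∑-mono C (λ c → pointwise α σ v c))))
          (stage-sum y t (λ _ → α) (p α) g (λ τ → 0≤* (0≤χ (isProper G τ)) (0≤energyAt τ)) (λ σ v c e' → proj₁ (p⁻ α σ v c e') , symm (proj₂ (p⁻ α σ v c e'))))))
        (≤-reflexive (trans (∑-const C energy) (cong (λ m → ι m * energy) (Listₚ.length-tabulate id)))))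
      where
      g : Col k n → ℚ
      g τ = χ (isProper G τ) * energyAt τ
      p : Fin k → Col k n → Fin n → Fin k → Bool
      p α σ v c = (isProper G σ ∧ does (lookup σ y Finₚ.≟ α)) ∧ (does (Root? (biᵃᵇ σ) v) ∧ (does (⊑? (biᵃᵇ σ) v y) ∧ ok σ y c))
      p⁻ : ∀ α σ v c → p α σ v c ≡ true → Valid y σ v c × lookup σ y ≡ α
      p⁻ α σ v c e' with ∧⁻ {isProper G σ ∧ does (lookup σ y Finₚ.≟ α)} e'
      ... | h₁ , h₂ with ∧⁻ {isProper G σ} h₁ | ∧⁻ {does (Root? (biᵃᵇ σ) v)} h₂
      ...   | q₁ , q₂ | q₃ , h₃ with ∧⁻ {does (⊑? (biᵃᵇ σ) v y)} h₃
      ...     | q₄ , q₅ = valid (proper⁻ G q₁) (does⁻ (Root? (biᵃᵇ σ) v) q₃) (does⁻ (⊑? (biᵃᵇ σ) v y) q₄) (does⁻ (Ok? σ y c) q₅) , does⁻ (lookup σ y Finₚ.≟ α) q₂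
      body : Fin k → Col k n → Fin n → Fin k → ℚ
      body α σ v c = χ (p α σ v c) * energyAt (stage σ v y t c)
      pointwise : ∀ α σ v c → body α σ v c ≤ χ (p α σ v c) * g (stage σ v y t c)
      pointwise α σ v c = ≤-reflexive (χ-* (p α σ v c) (λ e' → symm (trans (cong (λ x → χ x * energyAt (stage σ v y t c)) (is e')) (*-identityˡ _))))
        where
        is : p α σ v c ≡ true → isProper G (stage σ v y t c) ≡ true
        is e' with p⁻ α σ v c e'
        ... | valid P r vy o , _ = proper⁺ G (stage-proper P r vy o)
      split : ∑ΩV (stageEnergy y t) ≡ ∑ Ω (λ σ → ∑ C (λ α → ∑ V (λ v → ∑ C (λ c → body α σ v c))))
      split = ∑-cong Ω (λ σ → trans (trans (symm (trans (cong (_* S σ) (trans (∑-cong C (λ α → trans (cong χ (≡-dec-bool (lookup σ y Finₚ.≟ α) (α Finₚ.≟ lookup σ y) symm symm)) (symm (*-identityʳ _)))) (deltaFin k (lookup σ y) (λ _ → 1ℚ)))) (*-identityˡ (S σ)))) (symm (∑-*ʳ C (S σ) _)))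
          (∑-cong C (λ α → trans (trans (symm (*-assoc _ _ _)) (symm (∑-*ˡ V (χ (does (lookup σ y Finₚ.≟ α)) * χ (isProper G σ)) _))) (trans (∑-cong V (λ v → trans (∑V-in α σ v) (symm (∑-*ˡ C _ _)))) (∑-cong V (λ v → ∑-cong C (λ c → assemble α σ v c)))))))
        where
        S : Col k n → ℚ
        S σ = χ (isProper G σ) * ∑ V (stageEnergy y t σ)
        ∑V-in : ∀ α σ v → (χ (does (lookup σ y Finₚ.≟ α)) * χ (isProper G σ)) * stageEnergy y t σ v ≡
          (χ (isProper G σ) * χ (does (lookup σ y Finₚ.≟ α))) * (χ (does (Root? (biᵃᵇ σ) v)) * χ (does (⊑? (biᵃᵇ σ) v y))) * ∑ C (λ c → χ (ok σ y c) * energyAt (stage σ v y t c))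
        ∑V-in α σ v = solve 5 (λ x z u w q → (x :* z) :* (u :* (w :* q)) := (z :* x) :* (u :* w) :* q) refl _ _ _ _ _
        assemble : ∀ α σ v c → (χ (isProper G σ) * χ (does (lookup σ y Finₚ.≟ α))) * (χ (does (Root? (biᵃᵇ σ) v)) * χ (does (⊑? (biᵃᵇ σ) v y))) * (χ (ok σ y c) * energyAt (stage σ v y t c)) ≡ body α σ v c
        assemble α σ v c = trans (solve 5 (λ x u w q z → x :* (u :* w) :* (q :* z) := (x :* (u :* (w :* q))) :* z) refl _ _ _ _ _)
          (cong (_* energyAt (stage σ v y t c)) (symm (trans (χ-∧ (isProper G σ ∧ does (lookup σ y Finₚ.≟ α)) _) (cong₂ _*_ (χ-∧ (isProper G σ) _)
            (trans (χ-∧ (does (Root? (biᵃᵇ σ) v)) _) (cong (χ (does (Root? (biᵃᵇ σ) v)) *_) (χ-∧ (does (⊑? (biᵃᵇ σ) v y)) (ok σ y c))))))))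

    fibre : Fin n → ℚ
    fibre u = ∑Ω (λ τ → χ (small s τ u) * atom τ u)

    0≤fibre : ∀ u → 0ℚ ≤ fibre u
    0≤fibre u = 0≤∑Ω (λ τ → 0≤* (0≤χ (small s τ u)) (0≤atom τ u))

    lightPart : Fin n → Fin n → Col k n → Fin n → ℚ
    lightPart y u σ v = χ (does (Root? (biᵃᵇ σ) v)) * (χ (does (⊑? (biᵃᵇ σ) v y)) * Terms.lightTerm σ v y u)

    -- Here nothing is guessed: `y` had the one of the colours `a`, `b` that its child `u` does not
    -- have. The change at `u` is an `atom` of the stage, with `u` as a root and its subtree
    -- unaltered, so the sum over all origins is bounded by the same quantity at threshold `s`.
    lightPart-sum : ∀ y u → ∑ΩV (lightPart y u) ≤ inv′ e * (χ (Adj G y u) * fibre u)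
    lightPart-sum y u = ≤-trans (∑-mono Ω (λ σ → ≤-trans (≤-reflexive (symm (∑-*ˡ V (χ (isProper G σ)) _)))
        (∑-mono V (λ v → ≤-trans (≤-reflexive (spread σ v)) (∑-mono C (λ c → pointwise σ v c))))))
      (≤-trans (stage-sum y t (λ τ → other (lookup τ u)) p g 0≤g decode) (≤-reflexive total))
      where
      t : ℕ
      t = toℕ u
      g : Col k n → ℚ
      g τ = inv′ e * (χ (Adj G y u) * (χ (isProper G τ) * (χ (small s τ u) * atom τ u)))
      0≤g : ∀ τ → 0ℚ ≤ g τ
      0≤g τ = 0≤* (0≤inv e) (0≤* (0≤χ (Adj G y u)) (0≤* (0≤χ (isProper G τ)) (0≤* (0≤χ (small s τ u)) (0≤atom τ u))))
      total : ∑ Ω g ≡ inv′ e * (χ (Adj G y u) * fibre u)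
      total = trans (∑-*ˡ Ω (inv′ e) _) (cong (inv′ e *_) (∑-*ˡ Ω (χ (Adj G y u)) _))
      p : Col k n → Fin n → Fin k → Bool
      p σ v c = isProper G σ ∧ (does (Root? (biᵃᵇ σ) v) ∧ (does (⊑? (biᵃᵇ σ) v y) ∧ ((does (Par? (biᵃᵇ σ) y u) ∧ does (Light? (biᵃᵇ σ) u)) ∧ ok σ y c)))
      p⁻ : ∀ σ v c → p σ v c ≡ true → Valid y σ v c × Par (biᵃᵇ σ) y u × size (biᵃᵇ σ) u ≤ℕ s
      p⁻ σ v c h with ∧⁻ {isProper G σ} h
      ... | q₁ , h₂ with ∧⁻ {does (Root? (biᵃᵇ σ) v)} h₂
      ...   | q₂ , h₃ with ∧⁻ {does (⊑? (biᵃᵇ σ) v y)} h₃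
      ...     | q₃ , h₄ with ∧⁻ {does (Par? (biᵃᵇ σ) y u) ∧ does (Light? (biᵃᵇ σ) u)} h₄
      ...       | h₅ , q₆ with ∧⁻ {does (Par? (biᵃᵇ σ) y u)} h₅
      ...         | q₄ , q₅ = valid (proper⁻ G q₁) (does⁻ (Root? (biᵃᵇ σ) v) q₂) (does⁻ (⊑? (biᵃᵇ σ) v y) q₃) (does⁻ (Ok? σ y c) q₆) ,
                              does⁻ (Par? (biᵃᵇ σ) y u) q₄ , does⁻ (Light? (biᵃᵇ σ) u) q₅
      decode : ∀ σ v c → p σ v c ≡ true → Valid y σ v c × other (lookup (stage σ v y t c) u) ≡ lookup σ y
      decode σ v c h with p⁻ σ v c h
      ... | val@(valid P r vy o) , q , l = val , trans (cong other here-colour)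
            (sw-other a≢b (∈X P r (up q vy)) (∈X P r vy) (λ e' → differ P y u (Par.adjacent q) (symm e')))
        where
        here-colour : lookup (stage σ v y t c) u ≡ lookup σ u
        here-colour = trans (Vecₚ.lookup∘update′ (below-≢ P y q here) (flip a b (region (biᵃᵇ σ) v y t) σ) c)
          (flip-false a b (region (biᵃᵇ σ) v y t) σ (dec-false (Path.Region? G O k a b a≢b s 1≤s f e 1≤e (biᵃᵇ σ) v y t u) (region-self P q)))
      D : Col k n → Fin n → Fin k → ℚ
      D σ v c = sq (f (stage σ v y t c) - f (stage σ v y (suc t) c))
      i : Col k n → ℚ
      i σ = inv′ (size (biᵃᵇ σ) u)
      spread : ∀ σ v → χ (isProper G σ) * lightPart y u σ v ≡ ∑ C (λ c → χ (p σ v c) * (i σ * (inv′ e * D σ v c)))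
      spread σ v = trans (solve 6 (λ x z w q i S → x :* (z :* (w :* (q :* (i :* S)))) := (x :* (z :* (w :* (q :* i)))) :* S) refl
          (χ (isProper G σ)) (χ (does (Root? (biᵃᵇ σ) v))) (χ (does (⊑? (biᵃᵇ σ) v y))) q (i σ) (∑ C (λ c → (inv′ e * χ (ok σ y c)) * D σ v c)))
        (trans (symm (∑-*ˡ C _ _)) (∑-cong C (λ c → trans
          (solve 8 (λ x z w q i ε o d → (x :* (z :* (w :* (q :* i)))) :* ((ε :* o) :* d) := (x :* (z :* (w :* (q :* o)))) :* (i :* (ε :* d))) refl
            (χ (isProper G σ)) (χ (does (Root? (biᵃᵇ σ) v))) (χ (does (⊑? (biᵃᵇ σ) v y))) q (i σ) (inv′ e) (χ (ok σ y c)) (D σ v c))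
          (cong (_* (i σ * (inv′ e * D σ v c))) (symm (trans (χ-∧ (isProper G σ) _) (cong (χ (isProper G σ) *_) (trans (χ-∧ (does (Root? (biᵃᵇ σ) v)) _)
            (cong (χ (does (Root? (biᵃᵇ σ) v)) *_) (trans (χ-∧ (does (⊑? (biᵃᵇ σ) v y)) _) (cong (χ (does (⊑? (biᵃᵇ σ) v y)) *_) (χ-∧ (does (Par? (biᵃᵇ σ) y u) ∧ does (Light? (biᵃᵇ σ) u)) (ok σ y c)))))))))))))
        where
        q : ℚ
        q = χ (does (Par? (biᵃᵇ σ) y u) ∧ does (Light? (biᵃᵇ σ) u))
      pointwise : ∀ σ v c → χ (p σ v c) * (i σ * (inv′ e * D σ v c)) ≤ χ (p σ v c) * g (stage σ v y t c)
      pointwise σ v c = ≤-reflexive (χ-* (p σ v c) equal)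
        where
        τ : Col k n
        τ = stage σ v y t c
        equal : p σ v c ≡ true → i σ * (inv′ e * D σ v c) ≡ g τ
        equal h with p⁻ σ v c h
        ... | valid P r vy o , q , l = symm (trans (cong₂ (λ x z → inv′ e * (χ x * (χ z * (χ (small s τ u) * atom τ u)))) (Par.adjacent q) (proper⁺ G (stage-proper P r vy o)))
            (trans (cong₂ (λ x z → inv′ e * (1ℚ * (1ℚ * (χ x * z)))) is-small atom≡) (solve 3 (λ ε i d → ε :* (con (+ 1) :* (con (+ 1) :* (con (+ 1) :* (i :* d)))) := i :* (ε :* d)) refl (inv′ e) (i σ) (D σ v c))))
          where
          X' : biᵃᵇ τ ≡ biᵃᵇ σ [ y ]≔ false
          X' = stage-bi P (fresh o)
          size≡ : size (biᵃᵇ τ) u ≡ size (biᵃᵇ σ) u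
          size≡ = trans (cong (λ X → size X u) X') (detached-size P y q)
          is-small : small s τ u ≡ true
          is-small = cong₂ _∧_ (does⁺ (Root? (biᵃᵇ τ) u) (subst (λ X → Root X u) (symm X') (detached-root P y q)))
            (does⁺ (Le? (size (biᵃᵇ τ) u) s) (subst (_≤ℕ s) (symm size≡) l))
          atom≡ : atom τ u ≡ i σ * D σ v c
          atom≡ = cong₂ (λ m ρ → inv′ m * sq (f τ - f ρ)) size≡ (symm (stage-flip P q l (fresh o)))

    pathPart : Col k n → Fin n → ℚ
    pathPart σ v = χ (does (Root? (biᵃᵇ σ) v)) * Terms.pathTerm σ v v

    pathPart-bound : ∀ σ v → pathPart σ v ≤ ∑ V (λ y → ∑ V (λ u → lightPart y u σ v)) +
       ι 2 * (∑ V (λ y → stageEnergy y n σ v) + ∑ V (λ y → ∑ V (λ w → stageEnergy w 0 σ v)))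
    pathPart-bound σ v with Root? (biᵃᵇ σ) v in eqr
    ... | no _ = ≤-trans (≤-reflexive (zeroˡ _)) (0≤+ (0≤∑ V (λ y → 0≤∑ V (λ u → 0≤* (0≤ι 0) (0≤* (0≤χ (does (⊑? (biᵃᵇ σ) v y))) (Terms.0≤lightTerm σ v y u)))))
          (0≤* (0≤ι 2) (0≤+ (0≤∑ V (λ y → st y n)) (0≤∑ V (λ y → 0≤∑ V (λ w → st w 0))))))
      where
      st : ∀ y t → 0ℚ ≤ 0ℚ * (χ (does (⊑? (biᵃᵇ σ) v y)) * ∑ C (λ c → χ (ok σ y c) * energyAt (stage σ v y t c)))
      st y t = ≤-reflexive (symm (zeroˡ _))
    ... | yes r = ≤-trans (≤-reflexive (*-identityˡ _)) (≤-trans (∑-mono V each) (≤-reflexive (trans (∑-+ V _ _)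
          (+ˡ _ (trans (∑-*ˡ V (ι 2) _) (cong (ι 2 *_) (∑-+ V _ _)))))))
      where
      open Terms σ v
      above : Fin n → ℚ
      above y = χ (does (⊑? (biᵃᵇ σ) v y))
      En : Fin n → ℕ → ℚ
      En y t = ∑ C (λ c → χ (ok σ y c) * energyAt (stage σ v y t c))
      each : ∀ y → χ (does (⊑? X v y) ∧ heavy y) * stepTerm y ≤
        ∑ V (λ u → 1ℚ * (above y * lightTerm y u)) + ι 2 * (1ℚ * (above y * En y n) + ∑ V (λ w → 1ℚ * (above w * En w 0)))
      each y = ≤-trans (*-monoʳ (0≤stepTerm y) (χ-mono {does (⊑? X v y) ∧ heavy y} {does (⊑? X v y)} (λ h → proj₁ (∧⁻ {does (⊑? X v y)} h))))
        (≤-trans (≤-reflexive (trans (solve 4 (λ x l p q → x :* (l :+ con (+ 2) :* (p :+ q)) := x :* l :+ con (+ 2) :* (con (+ 1) :* (x :* p) :+ x :* q)) refl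
              (above y) (∑ V (lightTerm y)) (leaveTerm y) (∑ V (λ w → χ (does (Par? X y w)) * enterTerm w)))
            (cong₂ _+_ (trans (symm (∑-*ˡ V (above y) (lightTerm y))) (∑-cong V (λ u → symm (*-identityˡ _))))
              (cong (λ x → ι 2 * (1ℚ * (above y * En y n) + x)) (symm (∑-*ˡ V (above y) _))))))
          (+-mono-≤ ≤-refl (*-monoˡ (0≤ι 2) (+-mono-≤ ≤-refl (∑-mono V child)))))
        where
        child : ∀ w → above y * (χ (does (Par? X y w)) * enterTerm w) ≤ 1ℚ * (above w * En w 0)
        child w = ≤-trans (≤-reflexive (trans (symm (*-assoc _ _ _)) (cong (_* enterTerm w) (symm (χ-∧ (does (⊑? X v y)) (does (Par? X y w)))))))
          (≤-trans (*-monoʳ (0≤enterTerm w) (χ-mono {does (⊑? X v y) ∧ does (Par? X y w)} {does (⊑? X v w)}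
             (λ h → does⁺ (⊑? X v w) (up (does⁻ (Par? X y w) (proj₂ (∧⁻ {does (⊑? X v y)} h))) (does⁻ (⊑? X v y) (proj₁ (∧⁻ {does (⊑? X v y)} h))))))) (≤-reflexive (symm (*-identityˡ _))))

    -- For fixed `u`, summing over `y` leaves the number of neighbours of `u` divided by `e`. This
    -- ratio is the multiplicative loss of one doubling.
    pathPart-sum : ∑ΩV pathPart ≤ (inv′ e * ι Δ) * changes s + ι 2 * (ι n * (ι k * energy) + ι n * (ι n * (ι k * energy)))
    pathPart-sum = ≤-trans (∑ΩV-mono (λ σ v _ → pathPart-bound σ v)) (≤-trans (≤-reflexive (trans (∑ΩV-+ _ _) (cong₂ _+_
        (trans (∑ΩV-∑ V _) (∑-cong V (λ y → ∑ΩV-∑ V (λ σ v u → lightPart y u σ v))))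
        (trans (∑ΩV-*ˡ (ι 2) _) (cong (ι 2 *_) (trans (∑ΩV-+ _ _) (cong₂ _+_ (∑ΩV-∑ V (λ σ v y → stageEnergy y n σ v))
          (trans (∑ΩV-∑ V _) (∑-cong V (λ y → ∑ΩV-∑ V (λ σ v w → stageEnergy w 0 σ v)))))))))))
      (+-mono-≤ lights (*-monoˡ (0≤ι 2) (+-mono-≤ (≤-trans (∑-mono V (λ y → stageEnergy-sum y n)) (≤-reflexive (const (ι k * energy))))
        (≤-trans (∑-mono V (λ y → ≤-trans (∑-mono V (λ w → stageEnergy-sum w 0)) (≤-reflexive (const (ι k * energy))))) (≤-reflexive (const (ι n * (ι k * energy)))))))))
      where
      const : ∀ q → ∑ V (λ _ → q) ≡ ι n * q
      const q = trans (∑-const V q) (cong (λ m → ι m * q) (Listₚ.length-tabulate {n = n} id))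
      lights : ∑ V (λ y → ∑ V (λ u → ∑ΩV (lightPart y u))) ≤ (inv′ e * ι Δ) * changes s
      lights = ≤-trans (∑-mono V (λ y → ∑-mono V (λ u → lightPart-sum y u))) (≤-trans (≤-reflexive (trans (∑-swap V V _)
          (∑-cong V (λ u → trans (∑-*ˡ V (inv′ e) _) (cong (inv′ e *_) (∑-*ʳ V (fibre u) _))))))
        (≤-trans (∑-mono V (λ u → *-monoˡ (0≤inv e) (*-monoʳ (0≤fibre u) (deg≤ u))))
          (≤-reflexive (trans (∑-cong V (λ u → symm (*-assoc (inv′ e) (ι Δ) (fibre u)))) (trans (∑-*ˡ V _ fibre) (cong ((inv′ e * ι Δ) *_) (symm (∑Ω-∑ V _))))))))

    -- A tree of size at most `s` is counted in `changes s`; one of size above `s` and at most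
    -- `s + s` is handled by `root-path`.
    doubling : changes (s +ℕ s) ≤ changes s + ι 2 * (ι n * energy + ((inv′ e * ι Δ) * changes s + ι 2 * (ι n * (ι k * energy) + ι n * (ι n * (ι k * energy)))))
    doubling = ≤-trans (∑ΩV-mono each) (≤-trans (≤-reflexive (trans (∑ΩV-+ _ _) (+ˡ (changes s) (trans (∑ΩV-*ˡ (ι 2) _) (cong (ι 2 *_) (∑ΩV-+ _ _))))))
        (+-mono-≤ ≤-refl (*-monoˡ (0≤ι 2) (+-mono-≤ (≤-reflexive energies) pathPart-sum))))
      where
      energies : ∑ΩV (λ σ v → energyAt σ) ≡ ι n * energy
      energies = trans (∑Ω-cong (λ σ _ → trans (∑-const V (energyAt σ)) (cong (λ m → ι m * energyAt σ) (Listₚ.length-tabulate {n = n} id)))) (∑Ω-*ˡ (ι n) energyAt)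
      each : ∀ σ v → Proper G σ → χ (small (s +ℕ s) σ v) * atom σ v ≤ χ (small s σ v) * atom σ v + ι 2 * (energyAt σ + pathPart σ v)
      each σ v P with Root? (biᵃᵇ σ) v in eqr
      ... | no _ = ≤-trans (≤-reflexive (trans (zeroˡ _) (symm (+-identityˡ 0ℚ)))) (+-mono-≤ (≤-reflexive (symm (zeroˡ _)))
            (0≤* (0≤ι 2) (0≤+ (0≤energyAt σ) (≤-reflexive (symm (zeroˡ _))))))
      ... | yes r with Le? (size (biᵃᵇ σ) v) s
      ...   | yes l = ≤-diff (ι 2 * (energyAt σ + 1ℚ * Terms.pathTerm σ v v)) (0≤* (0≤ι 2) (0≤+ (0≤energyAt σ) (0≤* (0≤ι 1) (Terms.0≤pathTerm σ v v))))
              (cong (λ x → χ x * atom σ v + ι 2 * (energyAt σ + 1ℚ * Terms.pathTerm σ v v)) (symm (does⁺ (Le? (size (biᵃᵇ σ) v) (s +ℕ s)) (ℕₚ.≤-trans l (ℕₚ.m≤m+n s s)))))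
      ...   | no ¬l with Le? (size (biᵃᵇ σ) v) (s +ℕ s)
      ...     | no _ = ≤-diff (ι 2 * (energyAt σ + 1ℚ * Terms.pathTerm σ v v)) (0≤* (0≤ι 2) (0≤+ (0≤energyAt σ) (0≤* (0≤ι 1) (Terms.0≤pathTerm σ v v)))) refl
      ...     | yes l = ≤-trans (≤-reflexive (*-identityˡ _)) (≤-trans (At.root-path room P r l (ℕₚ.≰⇒> ¬l))
                (≤-reflexive (solve 3 (λ z e p → con (+ 2) :* (e :+ p) := con (+ 0) :* z :+ con (+ 2) :* (e :+ con (+ 1) :* p)) refl (atom σ v) (energyAt σ) (Terms.pathTerm σ v v))))

  -- A one-vertex Kempe component is recoloured by a single Glauber step.
  changes-1 : changes 1 ≤ energy
  changes-1 = ∑Ω-mono (λ σ P → ∑-mono (allFin n) (each σ P))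
    where
    each : ∀ σ → Proper G σ → ∀ v → χ (small 1 σ v) * atom σ v ≤ ∑ (allFin k) (λ d → sq (f σ - f (step G σ v d)))
    each σ P v with Root? (bi a b σ) v | Le? (size (bi a b σ) v) 1
    ... | no _ | _ = ≤-trans (≤-reflexive (zeroˡ _)) (0≤∑ (allFin k) (λ d → 0≤sq _))
    ... | yes _ | no _ = ≤-trans (≤-reflexive (zeroˡ _)) (0≤∑ (allFin k) (λ d → 0≤sq _))
    ... | yes r | yes l = ≤-trans (≤-reflexive (*-identityˡ _)) (≤-trans
          (≤-trans (*-monoʳ (0≤sq _) (inv-≤1 _ (size≥1 (bi a b σ) v))) (≤-reflexive (trans (*-identityˡ _) (cong (λ ρ → sq (f σ - f ρ)) (trans (symm single) (symm (step-free G fr)))))))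
          (single-≤-∑ (enumFin k) (λ d → sq (f σ - f (step G σ v d))) (λ d → 0≤sq _) (sw a b (lookup σ v))))
      where
      X : Vec Bool n
      X = bi a b σ
      alone : ∀ {x} → X ⊢ v ⊑ x → x ≡ v
      alone here = refl
      alone {x} h@(up q g) = ⊥-elim (ℕₚ.<-irrefl refl (ℕₚ.<-≤-trans (ℕₚ.≤-<-trans (size≥1 X x) (ℕₚ.<-≤-trans (size-child-< U q) (size-⊑ U g))) l))
        where
        U : Uniq X
        U = colours-uniq a b P
      single : σ [ v ]≔ sw a b (lookup σ v) ≡ flip a b (subtree X v) σ
      single = update-≡ (flip-true a b (subtree X v) σ (does⁺ (⊑? X v v) here))
        (λ x x≢v → symm (flip-false a b (subtree X v) σ (dec-false (⊑? X v x) (λ h → x≢v (alone h)))))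
      fr : Free G σ v (sw a b (lookup σ v))
      fr = proper→free G (subst (Proper G) (symm single) (flip-root-proper a b P r))

-- The Glauber dynamics

inv-* : ∀ m n → 1 ≤ℕ m → 1 ≤ℕ n → inv′ (m *ℕ n) ≡ inv′ m * inv′ n
inv-* m n hm hn = trans (trans (symm (*-identityʳ _)) (cong (inv′ (m *ℕ n) *_) (symm one)))
    (trans (symm (*-assoc _ _ _)) (trans (cong (_* (inv′ m * inv′ n)) (inv-cancel (m *ℕ n) (ℕₚ.*-mono-≤ hm hn))) (*-identityˡ _)))
  where
  one : ι (m *ℕ n) * (inv′ m * inv′ n) ≡ 1ℚ
  one = trans (cong (_* (inv′ m * inv′ n)) (ι-* m n)) (trans (solve 4 (λ a b c d → (a :* b) :* (c :* d) := (c :* a) :* (d :* b)) refl (ι m) (ι n) (inv′ m) (inv′ n))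
    (trans (cong₂ _*_ (inv-cancel m hm) (inv-cancel n hn)) (*-identityˡ 1ℚ)))

module Glauber {n} (G : Graph n) (k : ℕ) (1≤n : 1 ≤ℕ n) (1≤k : 1 ≤ℕ k) where
  open Colourings G k public

  N : ℕ
  N = n *ℕ k

  1≤N : 1 ≤ℕ N
  1≤N = ℕₚ.*-mono-≤ 1≤n 1≤k

  ∑M : (Fin n → Fin k → ℚ) → ℚ
  ∑M g = ∑ (allFin n) (λ v → ∑ (allFin k) (g v))

  ∑M-cong : ∀ {g h} → (∀ v c → g v c ≡ h v c) → ∑M g ≡ ∑M h
  ∑M-cong e = ∑-cong (allFin n) (λ v → ∑-cong (allFin k) (e v))

  ∑M-mono : ∀ {g h} → (∀ v c → g v c ≤ h v c) → ∑M g ≤ ∑M h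
  ∑M-mono e = ∑-mono (allFin n) (λ v → ∑-mono (allFin k) (e v))

  ∑M-+ : ∀ g h → ∑M (λ v c → g v c + h v c) ≡ ∑M g + ∑M h
  ∑M-+ g h = trans (∑-cong (allFin n) (λ v → ∑-+ (allFin k) (g v) (h v))) (∑-+ (allFin n) _ _)

  ∑M-*ˡ : ∀ c g → ∑M (λ v d → c * g v d) ≡ c * ∑M g
  ∑M-*ˡ c g = trans (∑-cong (allFin n) (λ v → ∑-*ˡ (allFin k) c (g v))) (∑-*ˡ (allFin n) c _)

  ∑M-const : ∀ p → ∑M (λ _ _ → p) ≡ ι N * p
  ∑M-const p = trans (∑-cong (allFin n) (λ v → trans (∑-const (allFin k) p) (cong (λ m → ι m * p) (Listₚ.length-tabulate {n = k} id))))
    (trans (∑-const (allFin n) (ι k * p)) (trans (cong (λ m → ι m * (ι k * p)) (Listₚ.length-tabulate {n = n} id)) (trans (symm (*-assoc _ _ _)) (cong (_* p) (symm (ι-* n k))))))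

  P : (Col k n → ℚ) → Col k n → ℚ
  P g σ = inv′ N * ∑M (λ v c → g (step G σ v c))

  P-cong : ∀ {g h} σ → (∀ τ → g τ ≡ h τ) → P g σ ≡ P h σ
  P-cong σ e = cong (inv′ N *_) (∑M-cong (λ v c → e (step G σ v c)))

  P-const : ∀ p σ → P (λ _ → p) σ ≡ p
  P-const p σ = trans (cong (inv′ N *_) (∑M-const p)) (trans (symm (*-assoc _ _ _)) (trans (cong (_* p) (inv-cancel N 1≤N)) (*-identityˡ p)))

  P-+ : ∀ g h σ → P (λ τ → g τ + h τ) σ ≡ P g σ + P h σ
  P-+ g h σ = trans (cong (inv′ N *_) (∑M-+ _ _)) (distribˡ (inv′ N) _ _)

  P-*ˡ : ∀ c g σ → P (λ τ → c * g τ) σ ≡ c * P g σ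
  P-*ˡ c g σ = trans (cong (inv′ N *_) (∑M-*ˡ c _)) (solve 3 (λ x y z → x :* (y :* z) := y :* (x :* z)) refl (inv′ N) c (∑M (λ v d → g (step G σ v d))))

  P-- : ∀ g h σ → P (λ τ → g τ - h τ) σ ≡ P g σ - P h σ
  P-- g h σ = trans (P-cong σ (λ τ → solve 2 (λ x y → x :- y := x :+ (:- con (+ 1)) :* y) refl (g τ) (h τ))) (trans (P-+ g (λ τ → (- 1ℚ) * h τ) σ)
    (trans (+ˡ (P g σ) (P-*ˡ (- 1ℚ) h σ)) (solve 2 (λ x y → x :+ (:- con (+ 1)) :* y := x :- y) refl (P g σ) (P h σ))))

  P^ : ℕ → (Col k n → ℚ) → Col k n → ℚ
  P^ zero g = g
  P^ (suc t) g = P (P^ t g)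

  P^-- : ∀ t g p σ → P^ t (λ τ → g τ - p) σ ≡ P^ t g σ - p
  P^-- zero g p σ = refl
  P^-- (suc t) g p σ = trans (P-cong σ (P^-- t g p)) (trans (P-- (P^ t g) (λ _ → p) σ) (cong (λ x → P (P^ t g) σ - x) (P-const p σ)))

  P^-+ : ∀ s t g σ → P^ (s +ℕ t) g σ ≡ P^ s (P^ t g) σ
  P^-+ zero t g σ = refl
  P^-+ (suc s) t g σ = P-cong σ (P^-+ s t g)

  step-proper : ∀ {σ : Col k n} {v c} → Proper G σ → Proper G (step G σ v c)
  step-proper {σ} {v} {c} Q with isFree G σ v c in e
  ... | true = subst (Proper G) (symm (step-free G (free⁻ G e))) (update-proper′ G Q (free⁻ G e))
  ... | false = subst (Proper G) (symm (trans (step≡ G σ v c) (cong (λ r → if r then σ [ v ]≔ c else σ) e))) Q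

  step-self : ∀ {σ : Col k n} v → Proper G σ → step G σ v (lookup σ v) ≡ σ
  step-self {σ} v Q = trans (step-free G (mkFree (λ w a e → differ Q v w a (symm e)))) (Vecₚ.[]≔-lookup σ v)

  -- An accepted move is undone by restoring the old colour of `v`, which is an involution on pairs
  -- of colouring and colour; a rejected move stays in place and cancels against itself.
  ∑Ω-step : ∀ v (g : Col k n → ℚ) → ∑Ω (λ σ → ∑ (allFin k) (λ c → g (step G σ v c))) ≡ ∑Ω (λ σ → ∑ (allFin k) (λ _ → g σ))
  ∑Ω-step v g = trans (trans (∑-cong Ω (λ σ → trans (symm (∑-*ˡ (allFin k) _ _)) (trans (∑-cong (allFin k) (split σ)) (∑-+ (allFin k) _ _)))) (∑-+ Ω _ _))
      (trans (cong (_+ ∑ Ω (λ σ → ∑ (allFin k) (λ c → stay σ c * g σ)))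
        (trans (symm (∑-× (enumCol k n) (enumFin k) _)) (trans (reindex-involution (enumCol k n ×ᵉ enumFin k) p φ closed invol (λ x → g (proj₁ x))) (∑-× (enumCol k n) (enumFin k) _))))
      (symm (trans (∑-cong Ω (λ σ → trans (symm (∑-*ˡ (allFin k) _ _)) (trans (∑-cong (allFin k) (merge σ)) (∑-+ (allFin k) _ _)))) (∑-+ Ω _ _))))
    where
    p : Col k n × Fin k → Bool
    p (σ , c) = isProper G σ ∧ isFree G σ v c
    φ : Col k n × Fin k → Col k n × Fin k
    φ (σ , c) = (σ [ v ]≔ c) , lookup σ v
    stay : Col k n → Fin k → ℚ
    stay σ c = χ (isProper G σ) * (1ℚ - χ (isFree G σ v c))
    split : ∀ σ c → χ (isProper G σ) * g (step G σ v c) ≡ χ (p (σ , c)) * g (proj₁ (φ (σ , c))) + stay σ c * g σ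
    split σ c = trans (cong (λ ρ → χ (isProper G σ) * g ρ) (step≡ G σ v c)) (trans (lem (isProper G σ) (isFree G σ v c)) (cong (_+ stay σ c * g σ) (cong (_* g (σ [ v ]≔ c)) (symm (χ-∧ (isProper G σ) (isFree G σ v c))))))
      where
      lem : ∀ x y → χ x * g (if y then σ [ v ]≔ c else σ) ≡ (χ x * χ y) * g (σ [ v ]≔ c) + (χ x * (1ℚ - χ y)) * g σ
      lem x true = solve 3 (λ x y z → x :* y := (x :* con (+ 1)) :* y :+ (x :* (con (+ 1) :- con (+ 1))) :* z) refl (χ x) (g (σ [ v ]≔ c)) (g σ)
      lem x false = solve 3 (λ x y z → x :* z := (x :* con (+ 0)) :* y :+ (x :* (con (+ 1) :- con (+ 0))) :* z) refl (χ x) (g (σ [ v ]≔ c)) (g σ)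
    merge : ∀ σ c → χ (isProper G σ) * g σ ≡ χ (p (σ , c)) * g σ + stay σ c * g σ
    merge σ c = trans (solve 3 (λ x y z → x :* z := (x :* y) :* z :+ (x :* (con (+ 1) :- y)) :* z) refl (χ (isProper G σ)) (χ (isFree G σ v c)) (g σ))
      (cong (λ z → z * g σ + stay σ c * g σ) (symm (χ-∧ (isProper G σ) (isFree G σ v c))))
    closed : ∀ x → p x ≡ true → p (φ x) ≡ true
    closed (σ , c) e with ∧⁻ {isProper G σ} e
    ... | e₁ , e₂ = cong₂ _∧_ (proper⁺ G (update-proper′ G (proper⁻ G e₁) (free⁻ G e₂)))
        (free⁺ G (proper→free G (subst (Proper G) (symm (trans (Vecₚ.[]≔-idempotent σ v) (Vecₚ.[]≔-lookup σ v))) (proper⁻ G e₁))))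
    invol : ∀ x → p x ≡ true → φ (φ x) ≡ x
    invol (σ , c) e = cong₂ _,_ (trans (Vecₚ.[]≔-idempotent σ v) (Vecₚ.[]≔-lookup σ v)) (Vecₚ.lookup∘update v σ c)

  ∑Ω-P : ∀ g → ∑Ω (P g) ≡ ∑Ω g
  ∑Ω-P g = trans (∑Ω-*ˡ (inv′ N) _) (trans (cong (inv′ N *_) (trans (∑Ω-∑ (allFin n) _) (trans (∑-cong (allFin n) (λ v → ∑Ω-step v g))
      (trans (symm (∑Ω-∑ (allFin n) _)) (trans (∑Ω-cong (λ σ _ → ∑M-const (g σ))) (∑Ω-*ˡ (ι N) g))))))
    (trans (symm (*-assoc _ _ _)) (trans (cong (_* ∑Ω g) (inv-cancel N 1≤N)) (*-identityˡ _))))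

  ∑Ω-P^ : ∀ t g → ∑Ω (P^ t g) ≡ ∑Ω g
  ∑Ω-P^ zero g = refl
  ∑Ω-P^ (suc t) g = trans (∑Ω-P (P^ t g)) (∑Ω-P^ t g)

  E : (Col k n → ℚ) → Col k n → ℚ
  E g σ = ∑M (λ v c → sq (g σ - g (step G σ v c)))

  -- With x = g σ and μ = P g σ, the lazy moves give (x - μ)² ≤ k Var, and ∑ w (gᵢ - x)² = Var + (x - μ)².
  variance-drop : ∀ g σ → Proper G σ → inv′ N * E g σ ≤ (1ℚ + ι k) * (P (λ τ → sq (g τ)) σ - sq (P g σ))
  variance-drop g σ Q = ≤-trans (≤-reflexive expand) (≤-trans (+-mono-≤ (≤-refl {Var}) lazy)
      (≤-reflexive (solve 2 (λ v k → v :+ k :* v := (con (+ 1) :+ k) :* v) refl Var (ι k))))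
    where
    x μ Var : ℚ
    x = g σ
    μ = P g σ
    Var = P (λ τ → sq (g τ)) σ - sq μ
    around : ∀ z → inv′ N * ∑M (λ v c → sq (z - g (step G σ v c))) ≡ Var + sq (z - μ)
    around z = trans (P-cong σ (λ τ → solve 2 (λ z y → (z :- y) :* (z :- y) := z :* z :+ (((:- (con (+ 2) :* z)) :* y) :+ y :* y)) refl z (g τ)))
      (trans (P-+ (λ _ → sq z) (λ τ → (- (ι 2 * z)) * g τ + sq (g τ)) σ) (trans (cong₂ _+_ (P-const (sq z) σ) (trans (P-+ (λ τ → (- (ι 2 * z)) * g τ) (λ τ → sq (g τ)) σ) (cong (_+ P (λ τ → sq (g τ)) σ) (P-*ˡ (- (ι 2 * z)) g σ))))
        (solve 3 (λ z m q → z :* z :+ ((:- (con (+ 2) :* z)) :* m :+ q) := (q :- m :* m) :+ (z :- m) :* (z :- m)) refl z μ (P (λ τ → sq (g τ)) σ))))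
    expand : inv′ N * E g σ ≡ Var + sq (x - μ)
    expand = around x
    lazy : sq (x - μ) ≤ ι k * Var
    lazy = subst₂ _≤_ (trans (cong (ι k *_) rescale) (trans (symm (*-assoc _ _ _)) (trans (cong (_* sq (x - μ)) (trans (*-comm _ _) (inv-cancel k 1≤k))) (*-identityˡ _))))
        (cong (ι k *_) (trans (around μ) (solve 2 (λ v m → v :+ (m :- m) :* (m :- m) := v) refl Var μ)))
        (*-monoˡ (0≤ι k) (*-monoˡ (0≤inv N) (∑-mono (allFin n) (λ v → ≤-trans (≤-reflexive (trans (sq-flip x μ) (cong (λ ρ → sq (μ - g ρ)) (symm (step-self v Q)))))
          (single-≤-∑ (enumFin k) (λ c → sq (μ - g (step G σ v c))) (λ c → 0≤sq _) (lookup σ v))))))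
      where
      rescale : inv′ N * ∑ (allFin n) (λ _ → sq (x - μ)) ≡ inv′ k * sq (x - μ)
      rescale = trans (cong₂ _*_ (inv-* n k 1≤n 1≤k) (trans (∑-const (allFin n) _) (cong (λ m → ι m * sq (x - μ)) (Listₚ.length-tabulate {n = n} id))))
        (trans (solve 4 (λ a b c d → (a :* b) :* (c :* d) := (a :* c) :* (b :* d)) refl (inv′ n) (inv′ k) (ι n) (sq (x - μ)))
          (trans (cong (_* (inv′ k * sq (x - μ))) (inv-cancel n 1≤n)) (*-identityˡ _)))

  energy-drop : ∀ g → ∑Ω (E g) ≤ ι (N *ℕ suc k) * (∑Ω (λ σ → sq (g σ)) - ∑Ω (λ σ → sq (P g σ)))
  energy-drop g = subst₂ _≤_ lhs rhs (*-monoˡ (0≤ι N) (∑Ω-mono (λ σ Q → variance-drop g σ Q)))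
    where
    lhs : ι N * ∑Ω (λ σ → inv′ N * E g σ) ≡ ∑Ω (E g)
    lhs = trans (cong (ι N *_) (∑Ω-*ˡ (inv′ N) (E g))) (trans (symm (*-assoc _ _ _)) (trans (cong (_* ∑Ω (E g)) (trans (*-comm _ _) (inv-cancel N 1≤N))) (*-identityˡ _)))
    rhs : ι N * ∑Ω (λ σ → (1ℚ + ι k) * (P (λ τ → sq (g τ)) σ - sq (P g σ))) ≡ ι (N *ℕ suc k) * (∑Ω (λ σ → sq (g σ)) - ∑Ω (λ σ → sq (P g σ)))
    rhs = trans (cong (ι N *_) (trans (∑Ω-*ˡ (1ℚ + ι k) _) (cong ((1ℚ + ι k) *_) (trans (∑Ω-- _ _) (cong (_- ∑Ω (λ σ → sq (P g σ))) (∑Ω-P (λ τ → sq (g τ))))))))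
      (trans (symm (*-assoc _ _ _)) (cong (_* (∑Ω (λ σ → sq (g σ)) - ∑Ω (λ σ → sq (P g σ)))) (symm (trans (ι-* N (suc k)) (cong (ι N *_) (ι-suc k))))))

  ‖_‖² : (Col k n → ℚ) → ℚ
  ‖ g ‖² = ∑Ω (λ σ → sq (g σ))

  module Decay (A : ℕ) (poincaré : ∀ g → ∑Ω g ≡ 0ℚ → ‖ g ‖² ≤ ι A * ∑Ω (E g)) where

    -- The product combines the Poincaré constant with the loss in `energy-drop`. The successor
    -- makes it positive whatever `A` is, so that `slow` may cancel it.
    B : ℕ
    B = suc (A *ℕ (N *ℕ suc k))

    contract : ∀ g → ∑Ω g ≡ 0ℚ → ‖ g ‖² + ι B * ‖ P g ‖² ≤ ι B * ‖ g ‖²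
    contract g h = ≤-diff r (diff-≤ drop) (trans (cong (_* ‖ g ‖²) (ι-suc _)) (trans
        (solve 3 (λ b x y → (con (+ 1) :+ b) :* x := (x :+ (con (+ 1) :+ b) :* y) :+ (b :* (x :- y) :- y)) refl (ι (A *ℕ (N *ℕ suc k))) ‖ g ‖² ‖ P g ‖²)
        (cong (λ x → (‖ g ‖² + x * ‖ P g ‖²) + r) (symm (ι-suc _)))))
      where
      r : ℚ
      r = ι (A *ℕ (N *ℕ suc k)) * (‖ g ‖² - ‖ P g ‖²) - ‖ P g ‖²
      main : ‖ g ‖² ≤ ι (A *ℕ (N *ℕ suc k)) * (‖ g ‖² - ‖ P g ‖²)
      main = ≤-trans (poincaré g h) (≤-trans (*-monoˡ (0≤ι A) (energy-drop g))
        (≤-reflexive (trans (symm (*-assoc _ _ _)) (cong (_* (‖ g ‖² - ‖ P g ‖²)) (symm (ι-* A (N *ℕ suc k)))))))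
      shrink : ‖ P g ‖² ≤ ‖ g ‖²
      shrink = ≤-trans (∑Ω-mono (λ σ Q → ≤-diff _ (nonneg σ Q) (solve 2 (λ x y → y := x :+ (y :- x)) refl (sq (P g σ)) (P (λ τ → sq (g τ)) σ)))) (≤-reflexive (∑Ω-P (λ τ → sq (g τ))))
        where
        nonneg : ∀ σ → Proper G σ → 0ℚ ≤ P (λ τ → sq (g τ)) σ - sq (P g σ)
        nonneg σ Q = *-cancelˡ (ℚₚ.<-≤-trans 0<1 (≤-diff (ι k) (0≤ι k) refl)) (subst (_≤ (1ℚ + ι k) * (P (λ τ → sq (g τ)) σ - sq (P g σ))) (symm (zeroʳ _))
          (≤-trans (0≤* (0≤inv N) (0≤∑ (allFin n) (λ v → 0≤∑ (allFin k) (λ c → 0≤sq _)))) (variance-drop g σ Q)))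
      drop : ‖ P g ‖² ≤ ι (A *ℕ (N *ℕ suc k)) * (‖ g ‖² - ‖ P g ‖²)
      drop = ≤-trans shrink main

    -- By `contract` one step multiplies the squared norm by at most 1 - 1/B. The `j`-th power of
    -- this is bounded by B/(B + j), which goes through induction without exponentials and equals
    -- one half at `j = B`.
    slow : ∀ g → ∑Ω g ≡ 0ℚ → ∀ j → ι (B +ℕ j) * ‖ P^ j g ‖² ≤ ι B * ‖ g ‖²
    slow g h zero = ≤-reflexive (cong (λ m → ι m * ‖ g ‖²) (ℕₚ.+-identityʳ B))
    slow g h (suc j) = *-cancelˡ {ι B} (ℚₚ.<-≤-trans 0<1 (ι-mono (s≤s z≤n))) (≤-trans step₁ (*-monoˡ (0≤ι B) (slow g h j)))
      where
      x y : ℚ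
      x = ‖ P^ j g ‖²
      y = ‖ P^ (suc j) g ‖²
      c : ℚ
      c = ι B * x - (x + ι B * y)
      0≤c : 0ℚ ≤ c
      0≤c = diff-≤ (contract (P^ j g) (trans (∑Ω-P^ j g) h))
      step₁ : ι B * (ι (B +ℕ suc j) * y) ≤ ι B * (ι (B +ℕ j) * x)
      step₁ = ≤-diff ((1ℚ + ι (B +ℕ j)) * c + (1ℚ + ι j) * x)
        (0≤+ (0≤* (0≤+ (0≤ι 1) (0≤ι (B +ℕ j))) 0≤c) (0≤* (0≤+ (0≤ι 1) (0≤ι j)) (0≤∑Ω (λ σ → 0≤sq _))))
        (trans (cong (λ z → ι B * (z * x)) (ι-+ B j)) (trans
          (solve 4 (λ b j x y → b :* ((b :+ j) :* x) := b :* ((con (+ 1) :+ (b :+ j)) :* y) :+ ((con (+ 1) :+ (b :+ j)) :* (b :* x :- (x :+ b :* y)) :+ (con (+ 1) :+ j) :* x)) refl (ι B) (ι j) x y)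
          (cong₂ (λ u w → ι B * (u * y) + (w * c + (1ℚ + ι j) * x)) (symm (trans (cong ι (ℕₚ.+-suc B j)) (trans (ι-suc _) (+ˡ 1ℚ (ι-+ B j))))) (symm (+ˡ 1ℚ (ι-+ B j))))))

    halve : ∀ g → ∑Ω g ≡ 0ℚ → ι 2 * ‖ P^ B g ‖² ≤ ‖ g ‖²
    halve g h = *-cancelˡ {ι B} (ℚₚ.<-≤-trans 0<1 (ι-mono (s≤s z≤n))) (subst (_≤ ι B * ‖ g ‖²)
      (trans (cong (_* ‖ P^ B g ‖²) (ι-+ B B)) (solve 2 (λ b x → (b :+ b) :* x := b :* (con (+ 2) :* x)) refl (ι B) ‖ P^ B g ‖²)) (slow g h B))

    decay : ∀ g → ∑Ω g ≡ 0ℚ → ∀ r → ι (2 ^ℕ r) * ‖ P^ (r *ℕ B) g ‖² ≤ ‖ g ‖²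
    decay g h zero = ≤-reflexive (*-identityˡ _)
    decay g h (suc r) = ≤-trans (≤-reflexive (trans (cong₂ _*_ (ι-* 2 (2 ^ℕ r)) (∑Ω-cong (λ σ _ → cong sq (P^-+ B (r *ℕ B) g σ))))
        (solve 3 (λ a b x → (a :* b) :* x := b :* (a :* x)) refl (ι 2) (ι (2 ^ℕ r)) ‖ P^ B (P^ (r *ℕ B) g) ‖²)))
      (≤-trans (*-monoˡ (0≤ι (2 ^ℕ r)) (halve (P^ (r *ℕ B) g) (trans (∑Ω-P^ (r *ℕ B) g) h))) (decay g h r))

-- From functions to the total variation distance

sumℚ≡ : ∀ xs → sumℚ xs ≡ ∑ xs id
sumℚ≡ [] = symm (ιℤ≡ (+ 0))
sumℚ≡ (x ∷ xs) = trans (cong (x ℚ.+_) (sumℚ≡ xs)) (symm (+≡ x _))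

∑-filter : ∀ {A : Set} (p : A → Bool) xs (f : A → ℚ) → ∑ (filterᵇ p xs) f ≡ ∑ xs (λ x → χ (p x) * f x)
∑-filter p [] f = refl
∑-filter p (x ∷ xs) f with p x
... | true  = cong₂ _+_ (symm (*-identityˡ (f x))) (∑-filter p xs f)
... | false = trans (∑-filter p xs f) (symm (trans (cong (_+ _) (zeroˡ (f x))) (+-identityˡ _)))

abstract
  0≤? : ∀ z → Dec (0ℚ ≤ z)
  0≤? z = 0ℚ ℚₚ.≤? z

sign : ℚ → ℚ
sign z = if does (0≤? z) then 1ℚ else (- 1ℚ)

sq-sign : ∀ z → sq (sign z) ≤ 1ℚ
sq-sign z with does (0≤? z)
... | true  = ≤-reflexive (*-identityˡ 1ℚ)
... | false = ≤-reflexive (solve 0 ((:- con (+ 1)) :* (:- con (+ 1)) := con (+ 1)) refl)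

∣∣≡ : ∀ z → ℚ.∣ z ∣ ≡ sign z * z
∣∣≡ z with 0≤? z
... | yes h = trans (ℚₚ.0≤p⇒∣p∣≡p (subst (_≤ z) (ιℤ≡ (+ 0)) h)) (symm (*-identityˡ z))
... | no h = trans (symm (ℚₚ.∣-p∣≡∣p∣ z)) (trans (ℚₚ.0≤p⇒∣p∣≡p (ℚₚ.neg-antimono-≤ (subst (z ≤_) (ιℤ≡ (+ 0)) (ℚₚ.<⇒≤ (ℚₚ.≰⇒> h)))))
      (trans (symm (-≡ z)) (solve 1 (λ x → :- x := (:- con (+ 1)) :* x) refl z)))

module TotalVariation {n} (G : Graph n) (k : ℕ) (1≤n : 1 ≤ℕ n) (1≤k : 1 ≤ℕ k) where
  open Glauber G k 1≤n 1≤k public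

  #Ω : ℕ
  #Ω = length (properCols G k)

  properCols-∑ : ∀ f → ∑ (properCols G k) f ≡ ∑Ω f
  properCols-∑ f = trans (∑-filter (proper G) Ω f) (∑-cong Ω (λ σ → cong (λ b → χ b * f σ) (symm (isProper≡ G σ))))

  ι-#Ω : ι #Ω ≡ ∑Ω (λ _ → 1ℚ)
  ι-#Ω = trans (symm (*-identityʳ _)) (trans (symm (∑-const (properCols G k) 1ℚ)) (properCols-∑ (λ _ → 1ℚ)))

  1≤#Ω : ∀ {x} → Proper G x → 1 ≤ℕ #Ω
  1≤#Ω {x} Q = ι-cancel (subst (1ℚ ≤_) (symm ι-#Ω) (subst (_≤ ∑Ω (λ _ → 1ℚ)) (trans (*-identityʳ _) (cong χ (proper⁺ G Q)))
    (single-≤-∑ (enumCol k n) (λ σ → χ (isProper G σ) * 1ℚ) (λ σ → 0≤* (0≤χ (isProper G σ)) (0≤ι 1)) x)))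

  ∑Ω-const : ∀ p → ∑Ω (λ _ → p) ≡ ι #Ω * p
  ∑Ω-const p = trans (∑Ω-cong (λ _ _ → symm (*-identityʳ p))) (trans (∑Ω-*ˡ p (λ _ → 1ℚ)) (trans (*-comm p _) (cong (_* p) (symm ι-#Ω))))

  average : (Col k n → ℚ) → ℚ
  average g = inv′ #Ω * ∑Ω g

  centred : ∀ {x} → Proper G x → ∀ g → ∑Ω (λ σ → g σ - average g) ≡ 0ℚ
  centred Q g = trans (∑Ω-- g _) (trans (cong (λ y → ∑Ω g - y) (trans (∑Ω-const (average g)) (trans (symm (*-assoc _ _ _))
    (trans (cong (_* ∑Ω g) (trans (*-comm _ _) (inv-cancel #Ω (1≤#Ω Q)))) (*-identityˡ _))))) (solve 1 (λ y → y :- y := con (+ 0)) refl (∑Ω g)))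

  dist-suc : ∀ t x y → dist G k (suc t) x y ≡ P (λ z → dist G k t z y) x
  dist-suc t x y = trans (symm (*≡ (inv N) (sumℚ (concatMap row (allFin n))))) (cong₂ _*_ (symm (inv≡ N)) (trans (sumℚ≡ (concatMap row (allFin n))) (trans (∑-concatMap row (allFin n) id) (∑-cong (allFin n) (λ v → ∑-map (λ c → dist G k t (step G x v c) y) (allFin k) id)))))
    where
    row : Fin n → List ℚ
    row v = map (λ c → dist G k t (step G x v c) y) (allFin k)

  dist-zero : ∀ x y → dist G k zero x y ≡ χ (does (y ≟ᶜ x))
  dist-zero x y with x ≟ᶜ y | y ≟ᶜ x
  ... | yes _ | yes _ = symm (ιℤ≡ (+ 1))
  ... | no _ | no _ = symm (ιℤ≡ (+ 0))
  ... | yes p | no ¬q = ⊥-elim (¬q (symm p))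
  ... | no ¬p | yes q = ⊥-elim (¬p (symm q))

  -- `dist` unfolds at the first step, not the last; this is the backward equation, the same
  -- recursion that defines `P^`.
  dist-P^ : ∀ t (s : Col k n → ℚ) x → Proper G x → ∑Ω (λ y → dist G k t x y * s y) ≡ P^ t s x
  dist-P^ zero s x Q = trans (∑-cong Ω (λ y → trans (cong (λ d → χ (isProper G y) * (d * s y)) (dist-zero x y)) (solve 3 (λ a b c → a :* (b :* c) := b :* (a :* c)) refl (χ (isProper G y)) (χ (does (y ≟ᶜ x))) (s y))))
    (trans (deltaCol k n x (λ y → χ (isProper G y) * s y)) (trans (cong (λ b → χ b * s x) (proper⁺ G Q)) (*-identityˡ _)))
  dist-P^ (suc t) s x Q = trans (∑Ω-cong (λ y _ → trans (cong (_* s y) (dist-suc t x y)) (trans (*-assoc _ _ _) (cong (inv′ N *_) (trans (symm (∑-*ʳ (allFin n) (s y) _)) (∑-cong (allFin n) (λ v → symm (∑-*ʳ (allFin k) (s y) _))))))))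
    (trans (∑Ω-*ˡ (inv′ N) _) (cong (inv′ N *_) (trans (∑Ω-∑ (allFin n) _) (∑-cong (allFin n) (λ v → trans (∑Ω-∑ (allFin k) _)
      (∑-cong (allFin k) (λ c → dist-P^ t s (step G x v c) (step-proper Q))))))))

  -- The sum of absolute values is attained by one test function, the sign of the difference, and
  -- then equals `P^ t s x - average s`. The factor one half in the distance turns 1/2 into 1/4.
  tv-≤ : ∀ t x → Proper G x → (∀ s → (∀ y → sq (s y) ≤ 1ℚ) → P^ t s x - average s ≤ inv′ 2) → tvDist G k t x ≤ (+ 1 ℚ./ 4)
  tv-≤ t x Q h = subst₂ _≤_ (*≡ ℚ.½ X) (trans (*≡ ℚ.½ (inv′ 2)) (cong (ℚ.½ ℚ.*_) (inv≡ 2)))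
      (*-monoˡ (subst (_≤ ℚ.½) (symm (ιℤ≡ (+ 0))) (ℚₚ.nonNegative⁻¹ ℚ.½)) (subst (_≤ inv′ 2) (symm X≡) (h s (λ y → sq-sign (z y)))))
    where
    z s : Col k n → ℚ
    z y = dist G k t x y ℚ.- πval G k
    s y = sign (z y)
    X : ℚ
    X = sumℚ (map (λ y → ℚ.∣ z y ∣) (properCols G k))
    each : ∀ y → ℚ.∣ z y ∣ ≡ dist G k t x y * s y - inv′ #Ω * s y
    each y = trans (∣∣≡ (z y)) (trans (cong (s y *_) (trans (symm (+≡ (dist G k t x y) (ℚ.- πval G k))) (cong (λ q → dist G k t x y + q) (trans (symm (-≡ (inv #Ω))) (cong (λ p → - p) (symm (inv≡ #Ω)))))))
      (solve 3 (λ a b c → a :* (b :+ (:- c)) := b :* a :- c :* a) refl (s y) (dist G k t x y) (inv′ #Ω)))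
    X≡ : X ≡ P^ t s x - average s
    X≡ = trans (sumℚ≡ (map (λ y → ℚ.∣ z y ∣) (properCols G k))) (trans (∑-map (λ y → ℚ.∣ z y ∣) (properCols G k) id) (trans (∑-cong (properCols G k) each) (trans (properCols-∑ _)
      (trans (∑Ω-- _ _) (cong₂ _-_ (dist-P^ t s x Q) (∑Ω-*ˡ (inv′ #Ω) s))))))

  length-allCols : ∀ m → ι (length (allCols k m)) ≡ ι (k ^ℕ m)
  length-allCols zero = refl
  length-allCols (suc m) = trans (trans (symm (*-identityʳ _)) (symm (∑-const (allCols k (suc m)) 1ℚ))) (trans (∑-concatMap _ (allFin k) _)
    (trans (∑-cong (allFin k) (λ c → trans (∑-map (c ∷ᵛ_) (allCols k m) _) (trans (∑-const (allCols k m) 1ℚ) (trans (*-identityʳ _) (length-allCols m)))))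
      (trans (∑-const (allFin k) _) (trans (cong (λ l → ι l * ι (k ^ℕ m)) (Listₚ.length-tabulate {n = k} id)) (symm (ι-* k (k ^ℕ m)))))))

  #Ω≤ : ι #Ω ≤ ι (k ^ℕ n)
  #Ω≤ = ≤-trans (ι-mono (Listₚ.length-filter _ Ω)) (≤-reflexive (length-allCols n))

  variance-≤ : ∀ {x} → Proper G x → ∀ s → (∀ y → sq (s y) ≤ 1ℚ) → ‖ (λ σ → s σ - average s) ‖² ≤ ι (k ^ℕ n)
  variance-≤ Q s h = ≤-trans (≤-diff (ι #Ω * sq m) (0≤* (0≤ι #Ω) (0≤sq m)) eq) (≤-trans (∑Ω-mono (λ σ _ → h σ)) (≤-trans (≤-reflexive (symm ι-#Ω)) #Ω≤))
    where
    m S : ℚ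
    m = average s
    S = ∑Ω s
    S≡ : S ≡ ι #Ω * m
    S≡ = symm (trans (symm (*-assoc _ _ _)) (trans (cong (_* S) (trans (*-comm _ _) (inv-cancel #Ω (1≤#Ω Q)))) (*-identityˡ _)))
    eq : ∑Ω (λ σ → sq (s σ)) ≡ ∑Ω (λ σ → sq (s σ - m)) + ι #Ω * sq m
    eq = symm (trans (cong (_+ ι #Ω * sq m) (trans (∑Ω-cong (λ σ _ → solve 2 (λ a m → (a :- m) :* (a :- m) := a :* a :+ ((:- (con (+ 2) :* m)) :* a :+ m :* m)) refl (s σ) m))
      (trans (∑Ω-+ _ _) (+ˡ (∑Ω (λ σ → sq (s σ))) (trans (∑Ω-+ _ _) (cong₂ _+_ (trans (∑Ω-*ˡ (- (ι 2 * m)) s) (cong (- (ι 2 * m) *_) S≡)) (∑Ω-const (sq m))))))))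
      (solve 3 (λ q w m → (q :+ ((:- (con (+ 2) :* m)) :* (w :* m) :+ w :* (m :* m))) :+ w :* (m :* m) := q) refl (∑Ω (λ σ → sq (s σ))) (ι #Ω) m))

  sq-cancel-≤ : ∀ p q → 0ℚ < q → sq p ≤ sq q → p ≤ q
  sq-cancel-≤ p q 0<q h with ℚₚ.≤-total p q
  ... | inj₁ l = l
  ... | inj₂ l = *-cancelˡ 0<q (≤-trans (*-monoʳ (≤-trans (ℚₚ.<⇒≤ 0<q) l) l) h)

  module FromPoincaré (A : ℕ) (poincaré : ∀ g → ∑Ω g ≡ 0ℚ → ‖ g ‖² ≤ ι A * ∑Ω (E g)) (r : ℕ) (big : 4 *ℕ k ^ℕ n ≤ℕ 2 ^ℕ r) where
    open Decay A poincaré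

    -- Since the norm is a plain sum, it dominates the square of the value at `x`. It starts at no
    -- more than `k ^ n`, so `r` halvings with `2 ^ r` at least `4 * k ^ n` bring the square down to
    -- 1/4.
    mixes : ∀ x → Proper G x → tvDist G k (r *ℕ B) x ≤ (+ 1 ℚ./ 4)
    mixes x Q = tv-≤ (r *ℕ B) x Q bound
      where
      bound : ∀ s → (∀ y → sq (s y) ≤ 1ℚ) → P^ (r *ℕ B) s x - average s ≤ inv′ 2
      bound s h = subst (_≤ inv′ 2) (P^-- (r *ℕ B) s (average s) x) (sq-cancel-≤ F (inv′ 2) 0<½ sqF)
        where
        g : Col k n → ℚ
        g σ = s σ - average s
        F : ℚ
        F = P^ (r *ℕ B) g x
        0<½ : 0ℚ < inv′ 2
        0<½ = ℚₚ.≰⇒> (λ l → case ι-cancel {1} {0} (≤-trans (≤-reflexive (symm (inv-cancel 2 (s≤s z≤n)))) (≤-trans (*-monoʳ (0≤ι 2) l) (≤-reflexive (zeroˡ _)))) of λ ())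
        point : sq F ≤ ‖ P^ (r *ℕ B) g ‖²
        point = subst (_≤ ‖ P^ (r *ℕ B) g ‖²) (trans (cong (λ b → χ b * sq F) (proper⁺ G Q)) (*-identityˡ _))
          (single-≤-∑ (enumCol k n) (λ σ → χ (isProper G σ) * sq (P^ (r *ℕ B) g σ)) (λ σ → 0≤* (0≤χ (isProper G σ)) (0≤sq _)) x)
        main : ι (4 *ℕ k ^ℕ n) * sq F ≤ ι (k ^ℕ n)
        main = ≤-trans (*-monoʳ (0≤sq F) (ι-mono big)) (≤-trans (*-monoˡ (0≤ι (2 ^ℕ r)) point) (≤-trans (decay g (centred Q s) r) (variance-≤ Q s h)))
        sqF : sq F ≤ sq (inv′ 2)
        sqF = *-cancelˡ {ι (4 *ℕ k ^ℕ n)} (ℚₚ.<-≤-trans 0<1 (ι-mono (ℕₚ.*-mono-≤ {1} {4} {1} {k ^ℕ n} (s≤s z≤n) (ℕₚ.m^n>0 k {{>-nonZero 1≤k}} n))))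
          (≤-trans main (≤-reflexive (symm (trans (cong (_* sq (inv′ 2)) (ι-* 4 (k ^ℕ n)))
            (trans (trans (cong (λ w → (w * ι (k ^ℕ n)) * sq (inv′ 2)) (ι-* 2 2)) (solve 3 (λ t w i → ((t :* t) :* w) :* (i :* i) := ((i :* t) :* (i :* t)) :* w) refl (ι 2) (ι (k ^ℕ n)) (inv′ 2)))
              (trans (cong (λ w → (w * w) * ι (k ^ℕ n)) (inv-cancel 2 (s≤s z≤n))) (trans (cong (_* ι (k ^ℕ n)) (*-identityˡ 1ℚ)) (*-identityˡ _))))))))

-- Coupling when there are many colours

0<ι : ∀ m → 1 ≤ℕ m → 0ℚ < ι m
0<ι m h = ℚₚ.<-≤-trans 0<1 (ι-mono h)

Free? : ∀ {n k} (G : Graph n) (σ : Col k n) v c → Dec (Free G σ v c)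
Free? G σ v c with isFree G σ v c in e
... | true = yes (free⁻ G e)
... | false = no (λ fr → case trans (symm (free⁺ G fr)) e of λ ())

blocked : ∀ {n k} (G : Graph n) (σ : Col k n) v c → ¬ Free G σ v c → ∃ λ w → Adj G v w ≡ true × lookup σ w ≡ c
blocked G σ v c h with Finₚ.any? (λ w → (Adj G v w Boolₚ.≟ true) ×-dec (lookup σ w Finₚ.≟ c))
... | yes p = p
... | no none = ⊥-elim (h (mkFree (λ w a e → none (w , a , e))))

module Oscillation {n} (G : Graph n) (k : ℕ) (1≤n : 1 ≤ℕ n) (1≤k : 1 ≤ℕ k) where
  open TotalVariation G k 1≤n 1≤k public

  below-average : ∀ {x} → Proper G x → ∀ h δ → (∀ y → Proper G y → h x - h y ≤ δ) → h x - average h ≤ δ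
  below-average {x} Q h δ bound = subst₂ _≤_ lhs rhs (*-monoˡ (0≤inv #Ω) (∑Ω-mono bound))
    where
    scale : ∀ p → inv′ #Ω * (ι #Ω * p) ≡ p
    scale p = trans (symm (*-assoc _ _ _)) (trans (cong (_* p) (inv-cancel #Ω (1≤#Ω Q))) (*-identityˡ p))
    lhs : inv′ #Ω * ∑Ω (λ y → h x - h y) ≡ h x - average h
    lhs = trans (cong (inv′ #Ω *_) (trans (∑Ω-- _ _) (cong (_- ∑Ω h) (∑Ω-const (h x))))) (trans (solve 3 (λ i a b → i :* (a :- b) := i :* a :- i :* b) refl (inv′ #Ω) (ι #Ω * h x) (∑Ω h)) (cong (_- average h) (scale (h x))))
    rhs : inv′ #Ω * ∑Ω (λ _ → δ) ≡ δ
    rhs = trans (cong (inv′ #Ω *_) (∑Ω-const δ)) (scale δ)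

  -- As `P` preserves averages, `average s` is the mean of the values `P^ t s y`. Comparing `x` with
  -- each `y` suffices, and this is what a coupling provides.
  oscillation-mixes : ∀ t x → Proper G x → (∀ s → (∀ y → sq (s y) ≤ 1ℚ) → ∀ y → Proper G y → P^ t s x - P^ t s y ≤ inv′ 2) → tvDist G k t x ≤ (+ 1 ℚ./ 4)
  oscillation-mixes t x Q h = tv-≤ t x Q (λ s hs → subst (λ m → P^ t s x - m ≤ inv′ 2) (cong (inv′ #Ω *_) (∑Ω-P^ t s)) (below-average Q (P^ t s) (inv′ 2) (h s hs)))

-- With many colours the identity coupling contracts the Hamming distance.
module ManyColours {n} (G : Graph n) (k : ℕ) (1≤n : 1 ≤ℕ n) (1≤k : 1 ≤ℕ k) (8n≤k : 8 *ℕ n ≤ℕ k) where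
  open Oscillation G k 1≤n 1≤k public

  V : List (Fin n)
  V = allFin n

  C : List (Fin k)
  C = allFin k

  diff? : ∀ (x y : Col k n) w → Dec (lookup x w ≢ lookup y w)
  diff? x y w = ¬? (lookup x w Finₚ.≟ lookup y w)

  abstract
    dif : Col k n → Col k n → Fin n → ℚ
    dif x y w = χ (does (diff? x y w))

    0≤dif : ∀ x y w → 0ℚ ≤ dif x y w
    0≤dif x y w = 0≤χ (does (diff? x y w))

    dif≤1 : ∀ x y w → dif x y w ≤ 1ℚ
    dif≤1 x y w = χ≤1 (does (diff? x y w))

    dif-≡ : ∀ {x y w} → lookup x w ≡ lookup y w → dif x y w ≡ 0ℚ
    dif-≡ {x} {y} {w} e = cong χ (dec-false (diff? x y w) (λ h → h e))

    dif-≢ : ∀ {x y w} → lookup x w ≢ lookup y w → dif x y w ≡ 1ℚ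
    dif-≢ {x} {y} {w} h = cong χ (does⁺ (diff? x y w) h)

  dif-cong : ∀ {x y x' y' w} → lookup x w ≡ lookup x' w → lookup y w ≡ lookup y' w → dif x y w ≡ dif x' y' w
  dif-cong {x} {y} {x'} {y'} {w} e₁ e₂ with lookup x w Finₚ.≟ lookup y w
  ... | yes e = trans (dif-≡ e) (symm (dif-≡ (trans (symm e₁) (trans e e₂))))
  ... | no h = trans (dif-≢ h) (symm (dif-≢ (λ e → h (trans e₁ (trans e (symm e₂))))))

  ham : Col k n → Col k n → ℚ
  ham x y = ∑ V (dif x y)

  0≤ham : ∀ x y → 0ℚ ≤ ham x y
  0≤ham x y = 0≤∑ V (0≤dif x y)

  ham≤n : ∀ x y → ham x y ≤ ι n
  ham≤n x y = ≤-trans (∑-mono V (dif≤1 x y)) (≤-reflexive (trans (∑-const V 1ℚ) (trans (*-identityʳ _) (cong ι (Listₚ.length-tabulate {n = n} id)))))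

  step-off : ∀ (x : Col k n) v c {w} → w ≢ v → lookup (step G x v c) w ≡ lookup x w
  step-off x v c {w} w≢v with Free? G x v c
  ... | yes fr = trans (cong (λ ρ → lookup ρ w) (step-free G fr)) (Vecₚ.lookup∘update′ w≢v x c)
  ... | no h = cong (λ ρ → lookup ρ w) (trans (step≡ G x v c) (cong (λ r → if r then x [ v ]≔ c else x) (not-free h)))
    where
    not-free : ¬ Free G x v c → isFree G x v c ≡ false
    not-free h with isFree G x v c in e
    ... | true = ⊥-elim (h (free⁻ G e))
    ... | false = refl

  step-blocked : ∀ (x : Col k n) v c → ¬ Free G x v c → step G x v c ≡ x
  step-blocked x v c h with isFree G x v c in e
  ... | true = ⊥-elim (h (free⁻ G e))
  ... | false = trans (step≡ G x v c) (cong (λ r → if r then x [ v ]≔ c else x) e)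

  step-at : ∀ (x : Col k n) v c → Free G x v c → lookup (step G x v c) v ≡ c
  step-at x v c fr = trans (cong (λ ρ → lookup ρ v) (step-free G fr)) (Vecₚ.lookup∘update v x c)

  hits : Col k n → Fin k → Fin n → ℚ
  hits x c w = χ (does (lookup x w Finₚ.≟ c))

  hits-sum : ∀ x w → ∑ C (λ c → hits x c w) ≡ 1ℚ
  hits-sum x w = trans (∑-cong C (λ c → trans (cong χ (≡-dec-bool (lookup x w Finₚ.≟ c) (c Finₚ.≟ lookup x w) symm symm)) (symm (*-identityʳ _)))) (deltaFin k (lookup x w) (λ _ → 1ℚ))

  used : Col k n → Fin k → ℚ
  used x c = ∑ V (hits x c)

  0≤hits : ∀ x c w → 0ℚ ≤ hits x c w
  0≤hits x c w = 0≤χ (does (lookup x w Finₚ.≟ c))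

  used≥1 : ∀ {x c w} → lookup x w ≡ c → 1ℚ ≤ used x c
  used≥1 {x} {c} {w} e = subst (_≤ used x c) (cong χ (does⁺ (lookup x w Finₚ.≟ c) e)) (single-≤-∑ (enumFin n) (hits x c) (0≤hits x c) w)

  used-sum : ∀ x → ∑ C (used x) ≡ ι n
  used-sum x = trans (∑-swap C V _) (trans (∑-cong V (hits-sum x)) (trans (∑-const V 1ℚ) (trans (*-identityʳ _) (cong ι (Listₚ.length-tabulate {n = n} id)))))

  clash : Col k n → Col k n → Fin k → ℚ
  clash x y c = ∑ V (λ w → dif x y w * (hits x c w + hits y c w))

  0≤clash : ∀ x y c → 0ℚ ≤ clash x y c
  0≤clash x y c = 0≤∑ V (λ w → 0≤* (0≤dif x y w) (0≤+ (0≤hits x c w) (0≤hits y c w)))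

  clash-sum : ∀ x y → ∑ C (clash x y) ≡ ι 2 * ham x y
  clash-sum x y = trans (∑-swap C V _) (trans (∑-cong V (λ w → trans (∑-*ˡ C (dif x y w) _) (trans (cong (dif x y w *_) (trans (∑-+ C _ _) (cong₂ _+_ (hits-sum x w) (hits-sum y w))))
    (solve 1 (λ d → d :* (con (+ 1) :+ con (+ 1)) := con (+ 2) :* d) refl (dif x y w))))) (∑-*ˡ V (ι 2) _))

  clash≥1 : ∀ {x y c w} → dif x y w ≡ 1ℚ → 1ℚ ≤ hits x c w + hits y c w → 1ℚ ≤ clash x y c
  clash≥1 {x} {y} {c} {w} e h = ≤-trans h (≤-trans (≤-reflexive (trans (symm (*-identityˡ _)) (cong (_* (hits x c w + hits y c w)) (symm e))))
    (single-≤-∑ (enumFin n) (λ w → dif x y w * (hits x c w + hits y c w)) (λ w → 0≤* (0≤dif x y w) (0≤+ (0≤hits x c w) (0≤hits y c w))) w))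

  -- An old disagreement at `v` survives only if `c` is used somewhere. A new one needs `c` blocked
  -- in one copy and free in the other, hence held by a vertex at which the copies differ. Adjacency
  -- to `v` is dropped from the counts, which `8 * n ≤ k` can afford.
  new-dif : ∀ x y v c → dif (step G x v c) (step G y v c) v ≤ dif x y v * (used x c + used y c) + clash x y c
  new-dif x y v c with lookup x v Finₚ.≟ lookup y v | Free? G x v c | Free? G y v c
  ... | _ | yes fx | yes fy = ≤-trans (≤-reflexive (dif-≡ (trans (step-at x v c fx) (symm (step-at y v c fy)))))
        (0≤+ (0≤* (0≤dif x y v) (0≤+ (0≤∑ V (0≤hits x c)) (0≤∑ V (0≤hits y c)))) (0≤clash x y c))
  ... | no h | no bx | _ with blocked G x v c bx
  ...   | w , _ , e = ≤-trans (dif≤1 _ _ v) (≤-trans (used≥1 {x} e) (≤-diff (used y c + clash x y c) (0≤+ (0≤∑ V (0≤hits y c)) (0≤clash x y c))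
          (trans (cong (λ d → d * (used x c + used y c) + clash x y c) (dif-≢ h)) (solve 3 (λ a b d → con (+ 1) :* (a :+ b) :+ d := a :+ (b :+ d)) refl (used x c) (used y c) (clash x y c)))))
  new-dif x y v c | no h | yes fx | no by with blocked G y v c by
  ...   | w , _ , e = ≤-trans (dif≤1 _ _ v) (≤-trans (used≥1 {y} e) (≤-diff (used x c + clash x y c) (0≤+ (0≤∑ V (0≤hits x c)) (0≤clash x y c))
          (trans (cong (λ d → d * (used x c + used y c) + clash x y c) (dif-≢ h)) (solve 3 (λ a b d → con (+ 1) :* (a :+ b) :+ d := b :+ (a :+ d)) refl (used x c) (used y c) (clash x y c)))))
  new-dif x y v c | yes e | no bx | no by = ≤-trans (≤-reflexive (trans (cong₂ (λ p q → dif p q v) (step-blocked x v c bx) (step-blocked y v c by)) (dif-≡ e)))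
        (0≤+ (0≤* (0≤dif x y v) (0≤+ (0≤∑ V (0≤hits x c)) (0≤∑ V (0≤hits y c)))) (0≤clash x y c))
  new-dif x y v c | yes e | no bx | yes fy with blocked G x v c bx
  ...   | w , a , e' = ≤-trans (dif≤1 _ _ v) (≤-trans (clash≥1 {x} {y} {c} {w} (dif-≢ (λ q → unused fy w a (trans (symm q) e')))
          (≤-diff (hits y c w) (0≤hits y c w) (cong (λ b → χ b + hits y c w) (does⁺ (lookup x w Finₚ.≟ c) e'))))
          (≤-diff (dif x y v * (used x c + used y c)) (0≤* (0≤dif x y v) (0≤+ (0≤∑ V (0≤hits x c)) (0≤∑ V (0≤hits y c)))) (+-comm _ _)))
  new-dif x y v c | yes e | yes fx | no by with blocked G y v c by
  ...   | w , a , e' = ≤-trans (dif≤1 _ _ v) (≤-trans (clash≥1 {x} {y} {c} {w} (dif-≢ (λ q → unused fx w a (trans q e')))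
          (≤-diff (hits x c w) (0≤hits x c w) (trans (cong (λ b → hits x c w + χ b) (does⁺ (lookup y w Finₚ.≟ c) e')) (+-comm _ _))))
          (≤-diff (dif x y v * (used x c + used y c)) (0≤* (0≤dif x y v) (0≤+ (0≤∑ V (0≤hits x c)) (0≤∑ V (0≤hits y c)))) (+-comm _ _)))

  ham-step : ∀ x y v c → ham (step G x v c) (step G y v c) ≤ (ham x y - dif x y v) + (dif x y v * (used x c + used y c) + clash x y c)
  ham-step x y v c = ≤-trans (≤-reflexive (trans (∑-cong V pt) (trans (∑-+ V _ _) (cong₂ _+_ (trans (∑-- V _ _) (cong (λ d → ham x y - d) (deltaFin n v (dif x y)))) (deltaFin n v (dif x' y'))))))
      (+-mono-≤ (≤-refl {ham x y - dif x y v}) (new-dif x y v c))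
    where
    x' y' : Col k n
    x' = step G x v c
    y' = step G y v c
    pt : ∀ w → dif x' y' w ≡ (dif x y w - χ (does (w Finₚ.≟ v)) * dif x y w) + χ (does (w Finₚ.≟ v)) * dif x' y' w
    pt w with w Finₚ.≟ v
    ... | yes refl = solve 2 (λ a b → b := (a :- con (+ 1) :* a) :+ con (+ 1) :* b) refl (dif x y w) (dif x' y' w)
    ... | no w≢v = trans (dif-cong (step-off x v c w≢v) (step-off y v c w≢v)) (solve 2 (λ a b → a := (a :- con (+ 0) :* a) :+ con (+ 0) :* b) refl (dif x y w) (dif x' y' w))

  -- Moves at disagreeing vertices gain `k` times the distance; blocked ones give back at most
  -- `2 * n` times it, and new disagreements add at most another `2 * n` times it.
  ham-total : ∀ x y → ∑M (λ v c → ham (step G x v c) (step G y v c)) ≤ (ι N - ι k + ι 4 * ι n) * ham x y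
  ham-total x y = ≤-trans (∑M-mono (ham-step x y)) (≤-reflexive (trans (∑-cong V row) (trans (∑-+ V _ _) (trans (cong₂ _+_ first second) assemble))))
    where
    len : length V ≡ n
    len = Listₚ.length-tabulate {n = n} id
    first : ∑ V (λ v → ι k * (ham x y - dif x y v)) ≡ ι k * (ι n * ham x y - ham x y)
    first = trans (∑-*ˡ V (ι k) _) (cong (ι k *_) (trans (∑-- V _ _) (cong (_- ham x y) (trans (∑-const V (ham x y)) (cong (λ m → ι m * ham x y) len)))))
    second : ∑ V (λ v → dif x y v * (ι n + ι n) + ι 2 * ham x y) ≡ ham x y * (ι n + ι n) + ι n * (ι 2 * ham x y)
    second = trans (∑-+ V _ _) (cong₂ _+_ (∑-*ʳ V (ι n + ι n) (dif x y)) (trans (∑-const V (ι 2 * ham x y)) (cong (λ m → ι m * (ι 2 * ham x y)) len)))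
    assemble : ι k * (ι n * ham x y - ham x y) + (ham x y * (ι n + ι n) + ι n * (ι 2 * ham x y)) ≡ (ι N - ι k + ι 4 * ι n) * ham x y
    assemble = trans (solve 3 (λ n k h → k :* (n :* h :- h) :+ (h :* (n :+ n) :+ n :* (con (+ 2) :* h)) := (n :* k :- k :+ con (+ 4) :* n) :* h) refl (ι n) (ι k) (ham x y))
      (cong (λ m → (m - ι k + ι 4 * ι n) * ham x y) (symm (ι-* n k)))
    row : ∀ v → ∑ C (λ c → (ham x y - dif x y v) + (dif x y v * (used x c + used y c) + clash x y c)) ≡ ι k * (ham x y - dif x y v) + (dif x y v * (ι n + ι n) + ι 2 * ham x y)
    row v = trans (∑-+ C _ _) (cong₂ _+_ (trans (∑-const C _) (cong (λ m → ι m * (ham x y - dif x y v)) (Listₚ.length-tabulate {n = k} id)))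
      (trans (∑-+ C _ _) (cong₂ _+_ (trans (∑-*ˡ C (dif x y v) _) (cong (dif x y v *_) (trans (∑-+ C _ _) (cong₂ _+_ (used-sum x) (used-sum y))))) (clash-sum x y))))

  Lip : ℚ → (Col k n → ℚ) → Set
  Lip c g = ∀ x y → Proper G x → Proper G y → g x - g y ≤ c * ham x y

  -- With `8 * n ≤ k` the coefficient in `ham-total` is at most N - k/2 = N (1 - 1/(2 n)), so the
  -- distance contracts by 1 - 1/D per step.
  D : ℕ
  D = 2 *ℕ n

  1≤D : 1 ≤ℕ D
  1≤D = ℕₚ.≤-trans 1≤n (ℕₚ.m≤m+n n (n +ℕ 0))

  P-lip : ∀ {c c' g} → 0ℚ ≤ c → ι D * c ≤ c + ι D * c' → Lip c g → Lip c' (P g)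
  P-lip {c} {c'} {g} 0≤c cc' L x y Qx Qy = *-cancelˡ {ι D * ι N} (subst (0ℚ <_) (ι-* D N) (0<ι (D *ℕ N) (ℕₚ.*-mono-≤ 1≤D 1≤N))) (≤-trans (≤-reflexive lhs)
      (≤-trans (*-monoˡ (0≤ι D) (≤-trans (∑M-mono (λ v d → L _ _ (step-proper Qx) (step-proper Qy))) (≤-trans (≤-reflexive (∑M-*ˡ c _)) (*-monoˡ 0≤c (ham-total x y)))))
        (≤-diff (ι n * c * ham x y * (ι k - ι 8 * ι n) + ι N * ham x y * (c + ι D * c' - ι D * c))
          (0≤+ (0≤* (0≤* (0≤* (0≤ι n) 0≤c) (0≤ham x y)) (diff-≤ (subst (_≤ ι k) (ι-* 8 n) (ι-mono 8n≤k)))) (0≤* (0≤* (0≤ι N) (0≤ham x y)) (diff-≤ cc')))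
          final)))
    where
    lhs : ι D * ι N * (P g x - P g y) ≡ ι D * ∑M (λ v d → g (step G x v d) - g (step G y v d))
    lhs = trans (*-assoc _ _ _) (cong (ι D *_) (trans (cong (ι N *_) (symm (P-diff x y))) (trans (symm (*-assoc _ _ _)) (trans (cong (_* ∑M (λ v d → g (step G x v d) - g (step G y v d))) (trans (*-comm _ _) (inv-cancel N 1≤N))) (*-identityˡ _)))))
      where
      P-diff : ∀ x y → inv′ N * ∑M (λ v d → g (step G x v d) - g (step G y v d)) ≡ P g x - P g y
      P-diff x y = trans (cong (inv′ N *_) (trans (∑-cong V (λ v → ∑-- C _ _)) (∑-- V _ _))) (solve 3 (λ i a b → i :* (a :- b) := i :* a :- i :* b) refl (inv′ N) _ _)
    final : ι D * ι N * (c' * ham x y) ≡ ι D * (c * ((ι N - ι k + ι 4 * ι n) * ham x y)) + (ι n * c * ham x y * (ι k - ι 8 * ι n) + ι N * ham x y * (c + ι D * c' - ι D * c))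
    final = trans (cong₂ (λ d m → d * m * (c' * ham x y)) (ι-* 2 n) (ι-* n k)) (trans
      (solve 5 (λ n k c c' h → (con (+ 2) :* n) :* (n :* k) :* (c' :* h) :=
          (con (+ 2) :* n) :* (c :* ((n :* k :- k :+ con (+ 4) :* n) :* h)) :+ (n :* c :* h :* (k :- con (+ 8) :* n) :+ (n :* k) :* h :* (c :+ (con (+ 2) :* n) :* c' :- (con (+ 2) :* n) :* c))) refl
        (ι n) (ι k) c c' (ham x y))
      (cong₂ (λ d m → d * (c * ((m - ι k + ι 4 * ι n) * ham x y)) + (ι n * c * ham x y * (ι k - ι 8 * ι n) + m * ham x y * (c + d * c' - d * c))) (symm (ι-* 2 n)) (symm (ι-* n k))))

  -- A bound for the `j`-th power of 1 - 1/D, of the same kind as in `slow`: it is one half at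
  -- `j = D`.
  rate : ℕ → ℚ
  rate j = ι D * inv′ (D +ℕ j)

  0≤rate : ∀ j → 0ℚ ≤ rate j
  0≤rate j = 0≤* (0≤ι D) (0≤inv (D +ℕ j))

  rate-step : ∀ j → ι D * rate j ≤ rate j + ι D * rate (suc j)
  rate-step j = *-cancelˡ {ι a * ι a'} (subst (0ℚ <_) (ι-* a a') (0<ι (a *ℕ a') (ℕₚ.*-mono-≤ 1≤a 1≤a'))) (subst₂ _≤_ (symm left) (symm right)
      (≤-diff (ι D * (1ℚ + ι j)) (0≤* (0≤ι D) (0≤+ (0≤ι 1) (0≤ι j))) eq))
    where
    a a' : ℕ
    a = D +ℕ j
    a' = D +ℕ suc j
    1≤a : 1 ≤ℕ a
    1≤a = ℕₚ.≤-trans 1≤D (ℕₚ.m≤m+n D j)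
    1≤a' : 1 ≤ℕ a'
    1≤a' = ℕₚ.≤-trans 1≤D (ℕₚ.m≤m+n D (suc j))
    i i' : ℚ
    i = inv′ a
    i' = inv′ a'
    left : ι a * ι a' * (ι D * rate j) ≡ ι D * ι D * ι a'
    left = trans (solve 4 (λ a a' d i → a :* a' :* (d :* (d :* i)) := d :* d :* a' :* (i :* a)) refl (ι a) (ι a') (ι D) i) (trans (cong (ι D * ι D * ι a' *_) (inv-cancel a 1≤a)) (*-identityʳ _))
    right : ι a * ι a' * (rate j + ι D * rate (suc j)) ≡ ι D * ι a' + ι D * ι D * ι a
    right = trans (solve 5 (λ a a' d i i' → a :* a' :* (d :* i :+ d :* (d :* i')) := d :* a' :* (i :* a) :+ d :* d :* a :* (i' :* a')) refl (ι a) (ι a') (ι D) i i')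
      (cong₂ _+_ (trans (cong (ι D * ι a' *_) (inv-cancel a 1≤a)) (*-identityʳ _)) (trans (cong (ι D * ι D * ι a *_) (inv-cancel a' 1≤a')) (*-identityʳ _)))
    eq : ι D * ι a' + ι D * ι D * ι a ≡ ι D * ι D * ι a' + ι D * (1ℚ + ι j)
    eq = trans (cong₂ (λ p q → ι D * p + ι D * ι D * q) ea' (ι-+ D j)) (trans (solve 2 (λ d j → d :* (d :+ (con (+ 1) :+ j)) :+ d :* d :* (d :+ j) := d :* d :* (d :+ (con (+ 1) :+ j)) :+ d :* (con (+ 1) :+ j)) refl (ι D) (ι j))
      (cong (λ p → ι D * ι D * p + ι D * (1ℚ + ι j)) (symm ea')))
      where
      ea' : ι a' ≡ ι D + (1ℚ + ι j)
      ea' = trans (ι-+ D (suc j)) (+ˡ (ι D) (ι-suc j))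

  lip-iterate : ∀ {c g} → 0ℚ ≤ c → Lip c g → ∀ j → Lip (c * rate j) (P^ j g)
  lip-iterate {c} {g} 0≤c L zero x y Qx Qy = ≤-trans (L x y Qx Qy) (≤-reflexive (cong (_* ham x y) (symm (trans (cong (c *_) (trans (cong (λ m → ι D * inv′ m) (ℕₚ.+-identityʳ D)) (trans (*-comm _ _) (inv-cancel D 1≤D)))) (*-identityʳ c)))))
  lip-iterate {c} {g} 0≤c L (suc j) = P-lip (0≤* 0≤c (0≤rate j)) (subst₂ _≤_ (solve 3 (λ c d r → c :* (d :* r) := d :* (c :* r)) refl c (ι D) (rate j))
      (solve 4 (λ c d r s → c :* (r :+ d :* s) := c :* r :+ d :* (c :* s)) refl c (ι D) (rate j) (rate (suc j))) (*-monoˡ 0≤c (rate-step j)))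
    (lip-iterate 0≤c L j)

  halfway : rate D ≡ inv′ 2
  halfway = trans (cong (ι D *_) (trans (cong inv′ (symm (trans (cong (D +ℕ_) (ℕₚ.+-identityʳ D)) refl))) (inv-* 2 D (s≤s z≤n) 1≤D)))
    (trans (solve 3 (λ d i j → d :* (i :* j) := i :* (j :* d)) refl (ι D) (inv′ 2) (inv′ D)) (trans (cong (inv′ 2 *_) (inv-cancel D 1≤D)) (*-identityʳ _)))

  half^ : ℕ → ℚ
  half^ zero = 1ℚ
  half^ (suc r) = half^ r * inv′ 2

  0≤half^ : ∀ r → 0ℚ ≤ half^ r
  0≤half^ zero = 0≤ι 1
  0≤half^ (suc r) = 0≤* (0≤half^ r) (0≤inv 2)

  half^-2^ : ∀ r → half^ r * ι (2 ^ℕ r) ≡ 1ℚ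
  half^-2^ zero = *-identityˡ 1ℚ
  half^-2^ (suc r) = trans (cong (half^ (suc r) *_) (ι-* 2 (2 ^ℕ r))) (trans (solve 4 (λ h i t p → (h :* i) :* (t :* p) := (h :* p) :* (i :* t)) refl (half^ r) (inv′ 2) (ι 2) (ι (2 ^ℕ r)))
    (trans (cong₂ _*_ (half^-2^ r) (inv-cancel 2 (s≤s z≤n))) (*-identityˡ 1ℚ)))

  lip-halving : ∀ {c g} → 0ℚ ≤ c → Lip c g → ∀ r → Lip (c * half^ r) (P^ (r *ℕ D) g)
  lip-halving {c} 0≤c L zero x y Qx Qy = ≤-trans (L x y Qx Qy) (≤-reflexive (cong (_* ham x y) (symm (*-identityʳ c))))
  lip-halving {c} {g} 0≤c L (suc r) x y Qx Qy = subst₂ _≤_ (cong₂ _-_ (symm (P^-+ D (r *ℕ D) g x)) (symm (P^-+ D (r *ℕ D) g y)))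
      (cong (_* ham x y) (trans (cong (c * half^ r *_) halfway) (*-assoc _ _ _)))
      (lip-iterate (0≤* 0≤c (0≤half^ r)) (lip-halving 0≤c L r) D x y Qx Qy)

  bounded-lip : ∀ s → (∀ y → sq (s y) ≤ 1ℚ) → Lip (ι 2) s
  bounded-lip s h x y _ _ with x ≟ᶜ y
  ... | yes refl = ≤-trans (≤-reflexive (solve 1 (λ a → a :- a := con (+ 0)) refl (s x))) (0≤* (0≤ι 2) (0≤ham x x))
  ... | no x≢y = ≤-trans (≤-diff _ (0≤+ (diff-≤ (up-to-1 x)) (diff-≤ (neg-1 y))) (solve 2 (λ a b → con (+ 2) := (a :- b) :+ ((con (+ 1) :- a) :+ (b :- (:- con (+ 1))))) refl (s x) (s y)))
      (≤-trans (≤-reflexive (symm (*-identityʳ (ι 2)))) (*-monoˡ (0≤ι 2) far))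
    where
    up-to-1 : ∀ y → s y ≤ 1ℚ
    up-to-1 y = sq-cancel-≤ (s y) 1ℚ 0<1 (≤-trans (h y) (≤-reflexive (symm (*-identityˡ 1ℚ))))
    neg-1 : ∀ y → - 1ℚ ≤ s y
    neg-1 y = subst (- 1ℚ ≤_) (solve 1 (λ a → :- (:- a) := a) refl (s y)) (neg-antimono (sq-cancel-≤ (- s y) 1ℚ 0<1
      (≤-trans (≤-reflexive (solve 1 (λ a → (:- a) :* (:- a) := a :* a) refl (s y))) (≤-trans (h y) (≤-reflexive (symm (*-identityˡ 1ℚ)))))))
    far : 1ℚ ≤ ham x y
    far with Finₚ.any? (diff? x y)
    ... | yes (w , d) = subst (_≤ ham x y) (dif-≢ d) (single-≤-∑ (enumFin n) (dif x y) (0≤dif x y) w)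
    ... | no none = ⊥-elim (x≢y (Vec-ext (λ w → case lookup x w Finₚ.≟ lookup y w of λ { (yes e) → e ; (no d) → ⊥-elim (none (w , d)) })))

  mixes : ∀ r → 4 *ℕ n ≤ℕ 2 ^ℕ r → ∀ x → Proper G x → tvDist G k (r *ℕ D) x ≤ (+ 1 ℚ./ 4)
  mixes r 4n≤2^r x Q = oscillation-mixes (r *ℕ D) x Q (λ s h y Qy → ≤-trans (lip-halving (0≤ι 2) (bounded-lip s h) r x y Q Qy)
      (≤-trans (*-monoˡ (0≤* (0≤ι 2) (0≤half^ r)) (ham≤n x y)) small))
    where
    small : ι 2 * half^ r * ι n ≤ inv′ 2
    small = *-cancelˡ {ι 2} (0<ι 2 (s≤s z≤n)) (subst₂ _≤_ (trans (cong (half^ r *_) (trans (ι-* 4 n) (cong (_* ι n) (ι-* 2 2)))) (solve 3 (λ h t n → h :* ((t :* t) :* n) := t :* (t :* h :* n)) refl (half^ r) (ι 2) (ι n)))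
      (trans (half^-2^ r) (symm (trans (*-comm _ _) (inv-cancel 2 (s≤s z≤n))))) (*-monoˡ (0≤half^ r) (ι-mono 4n≤2^r)))

-- Perfect elimination orderings of chordal graphs

abstract
  count : ∀ {n} → Vec Bool n → ℕ
  count {n} S = length (filterᵇ (lookup S) (allFin n))

  count≤n : ∀ {n} (S : Vec Bool n) → count S ≤ℕ n
  count≤n {n} S = ℕₚ.≤-trans (Listₚ.length-filter _ (allFin n)) (ℕₚ.≤-reflexive (Listₚ.length-tabulate {n = n} id))

  count-< : ∀ {n} (S T : Vec Bool n) {v} → lookup S v ≡ false → lookup T v ≡ true → (∀ x → lookup S x ≡ true → lookup T x ≡ true) → count S <ℕ count T
  count-< {n} S T {v} v∉S v∈T S⊆T = ι-cancel (≤-trans (≤-reflexive (trans (ι-suc (count S)) (trans (cong₂ _+_ (symm (deltaFin n v (λ _ → 1ℚ))) (ι-count (lookup S) (allFin n))) (symm (∑-+ (allFin n) _ _)))))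
      (≤-trans (∑-mono (allFin n) pt) (≤-reflexive (symm (ι-count (lookup T) (allFin n))))))
    where
    pt : ∀ x → χ (does (x Finₚ.≟ v)) * 1ℚ + χ (lookup S x) ≤ χ (lookup T x)
    pt x with x Finₚ.≟ v
    ... | yes refl rewrite v∉S | v∈T = ≤-reflexive (solve 0 (con (+ 1) :* con (+ 1) :+ con (+ 0) := con (+ 1)) refl)
    ... | no _ = ≤-trans (≤-reflexive (trans (cong (_+ χ (lookup S x)) (zeroˡ 1ℚ)) (+-identityˡ _))) (χ-mono (S⊆T x))

module Elimination {n} (G : Graph n) (chordal : Chordal G) where

  infix 4 _∈_ _∉_ _~_

  _∈_ _∉_ : Fin n → Vec Bool n → Set
  x ∈ S = lookup S x ≡ true
  x ∉ S = lookup S x ≡ false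

  _∈?_ : ∀ x S → Dec (x ∈ S)
  x ∈? S = lookup S x Boolₚ.≟ true

  ∉⁺ : ∀ {x S} → ¬ x ∈ S → x ∉ S
  ∉⁺ {x} {S} h with lookup S x
  ... | true = ⊥-elim (h refl)
  ... | false = refl

  record _~_ (x y : Fin n) : Set where
    constructor edge
    field adj : Adj G x y ≡ true
  open _~_

  _~?_ : ∀ x y → Dec (x ~ y)
  x ~? y = map′ edge adj (Adj G x y Boolₚ.≟ true)

  ~-sym : ∀ {x y} → x ~ y → y ~ x
  ~-sym (edge h) = edge (Adj-sym {k = 0} G h)

  ~-irrefl : ∀ {x} → ¬ x ~ x
  ~-irrefl (edge h) = Adj-≢ {k = 0} G h refl

  abstract
    filterSet : {P : Fin n → Set} → (∀ x → Dec (P x)) → Vec Bool n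
    filterSet d = tabulateᵛ (λ x → does (d x))

    filterSet⁺ : ∀ {P : Fin n → Set} (d : ∀ x → Dec (P x)) {x} → P x → x ∈ filterSet d
    filterSet⁺ d {x} p = trans (Vecₚ.lookup∘tabulate _ x) (does⁺ (d x) p)

    filterSet⁻ : ∀ {P : Fin n → Set} (d : ∀ x → Dec (P x)) {x} → x ∈ filterSet d → P x
    filterSet⁻ d {x} h = does⁻ (d x) (trans (symm (Vecₚ.lookup∘tabulate _ x)) h)

  insert-∈ : ∀ (S : Vec Bool n) {v x} → x ∈ S [ v ]≔ true → x ≡ v ⊎ x ∈ S
  insert-∈ S {v} {x} h with x Finₚ.≟ v
  ... | yes e = inj₁ e
  ... | no ne = inj₂ (trans (symm (Vecₚ.lookup∘update′ ne S true)) h)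

  ∈-insert : ∀ (S : Vec Bool n) {v x} → x ∈ S → x ∈ S [ v ]≔ true
  ∈-insert S {v} {x} h with x Finₚ.≟ v
  ... | yes refl = Vecₚ.lookup∘update x S true
  ... | no ne = trans (Vecₚ.lookup∘update′ ne S true) h

  delete-∈ : ∀ (S : Vec Bool n) {v x} → x ∈ S [ v ]≔ false → x ≢ v × x ∈ S
  delete-∈ S {v} {x} h with x Finₚ.≟ v
  ... | yes refl = case trans (symm h) (Vecₚ.lookup∘update x S false) of λ ()
  ... | no ne = ne , trans (symm (Vecₚ.lookup∘update′ ne S false)) h

  ∈-delete : ∀ (S : Vec Bool n) {v x} → x ≢ v → x ∈ S → x ∈ S [ v ]≔ false
  ∈-delete S ne h = trans (Vecₚ.lookup∘update′ ne S false) h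

  data Conn (C : Vec Bool n) : Fin n → Fin n → Set where
    done : ∀ {x} → Conn C x x
    move : ∀ {x y z} → x ~ y → y ∈ C → Conn C y z → Conn C x z

  conn-trans : ∀ {C x y z} → Conn C x y → Conn C y z → Conn C x z
  conn-trans done q = q
  conn-trans (move a m p) q = move a m (conn-trans p q)

  conn-sym : ∀ {C x y} → x ∈ C → Conn C x y → Conn C y x
  conn-sym x∈ done = done
  conn-sym x∈ (move a y∈ p) = conn-trans (conn-sym y∈ p) (move (~-sym a) x∈ done)

  conn-mono : ∀ {C v x y} → Conn C x y → Conn (C [ v ]≔ true) x y
  conn-mono done = done
  conn-mono {C} (move a m p) = move a (∈-insert C m) (conn-mono p)

  record Component (R : Vec Bool n) (w : Fin n) : Set where
    field
      C         : Vec Bool n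
      w∈C       : w ∈ C
      C⊆R       : ∀ {x} → x ∈ C → x ∈ R
      connected : ∀ {x} → x ∈ C → Conn C w x
      closed    : ∀ {x y} → x ∈ C → x ~ y → y ∈ R → y ∈ C

  abstract
    component : ∀ R {w} → w ∈ R → Component R w
    component R {w} w∈R = grow n (filterSet is-w) (ℕₚ.m≤n+m n _) (filterSet⁺ is-w refl)
        (λ h → subst (_∈ R) (symm (filterSet⁻ is-w h)) w∈R) (λ h → subst (Conn _ w) (symm (filterSet⁻ is-w h)) done)
      where
      is-w : ∀ x → Dec (x ≡ w)
      is-w x = x Finₚ.≟ w
      grow : ∀ m C → n ≤ℕ count C +ℕ m → w ∈ C → (∀ {x} → x ∈ C → x ∈ R) → (∀ {x} → x ∈ C → Conn C w x) → Component R w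
      grow m C bound w∈ sub conn with Finₚ.any? (λ y → (y ∈? R ×-dec ¬? (y ∈? C)) ×-dec Finₚ.any? (λ x → x ∈? C ×-dec (x ~? y)))
      ... | no none = record { C = C ; w∈C = w∈ ; C⊆R = sub ; connected = conn ; closed = λ {x} {y} x∈ a y∈ → closed x∈ a y∈ }
        where
        closed : ∀ {x y} → x ∈ C → x ~ y → y ∈ R → y ∈ C
        closed {x} {y} x∈ a y∈ with y ∈? C
        ... | yes h = h
        ... | no h = ⊥-elim (none (y , (y∈ , h) , (x , x∈ , a)))
      ... | yes (y , (y∈R , y∉C) , (x , x∈C , a)) = more m bound
        where
        C' : Vec Bool n
        C' = C [ y ]≔ true
        larger : count C <ℕ count C'
        larger = count-< C C' (∉⁺ {y} {C} y∉C) (Vecₚ.lookup∘update y C true) (λ z → ∈-insert C)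
        more : ∀ m → n ≤ℕ count C +ℕ m → Component R w
        more zero b = ⊥-elim (ℕₚ.<-irrefl refl (ℕₚ.<-≤-trans (ℕₚ.≤-<-trans (subst (n ≤ℕ_) (ℕₚ.+-identityʳ _) b) larger) (count≤n C')))
        more (suc m) b = grow m C' (ℕₚ.≤-trans b (ℕₚ.≤-trans (ℕₚ.≤-reflexive (ℕₚ.+-suc (count C) m)) (ℕₚ.+-monoˡ-≤ m larger))) (∈-insert C w∈)
          (λ h → case insert-∈ C h of λ { (inj₁ refl) → y∈R ; (inj₂ h') → sub h' })
          (λ h → case insert-∈ C h of λ { (inj₁ refl) → conn-trans (conn-mono (conn x∈C)) (move a (Vecₚ.lookup∘update y C true) done) ; (inj₂ h') → conn-mono (conn h') })

  -- If two vertices of N(v) that both see a component C of G - N[v] were not adjacent,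
  -- a shortest path between them through C would close up with v to an induced cycle.
  module _ (C : Vec Bool n) {v x y : Fin n} (v~x : v ~ x) (v~y : v ~ y) (v-far : ∀ {c} → c ∈ C → ¬ v ~ c) (v∉C : ¬ v ∈ C)
           (x≢y : x ≢ y) (x≁y : ¬ x ~ y) where

    -- Only the starting vertex may lie outside `C` and differ from `y`. The inner vertices of a
    -- walk from `x` without repetitions are thus in `C`, out of sight of `v`.
    data Walkʸ : ℕ → Fin n → Set where
      stop : Walkʸ 0 y
      go   : ∀ {l z z'} → z ~ z' → (z' ∈ C ⊎ z' ≡ y) → Walkʸ l z' → Walkʸ (suc l) z

    at : ∀ {l z} → Walkʸ l z → Fin (suc l) → Fin n
    at {z = z} w zero = z
    at (go _ _ w) (suc i) = at w i

    at-last : ∀ {l z} (w : Walkʸ l z) i → toℕ i ≡ l → at w i ≡ y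
    at-last stop zero _ = refl
    at-last (go _ _ w) (suc i) e = at-last w i (ℕₚ.suc-injective e)

    at-suc : ∀ {l z} (w : Walkʸ l z) (i : Fin l) → at w (suc i) ∈ C ⊎ at w (suc i) ≡ y
    at-suc (go _ h w) zero = h
    at-suc (go _ h w) (suc i) = at-suc w i

    at-next : ∀ {l z} (w : Walkʸ l z) i j → toℕ j ≡ suc (toℕ i) → at w i ~ at w j
    at-next (go a _ w) zero (suc zero) _ = a
    at-next (go a _ w) (suc i) (suc j) e = at-next w i j (ℕₚ.suc-injective e)

    suffix : ∀ {l z} (w : Walkʸ l z) i → ∃ λ m → (m +ℕ toℕ i ≡ l) × Walkʸ m (at w i)
    suffix {l} w zero = l , ℕₚ.+-identityʳ l , w
    suffix (go _ _ w) (suc i) with suffix w i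
    ... | m , e , s = m , trans (ℕₚ.+-suc m (toℕ i)) (cong suc e) , s

    splice : ∀ {l z m} (w : Walkʸ l z) i → Walkʸ m (at w i) → Walkʸ (toℕ i +ℕ m) z
    splice w zero s = s
    splice (go a h w) (suc i) s = go a h (splice w i s)

    Chordless : ∀ {l z} → Walkʸ l z → Set
    Chordless {l} w = ∀ i j → toℕ i <ℕ toℕ j → at w i ≢ at w j × (at w i ~ at w j → toℕ j ≡ suc (toℕ i))

    -- A repeated vertex or a chord lets the prefix be joined directly to a later suffix; the length
    -- drops strictly, which is what makes `chordless` terminate.
    shorten : ∀ {l z} (w : Walkʸ l z) → Chordless w ⊎ ∃ λ m → m <ℕ l × Walkʸ m z
    shorten {l} {z} w with Finₚ.any? (λ i → Finₚ.any? (λ j → (toℕ i ℕₚ.<? toℕ j) ×-dec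
        ((at w i Finₚ.≟ at w j) ⊎-dec ((at w i ~? at w j) ×-dec ¬? (toℕ j ℕₚ.≟ suc (toℕ i))))))
    ... | no none = inj₁ (λ i j lt → (λ e → none (i , j , lt , inj₁ e)) , (λ a → case toℕ j ℕₚ.≟ suc (toℕ i) of λ
            { (yes e) → e ; (no ne) → ⊥-elim (none (i , j , lt , inj₂ (a , ne))) }))
    ... | yes (i , j , lt , inj₁ e) with suffix w j
    ...   | m , em , s = inj₂ (toℕ i +ℕ m , ℕₚ.<-≤-trans (ℕₚ.+-monoˡ-< m lt) (ℕₚ.≤-reflexive (trans (ℕₚ.+-comm (toℕ j) m) em)) ,
              splice w i (subst (Walkʸ m) (symm e) s))
    shorten {l} {z} w | yes (i , suc j , lt , inj₂ (a , ne)) with suffix w (suc j)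
    ...   | m , em , s = inj₂ (toℕ i +ℕ suc m ,
              ℕₚ.<-≤-trans (ℕₚ.≤-reflexive (cong suc (ℕₚ.+-suc (toℕ i) m))) (ℕₚ.≤-trans (ℕₚ.+-monoˡ-≤ m (ℕₚ.≤∧≢⇒< lt (λ e → ne (symm e)))) (ℕₚ.≤-reflexive (trans (ℕₚ.+-comm (suc (toℕ j)) m) em))) ,
              splice w i (go a (at-suc w j) s))

    chordless : ∀ b {l z} → l ≤ℕ b → Walkʸ l z → ∃ λ m → Σ (Walkʸ m z) Chordless
    chordless b {l} l≤b w with shorten w
    ... | inj₁ c = l , w , c
    chordless zero l≤b w | inj₂ (m , m<l , w') = ⊥-elim (ℕₚ.n≮0 (ℕₚ.<-≤-trans m<l l≤b))
    chordless (suc b) l≤b w | inj₂ (m , m<l , w') = chordless b (ℕₚ.≤-pred (ℕₚ.<-≤-trans m<l l≤b)) w'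

    no-walk : ∀ {l} → ¬ Walkʸ l x
    no-walk {l₀} w₀ with chordless l₀ ℕₚ.≤-refl w₀
    ... | zero , stop , _ = x≢y refl
    ... | suc zero , go a _ stop , _ = x≁y a
    -- Lengths 0 and 1 contradict `x≢y` and `x≁y`. Length `l + 2` means `l + 3` vertices, and `v`
    -- closes them up to a cycle of length `4 + l`.
    ... | suc (suc l) , w , ch = chordal (4 +ℕ l) (s≤s (s≤s (s≤s (s≤s z≤n)))) f (inj , λ i j → mk⇔ (to i j) (from i j))
      where
      f : Fin (4 +ℕ l) → Fin n
      f zero = v
      f (suc i) = at w i
      at-inj : ∀ i j → at w i ≡ at w j → i ≡ j
      at-inj i j e with ℕₚ.<-cmp (toℕ i) (toℕ j)
      ... | tri< lt _ _ = ⊥-elim (proj₁ (ch i j lt) e)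
      ... | tri≈ _ e' _ = Finₚ.toℕ-injective e'
      ... | tri> _ _ gt = ⊥-elim (proj₁ (ch j i gt) (symm e))
      position : ∀ i → toℕ i ≡ 0 ⊎ (toℕ i ≡ 2 +ℕ l ⊎ at w i ∈ C)
      position zero = inj₁ refl
      position (suc i) with at-suc w i
      ... | inj₁ c = inj₂ (inj₂ c)
      ... | inj₂ e = inj₂ (inj₁ (trans (cong toℕ (at-inj (suc i) (fromℕ (2 +ℕ l)) (trans e (symm (at-last w _ (Finₚ.toℕ-fromℕ (2 +ℕ l))))))) (Finₚ.toℕ-fromℕ (2 +ℕ l))))
      v≢at : ∀ i → v ≢ at w i
      v≢at i e with position i
      ... | inj₁ p rewrite Finₚ.toℕ-injective {i = i} {j = zero} p = ~-irrefl (subst (v ~_) (symm e) v~x)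
      ... | inj₂ (inj₁ p) = ~-irrefl (subst (v ~_) (symm (trans e (at-last w i p))) v~y)
      ... | inj₂ (inj₂ c) = v∉C (subst (_∈ C) (symm e) c)
      inj : ∀ {i j} → f i ≡ f j → i ≡ j
      inj {zero} {zero} _ = refl
      inj {zero} {suc j} e = ⊥-elim (v≢at j e)
      inj {suc i} {zero} e = ⊥-elim (v≢at i (symm e))
      inj {suc i} {suc j} e = cong suc (at-inj i j e)
      hub : ∀ i → v ~ at w i → toℕ i ≡ 0 ⊎ toℕ i ≡ 2 +ℕ l
      hub i a with position i
      ... | inj₁ p = inj₁ p
      ... | inj₂ (inj₁ p) = inj₂ p
      ... | inj₂ (inj₂ c) = ⊥-elim (v-far c a)
      to : ∀ i j → Adj G (f i) (f j) ≡ true → CycAdj (4 +ℕ l) i j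
      to zero zero a = ⊥-elim (~-irrefl (edge a))
      to zero (suc j) a with hub j (edge a)
      ... | inj₁ p = inj₁ (cong suc p)
      ... | inj₂ p = inj₂ (inj₂ (inj₁ (refl , cong (2 +ℕ_) p)))
      to (suc i) zero a with hub i (~-sym (edge a))
      ... | inj₁ p = inj₂ (inj₁ (cong suc p))
      ... | inj₂ p = inj₂ (inj₂ (inj₂ (refl , cong (2 +ℕ_) p)))
      to (suc i) (suc j) a with ℕₚ.<-cmp (toℕ i) (toℕ j)
      ... | tri< lt _ _ = inj₁ (cong suc (proj₂ (ch i j lt) (edge a)))
      ... | tri≈ _ e _ = ⊥-elim (~-irrefl (subst (at w i ~_) (cong (at w) (symm (Finₚ.toℕ-injective e))) (edge a)))
      ... | tri> _ _ gt = inj₂ (inj₁ (cong suc (proj₂ (ch j i gt) (~-sym (edge a)))))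
      spoke : ∀ j → toℕ j ≡ 0 ⊎ toℕ j ≡ 2 +ℕ l → v ~ at w j
      spoke j (inj₁ p) rewrite Finₚ.toℕ-injective {i = j} {j = zero} p = v~x
      spoke j (inj₂ p) = subst (v ~_) (symm (at-last w j p)) v~y
      from : ∀ i j → CycAdj (4 +ℕ l) i j → Adj G (f i) (f j) ≡ true
      from zero zero (inj₁ ())
      from zero zero (inj₂ (inj₁ ()))
      from zero zero (inj₂ (inj₂ (inj₁ (_ , ()))))
      from zero zero (inj₂ (inj₂ (inj₂ (_ , ()))))
      from zero (suc j) (inj₁ e) = adj (spoke j (inj₁ (ℕₚ.suc-injective e)))
      from zero (suc j) (inj₂ (inj₂ (inj₁ (_ , e)))) = adj (spoke j (inj₂ (ℕₚ.suc-injective (ℕₚ.suc-injective e))))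
      from (suc i) zero (inj₂ (inj₁ e)) = adj (~-sym (spoke i (inj₁ (ℕₚ.suc-injective e))))
      from (suc i) zero (inj₂ (inj₂ (inj₂ (_ , e)))) = adj (~-sym (spoke i (inj₂ (ℕₚ.suc-injective (ℕₚ.suc-injective e)))))
      from (suc i) (suc j) (inj₂ (inj₂ (inj₁ (() , _))))
      from (suc i) (suc j) (inj₂ (inj₂ (inj₂ (() , _))))
      from (suc i) (suc j) (inj₁ e) = adj (at-next w i j (ℕₚ.suc-injective e))
      from (suc i) (suc j) (inj₂ (inj₁ e)) = adj (~-sym (at-next w j i (ℕₚ.suc-injective e)))

    conn-walk : ∀ {c c'} → Conn C c c' → c' ~ y → ∃ λ l → Walkʸ l c
    conn-walk done a = 1 , go a (inj₂ refl) stop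
    conn-walk (move a m p) a' with conn-walk p a'
    ... | l , w = suc l , go a (inj₁ m) w

    not-linked : ∀ {c c'} → x ~ c → c ∈ C → Conn C c c' → c' ~ y → ⊥
    not-linked a m p a' with conn-walk p a'
    ... | l , w = no-walk (go a (inj₁ m) w)

  Simplicial : Vec Bool n → Fin n → Set
  Simplicial S s = ∀ {y z} → y ∈ S → z ∈ S → s ~ y → s ~ z → y ≢ z → y ~ z

  Far : Vec Bool n → Fin n → Fin n → Set
  Far S v w = w ∈ S × (w ≢ v × ¬ v ~ w)

  abstract
    Far? : ∀ S v w → Dec (Far S v w)
    Far? S v w = (w ∈? S) ×-dec (¬? (w Finₚ.≟ v) ×-dec ¬? (v ~? w))

    anyFar? : ∀ S v → Dec (∃ (Far S v))
    anyFar? S v = Finₚ.any? (Far? S v)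

  universal : ∀ S {v} → ¬ (∃ λ w → Far S v w) → ∀ {w} → w ∈ S → w ≢ v → v ~ w
  universal S {v} none {w} w∈ w≢v with v ~? w
  ... | yes a = a
  ... | no ¬a = ⊥-elim (none (w , w∈ , w≢v , ¬a))

  -- Asking for a simplicial vertex away from `v` is what makes the induction work. `C` is a
  -- component of the vertices far from `v`, and `H` is `C` with its neighbours; `H` misses `v`,
  -- hence is smaller. The part of `H` outside `C` is a clique, and a vertex of `C` simplicial in
  -- `H` is simplicial in `S`, as `H` contains all its neighbours in `S`.
  dirac : ∀ m S → count S ≤ℕ m → ∀ {v} → v ∈ S → ∃ (Far S v) → ∃ λ s → Far S v s × Simplicial S s
  dirac zero S bound {v} v∈ _ = ⊥-elim (ℕₚ.n≮0 (ℕₚ.<-≤-trans (count-< (tabulateᵛ (λ _ → false)) S {v} (Vecₚ.lookup∘tabulate _ v) v∈ (λ x h → case trans (symm h) (Vecₚ.lookup∘tabulate _ x) of λ ())) bound))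
  dirac (suc m) S bound {v} v∈ (w , farw) = find
    where
    R : Vec Bool n
    R = filterSet (Far? S v)
    open Component (component R {w} (filterSet⁺ (Far? S v) farw))
    C-far : ∀ {c} → c ∈ C → Far S v c
    C-far h = filterSet⁻ (Far? S v) (C⊆R h)
    InH : Fin n → Set
    InH x = x ∈ S × (x ∈ C ⊎ ∃ λ c → c ∈ C × c ~ x)
    InH? : ∀ x → Dec (InH x)
    InH? x = (x ∈? S) ×-dec ((x ∈? C) ⊎-dec Finₚ.any? (λ c → (c ∈? C) ×-dec (c ~? x)))
    H : Vec Bool n
    H = filterSet InH?
    C⊆H : ∀ {c} → c ∈ C → c ∈ H
    C⊆H h = filterSet⁺ InH? (proj₁ (C-far h) , inj₁ h)
    nbr∈H : ∀ {c x} → c ∈ C → c ~ x → x ∈ S → x ∈ H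
    nbr∈H h a x∈ = filterSet⁺ InH? (x∈ , inj₂ (_ , h , a))
    boundary : ∀ {x} → x ∈ H → ¬ x ∈ C → v ~ x × ∃ λ c → c ∈ C × c ~ x
    boundary {x} h x∉C with filterSet⁻ InH? h
    ... | x∈S , inj₁ x∈C = ⊥-elim (x∉C x∈C)
    ... | x∈S , inj₂ (c , c∈C , a) with v ~? x
    ...   | yes v~x = v~x , c , c∈C , a
    ...   | no v≁x = ⊥-elim (x∉C (closed c∈C a (filterSet⁺ (Far? S v) (x∈S , (λ { refl → proj₂ (proj₂ (C-far c∈C)) (~-sym a) }) , v≁x))))
    v∉C : ¬ v ∈ C
    v∉C h = proj₁ (proj₂ (C-far h)) refl
    v∉H : v ∉ H
    v∉H = ∉⁺ {v} {H} (λ h → ~-irrefl (proj₁ (boundary h v∉C)))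
    boundary-clique : ∀ {x y} → x ∈ H → y ∈ H → ¬ x ∈ C → ¬ y ∈ C → x ≢ y → x ~ y
    boundary-clique {x} {y} hx hy x∉ y∉ x≢y with x ~? y
    ... | yes a = a
    ... | no x≁y with boundary hx x∉ | boundary hy y∉
    ...   | v~x , c , c∈ , c~x | v~y , c' , c'∈ , c'~y =
      ⊥-elim (not-linked C v~x v~y (λ h → proj₂ (proj₂ (C-far h))) v∉C x≢y x≁y (~-sym c~x) c∈
        (conn-trans (conn-sym w∈C (connected c∈)) (connected c'∈)) c'~y)
    lift : ∀ {s} → s ∈ C → Simplicial H s → Simplicial S s
    lift s∈ simp y∈ z∈ ay az = simp (nbr∈H s∈ ay y∈) (nbr∈H s∈ az z∈) ay az
    size : count H ≤ℕ m
    size = ℕₚ.≤-pred (ℕₚ.<-≤-trans (count-< H S v∉H v∈ (λ x h → proj₁ (filterSet⁻ InH? h))) bound)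
    Goal : Set
    Goal = ∃ λ s → Far S v s × Simplicial S s
    from-boundary : ∀ {x} → x ∈ H → ¬ x ∈ C → (∃ λ s → Far H x s × Simplicial H s) → Goal
    from-boundary {x} x∈H x∉C (s , (s∈H , s≢x , x≁s) , simp) with s ∈? C
    ... | yes s∈C = s , C-far s∈C , lift s∈C simp
    ... | no s∉C = ⊥-elim (x≁s (boundary-clique x∈H s∈H x∉C s∉C (λ e → s≢x (symm e))))
    -- When boundary vertices are adjacent to all of `H`, none of them can be far from `x`, so the
    -- vertex found by induction lies in `C`.
    from-inside : (∀ {x} → x ∈ H → ¬ x ∈ C → ¬ ∃ (Far H x)) → ∀ {x} → x ∈ C → (∃ λ s → Far H x s × Simplicial H s) → Goal
    from-inside noB {x} x∈C (s , (s∈H , s≢x , x≁s) , simp) with s ∈? C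
    ... | yes s∈C = s , C-far s∈C , lift s∈C simp
    ... | no s∉C = ⊥-elim (x≁s (~-sym (universal H (noB s∈H s∉C) (C⊆H x∈C) (λ e → s≢x (symm e)))))
    complete : (∀ {x} → x ∈ H → ¬ x ∈ C → ¬ ∃ (Far H x)) → (∀ {x} → x ∈ C → ¬ ∃ (Far H x)) → Simplicial H w
    complete noB noC {y} {z} y∈ z∈ _ _ y≢z with y ∈? C
    ... | yes y∈C = universal H (noC y∈C) z∈ (λ e → y≢z (symm e))
    ... | no y∉C = universal H (noB y∈ y∉C) z∈ (λ e → y≢z (symm e))
    find₂ : (∀ {x} → x ∈ H → ¬ x ∈ C → ¬ ∃ (Far H x)) → Dec (∃ λ x → x ∈ C × ∃ (Far H x)) → Goal
    find₂ noB (yes (x , x∈C , far)) = from-inside noB x∈C (dirac m H size (C⊆H x∈C) far)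
    find₂ noB (no noC) = w , farw , lift w∈C (complete noB (λ h u → noC (_ , h , u)))
    find₁ : Dec (∃ λ x → (x ∈ H × ¬ x ∈ C) × ∃ (Far H x)) → Goal
    find₁ (yes (x , (x∈H , x∉C) , far)) = from-boundary x∈H x∉C (dirac m H size x∈H far)
    find₁ (no noB) = find₂ (λ h h' u → noB (_ , (h , h') , u)) (Finₚ.any? (λ x → (x ∈? C) ×-dec anyFar? H x))
    find : Goal
    find = find₁ (Finₚ.any? (λ x → ((x ∈? H) ×-dec ¬? (x ∈? C)) ×-dec anyFar? H x))

  simplicial-exists : ∀ S {v} → v ∈ S → ∃ λ s → s ∈ S × Simplicial S s
  simplicial-exists S {v} v∈ with Finₚ.any? (λ x → (x ∈? S) ×-dec anyFar? S x)
  ... | yes (x , x∈ , far) with dirac (count S) S ℕₚ.≤-refl x∈ far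
  ...   | s , (s∈ , _) , simp = s , s∈ , simp
  simplicial-exists S {v} v∈ | no none = v , v∈ , λ {y} y∈ z∈ _ _ y≢z → universal S (λ u → none (y , y∈ , u)) z∈ (λ e → y≢z (symm e))

  record Order (S : Vec Bool n) (m : ℕ) : Set where
    field
      rank   : Fin n → ℕ
      rank<  : ∀ {x} → x ∈ S → rank x <ℕ m
      inj    : ∀ {x y} → x ∈ S → y ∈ S → rank x ≡ rank y → x ≡ y
      clique : ∀ {x y z} → x ∈ S → y ∈ S → z ∈ S → x ~ y → x ~ z → rank y <ℕ rank x → rank z <ℕ rank x → y ≢ z → y ~ z

  -- A simplicial vertex of `S` receives the highest rank `m`; its neighbours in `S` are then all
  -- earlier and form a clique.
  order : ∀ m S → count S ≤ℕ m → Order S m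
  order m S bound with Finₚ.any? (λ v → v ∈? S)
  ... | no none = record { rank = λ _ → 0 ; rank< = λ h → ⊥-elim (none (_ , h)) ; inj = λ h → ⊥-elim (none (_ , h)) ; clique = λ h → ⊥-elim (none (_ , h)) }
  ... | yes (v , v∈) with simplicial-exists S v∈
  order zero S bound | yes (v , v∈) | s , s∈ , simp = ⊥-elim (ℕₚ.n≮0 (ℕₚ.<-≤-trans (count-< (S [ s ]≔ false) S (Vecₚ.lookup∘update s S false) s∈ (λ x h → proj₂ (delete-∈ S h))) bound))
  order (suc m) S bound | yes (v , v∈) | s , s∈ , simp = record { rank = rank' ; rank< = rank<' ; inj = inj' ; clique = clique' }
    where
    S' : Vec Bool n
    S' = S [ s ]≔ false
    O : Order S' m
    O = order m S' (ℕₚ.≤-pred (ℕₚ.<-≤-trans (count-< (S [ s ]≔ false) S (Vecₚ.lookup∘update s S false) s∈ (λ x h → proj₂ (delete-∈ S h))) bound))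
    open Order O
    rank' : Fin n → ℕ
    rank' x = if does (x Finₚ.≟ s) then m else rank x
    rank'-s : rank' s ≡ m
    rank'-s rewrite does⁺ (s Finₚ.≟ s) refl = refl
    rank'-≢ : ∀ {x} → x ≢ s → rank' x ≡ rank x
    rank'-≢ {x} h rewrite dec-false (x Finₚ.≟ s) h = refl
    below : ∀ {x} → x ≢ s → x ∈ S → rank' x <ℕ m
    below h x∈ = subst (_<ℕ m) (symm (rank'-≢ h)) (rank< (∈-delete S h x∈))
    rank<' : ∀ {x} → x ∈ S → rank' x <ℕ suc m
    rank<' {x} x∈ with x Finₚ.≟ s
    ... | yes refl = ℕₚ.≤-reflexive refl
    ... | no h = ℕₚ.m≤n⇒m≤1+n (rank< (∈-delete S h x∈))
    inj' : ∀ {x y} → x ∈ S → y ∈ S → rank' x ≡ rank' y → x ≡ y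
    inj' {x} {y} x∈ y∈ e = byCases (x Finₚ.≟ s) (y Finₚ.≟ s)
      where
      byCases : Dec (x ≡ s) → Dec (y ≡ s) → x ≡ y
      byCases (yes p) (yes q) = trans p (symm q)
      byCases (yes refl) (no q) = ⊥-elim (ℕₚ.<-irrefl (trans (symm e) rank'-s) (below q y∈))
      byCases (no p) (yes refl) = ⊥-elim (ℕₚ.<-irrefl (trans e rank'-s) (below p x∈))
      byCases (no p) (no q) = inj (∈-delete S p x∈) (∈-delete S q y∈) (trans (symm (rank'-≢ p)) (trans e (rank'-≢ q)))
    clique' : ∀ {x y z} → x ∈ S → y ∈ S → z ∈ S → x ~ y → x ~ z → rank' y <ℕ rank' x → rank' z <ℕ rank' x → y ≢ z → y ~ z
    clique' {x} {y} {z} x∈ y∈ z∈ axy axz ly lz y≢z = byCases (x Finₚ.≟ s)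
      where
      byCases : Dec (x ≡ s) → y ~ z
      byCases (yes refl) = simp y∈ z∈ axy axz y≢z
      byCases (no p) = clique (∈-delete S p x∈) (∈-delete S y≢s y∈) (∈-delete S z≢s z∈) axy axz
          (subst₂ _<ℕ_ (rank'-≢ y≢s) (rank'-≢ p) ly) (subst₂ _<ℕ_ (rank'-≢ z≢s) (rank'-≢ p) lz) y≢z
        where
        y≢s : y ≢ s
        y≢s refl = ℕₚ.<-asym (below p x∈) (subst (_<ℕ rank' x) rank'-s ly)
        z≢s : z ≢ s
        z≢s refl = ℕₚ.<-asym (below p x∈) (subst (_<ℕ rank' x) rank'-s lz)

  peo : PEO G
  peo = record { rank = rank ; rank<n = λ x → rank< (all x) ; rank-inj = λ {x} {y} → inj (all x) (all y)
               ; clique = λ {x} {y} {z} a b l₁ l₂ ne → adj (clique (all x) (all y) (all z) (edge a) (edge b) l₁ l₂ ne) }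
    where
    full : Vec Bool n
    full = tabulateᵛ (λ _ → true)
    all : ∀ x → x ∈ full
    all x = Vecₚ.lookup∘tabulate _ x
    open Order (order n full (count≤n full))

-- The spectral gap

max-≥ : ∀ {m} (f : Fin m → ℕ) i → f i ≤ℕ foldr _⊔ℕ_ 0 (tabulate f)
max-≥ f zero = ℕₚ.m≤m⊔n (f zero) _
max-≥ f (suc i) = ℕₚ.≤-trans (max-≥ (f ∘ suc) i) (ℕₚ.m≤n⊔m (f zero) _)

degree≤ : ∀ {n} (G : Graph n) v → degree G v ≤ℕ maxDegree G
degree≤ {n} G v = subst (λ l → degree G v ≤ℕ foldr _⊔ℕ_ 0 l) (symm (Listₚ.map-tabulate id (degree G))) (max-≥ (degree G) v)

module _ {n k : ℕ} (G : Graph n) where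

  ∑-nbrs : ∀ v → ∑ (allFin n) (λ z → χ (Adj G v z)) ≤ ι (maxDegree G)
  ∑-nbrs v = ≤-trans (≤-reflexive (symm (ι-count (Adj G v) (allFin n)))) (ι-mono (degree≤ G v))

  -- Each colour is good, or the present colour of `w`, or the colour of a neighbour of `w`. This
  -- makes `k` minus maximum degree minus 1 an admissible `e`.
  colour-room : ∀ (τ : Col k n) w → k ≤ℕ length (filterᵇ (λ d → isFree G τ w d ∧ not (does (d Finₚ.≟ lookup τ w))) (allFin k)) +ℕ suc (maxDegree G)
  colour-room τ w = ι-cancel (≤-trans (≤-reflexive total) (≤-trans (∑-mono (allFin k) each) (≤-trans (≤-reflexive split)
      (≤-trans (+-mono-≤ (≤-refl {ι #g}) (+-mono-≤ (≤-refl {1ℚ}) (∑-nbrs w))) (≤-reflexive (symm (trans (ι-+ #g (suc (maxDegree G))) (+ˡ (ι #g) (ι-suc (maxDegree G))))))))))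
    where
    g : Fin k → Bool
    g d = isFree G τ w d ∧ not (does (d Finₚ.≟ lookup τ w))
    #g : ℕ
    #g = length (filterᵇ g (allFin k))
    self : Fin k → ℚ
    self d = χ (does (d Finₚ.≟ lookup τ w)) * 1ℚ
    term : Fin k → Fin n → ℚ
    term d z = χ (Adj G w z) * (χ (does (d Finₚ.≟ lookup τ z)) * 1ℚ)
    0≤term : ∀ d z → 0ℚ ≤ term d z
    0≤term d z = 0≤* (0≤χ (Adj G w z)) (0≤* (0≤χ (does (d Finₚ.≟ lookup τ z))) (0≤ι 1))
    0≤self : ∀ d → 0ℚ ≤ self d
    0≤self d = 0≤* (0≤χ (does (d Finₚ.≟ lookup τ w))) (0≤ι 1)
    total : ι k ≡ ∑ (allFin k) (λ _ → 1ℚ)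
    total = symm (trans (∑-const (allFin k) 1ℚ) (trans (*-identityʳ _) (cong ι (Listₚ.length-tabulate {n = k} id))))
    each : ∀ d → 1ℚ ≤ χ (g d) + (self d + ∑ (allFin n) (term d))
    each d with Free? G τ w d
    ... | no h with blocked G τ w d h
    ...   | z , a , e = ≤-trans (≤-reflexive (symm (trans (cong₂ (λ x y → χ x * (χ y * 1ℚ)) a (does⁺ (d Finₚ.≟ lookup τ z) (symm e))) (trans (*-identityˡ _) (*-identityˡ _)))))
            (≤-trans (single-≤-∑ (enumFin n) (term d) (0≤term d) z)
              (≤-diff (χ (g d) + self d) (0≤+ (0≤χ (g d)) (0≤self d)) (solve 3 (λ x y z → x :+ (y :+ z) := z :+ (x :+ y)) refl (χ (g d)) (self d) (∑ (allFin n) (term d)))))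
    each d | yes fr with d Finₚ.≟ lookup τ w
    ... | yes _ = ≤-diff (χ (isFree G τ w d ∧ false) + ∑ (allFin n) (term d)) (0≤+ (0≤χ (isFree G τ w d ∧ false)) (0≤∑ (allFin n) (0≤term d)))
            (solve 2 (λ x z → x :+ (con (+ 1) :* con (+ 1) :+ z) := con (+ 1) :+ (x :+ z)) refl (χ (isFree G τ w d ∧ false)) (∑ (allFin n) (term d)))
    ... | no _ = ≤-diff (0ℚ * 1ℚ + ∑ (allFin n) (term d)) (0≤+ (0≤* (0≤ι 0) (0≤ι 1)) (0≤∑ (allFin n) (0≤term d))) (cong (λ x → χ (x ∧ true) + (0ℚ * 1ℚ + ∑ (allFin n) (term d))) (free⁺ G fr))
    split : ∑ (allFin k) (λ d → χ (g d) + (self d + ∑ (allFin n) (term d))) ≡ ι #g + (1ℚ + ∑ (allFin n) (λ z → χ (Adj G w z)))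
    split = trans (∑-+ (allFin k) _ _) (cong₂ _+_ (symm (ι-count g (allFin k))) (trans (∑-+ (allFin k) _ _) (cong₂ _+_ (deltaFin k (lookup τ w) (λ _ → 1ℚ))
      (trans (∑-swap (allFin k) (allFin n) term) (∑-cong (allFin n) (λ z → trans (∑-*ˡ (allFin k) (χ (Adj G w z)) _) (trans (cong (χ (Adj G w z) *_) (deltaFin k (lookup τ z) (λ _ → 1ℚ))) (*-identityʳ _))))))))

module Poincaré {n} (G : Graph n) (O : PEO G) (k Q e : ℕ) (1≤e : 1 ≤ℕ e) (e≤ : e +ℕ suc (maxDegree G) ≤ℕ k) (k≤ : k ≤ℕ Q *ℕ e) where
  open Kempe G O k

  M : ℕ
  M = 2 *ℕ (n +ℕ 2 *ℕ (n *ℕ k +ℕ n *ℕ (n *ℕ k)))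

  -- The recursion of `doubling`. That the polynomial `M` is added rather than multiplied is
  -- essential: as a factor it would produce n^O(log n) over the log n doublings.
  factor : ℕ → ℕ
  factor zero = 1
  factor (suc j) = (1 +ℕ 2 *ℕ Q) *ℕ factor j +ℕ M

  module _ (f : Col k n → ℚ) where

    L : ℚ
    L = ∑Ω (λ τ → ∑ (allFin n) (λ x → ∑ (allFin k) (λ d → sq (f τ - f (step G τ x d)))))

    0≤L : 0ℚ ≤ L
    0≤L = 0≤∑Ω (λ τ → 0≤∑ (allFin n) (λ x → 0≤∑ (allFin k) (λ d → 0≤sq _)))

    load : inv′ e * ι (maxDegree G) ≤ ι Q
    load = ≤-trans (*-monoˡ (0≤inv e) (ι-mono (ℕₚ.≤-trans (ℕₚ.≤-trans (ℕₚ.≤-trans (ℕₚ.n≤1+n _) (ℕₚ.m≤n+m _ e)) e≤) k≤)))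
      (≤-reflexive (trans (cong (inv′ e *_) (ι-* Q e)) (trans (solve 3 (λ i q e → i :* (q :* e) := q :* (i :* e)) refl (inv′ e) (ι Q) (ι e)) (trans (cong (ι Q *_) (inv-cancel e 1≤e)) (*-identityʳ _)))))

    module _ {a b : Fin k} (a≢b : a ≢ b) where
      open Congestion G O k a b a≢b f using (changes; changes-1; small; atom; 0≤atom; module Doubling)

      changes-bound : ∀ j → changes (2 ^ℕ j) ≤ ι (factor j) * L
      changes-bound zero = ≤-trans changes-1 (≤-reflexive (symm (*-identityˡ L)))
      changes-bound (suc j) = ≤-trans (≤-reflexive (cong (λ m → changes (s +ℕ m)) (ℕₚ.+-identityʳ s))) (≤-trans
          (Doubling.doubling s (ℕₚ.m^n>0 2 j) e 1≤e (maxDegree G) (λ {τ} w _ → ℕₚ.+-cancelʳ-≤ (suc (maxDegree G)) e _ (ℕₚ.≤-trans e≤ (colour-room G τ w)))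
            (λ u → ≤-trans (≤-reflexive (∑-cong (allFin n) (λ y → cong χ (Graph.sym G y u)))) (∑-nbrs {k = k} G u)))
          (≤-trans (+-mono-≤ ih (*-monoˡ (0≤ι 2) (+-mono-≤ (≤-refl {ι n * L}) (+-mono-≤ scaled (≤-refl {ι 2 * (ι n * (ι k * L) + ι n * (ι n * (ι k * L)))})))))
            (≤-reflexive eq)))
        where
        s : ℕ
        s = 2 ^ℕ j
        ih : changes s ≤ ι (factor j) * L
        ih = changes-bound j
        scaled : (inv′ e * ι (maxDegree G)) * changes s ≤ ι Q * (ι (factor j) * L)
        scaled = *-mono (0≤∑Ω (λ σ → 0≤∑ (allFin n) (λ v → 0≤* (0≤χ (small s σ v)) (0≤atom σ v)))) (0≤ι Q) load ih
        eq : ι (factor j) * L + ι 2 * (ι n * L + (ι Q * (ι (factor j) * L) + ι 2 * (ι n * (ι k * L) + ι n * (ι n * (ι k * L))))) ≡ ι (factor (suc j)) * L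
        eq = trans (solve 5 (λ c l n k q → c :* l :+ con (+ 2) :* (n :* l :+ (q :* (c :* l) :+ con (+ 2) :* (n :* (k :* l) :+ n :* (n :* (k :* l))))) :=
              ((con (+ 1) :+ con (+ 2) :* q) :* c :+ con (+ 2) :* (n :+ con (+ 2) :* (n :* k :+ n :* (n :* k)))) :* l) refl (ι (factor j)) L (ι n) (ι k) (ι Q))
          (cong (_* L) (symm (trans (ι-+ ((1 +ℕ 2 *ℕ Q) *ℕ factor j) M) (cong₂ _+_ (trans (ι-* (1 +ℕ 2 *ℕ Q) (factor j)) (cong (_* ι (factor j)) (trans (ι-suc _) (+ˡ 1ℚ (ι-* 2 Q)))))
            (trans (ι-* 2 _) (cong (ι 2 *_) (trans (ι-+ n _) (+ˡ (ι n) (trans (ι-* 2 _) (cong (ι 2 *_) (trans (ι-+ (n *ℕ k) _) (cong₂ _+_ (ι-* n k) (trans (ι-* n _) (cong (ι n *_) (ι-* n k)))))))))))))))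

    module _ (J : ℕ) (n≤2^J : n ≤ℕ 2 ^ℕ J) where

      pairBound : ℚ
      pairBound = ι n * (ι (factor J) * L)

      0≤pairBound : 0ℚ ≤ pairBound
      0≤pairBound = 0≤* (0≤ι n) (0≤* (0≤ι (factor J)) 0≤L)

      atomᵃᵇ : Fin k → Fin k → Col k n → Fin n → ℚ
      atomᵃᵇ a b σ v = χ (not (does (a Finₚ.≟ b)) ∧ does (Root? (bi a b σ) v)) * sq (f σ - f (flip a b (subtree (bi a b σ) v) σ))

      pair-sum : ∀ a b → ∑Ω (λ σ → ∑ (allFin n) (atomᵃᵇ a b σ)) ≤ pairBound
      pair-sum a b with a Finₚ.≟ b
      ... | yes _ = ≤-trans (≤-reflexive (trans (∑Ω-cong (λ σ _ → trans (∑-cong (allFin n) (λ v → zeroˡ _)) (∑-zero (allFin n)))) (trans (∑-cong Ω (λ σ → zeroʳ _)) (∑-zero Ω)))) 0≤pairBound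
      ... | no a≢b = ≤-trans (∑Ω-mono (λ σ _ → ∑-mono (allFin n) (each σ))) (≤-trans (≤-reflexive (trans (∑Ω-cong (λ σ _ → ∑-*ˡ (allFin n) (ι n) _)) (∑Ω-*ˡ (ι n) _)))
            (*-monoˡ (0≤ι n) (changes-bound a≢b J)))
        where
        open Congestion G O k a b a≢b f using (small; atom; 0≤atom)
        each : ∀ σ v → χ (does (Root? (bi a b σ) v)) * sq (f σ - f (flip a b (subtree (bi a b σ) v) σ)) ≤ ι n * (χ (small (2 ^ℕ J) σ v) * atom σ v)
        each σ v = ≤-trans (*-monoʳ (0≤sq _) (χ-mono {does (Root? X v)} {small (2 ^ℕ J) σ v} (λ h → cong₂ _∧_ h (does⁺ (Le? (size X v) (2 ^ℕ J)) (ℕₚ.≤-trans (size≤n X v) n≤2^J)))))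
            (≤-trans (*-monoˡ (0≤χ (small (2 ^ℕ J) σ v)) (≤-trans (≤-reflexive unscale) (*-monoʳ (0≤atom σ v) (ι-mono (size≤n X v)))))
              (≤-reflexive (solve 3 (λ c n a → c :* (n :* a) := n :* (c :* a)) refl (χ (small (2 ^ℕ J) σ v)) (ι n) (atom σ v))))
          where
          X : Vec Bool n
          X = bi a b σ
          unscale : sq (f σ - f (flip a b (subtree X v) σ)) ≡ ι (size X v) * atom σ v
          unscale = symm (trans (solve 3 (λ s i q → s :* (i :* q) := (i :* s) :* q) refl (ι (size X v)) (inv′ (size X v)) (sq (f σ - f (flip a b (subtree X v) σ))))
            (trans (cong (_* sq (f σ - f (flip a b (subtree X v) σ))) (inv-cancel (size X v) (size≥1 X v))) (*-identityˡ _)))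

      -- Recolouring `v` by an available `b` exchanges the pair `lookup σ v`, `b` on the tree of a
      -- root. The old colour is summed over as `a`, so the total is at most one `pairBound` for
      -- each of the `k * k` pairs.
      flipEnergy-bound : flipEnergy f ≤ ι k * (ι k * pairBound)
      flipEnergy-bound = ≤-trans (∑-mono (allFin n) (λ v → ∑Ω-mono (λ σ P → ∑-mono (allFin k) (λ b → each σ P v b)))) (≤-trans (≤-reflexive rearrange)
          (≤-trans (∑-mono (allFin k) (λ b → ∑-mono (allFin k) (λ a → pair-sum a b)))
            (≤-reflexive (trans (∑-cong (allFin k) (λ b → const pairBound)) (const (ι k * pairBound))))))
        where
        const : ∀ p → ∑ (allFin k) (λ _ → p) ≡ ι k * p
        const p = trans (∑-const (allFin k) p) (cong (λ m → ι m * p) (Listₚ.length-tabulate {n = k} id))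
        each : ∀ σ → Proper G σ → ∀ v b → χ (avail σ v b) * sq (f σ - f (kempe σ v b)) ≤ ∑ (allFin k) (λ a → atomᵃᵇ a b σ v)
        each σ P v b = ≤-trans (own (lookup σ v Finₚ.≟ b)) (single-≤-∑ (enumFin k) (λ a → atomᵃᵇ a b σ v) (λ a → 0≤* (0≤χ (not (does (a Finₚ.≟ b)) ∧ does (Root? (bi a b σ) v))) (0≤sq _)) (lookup σ v))
          where
          own : Dec (lookup σ v ≡ b) → χ (avail σ v b) * sq (f σ - f (kempe σ v b)) ≤ atomᵃᵇ (lookup σ v) b σ v
          own (yes e') = ≤-trans (≤-reflexive (trans (cong (λ ρ → χ (avail σ v b) * sq (f σ - f ρ)) trivial) (solve 2 (λ c x → c :* ((x :- x) :* (x :- x)) := con (+ 0)) refl (χ (avail σ v b)) (f σ))))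
              (0≤* (0≤χ (not (does (lookup σ v Finₚ.≟ b)) ∧ does (Root? (bi (lookup σ v) b σ) v))) (0≤sq _))
            where
            trivial : kempe σ v b ≡ σ
            trivial = subst (λ c → kempe σ v c ≡ σ) e' (Vec-ext (λ x → trans (flip-lookup (lookup σ v) (lookup σ v) _ σ x) (idle x (subtree (bi (lookup σ v) (lookup σ v) σ) v x))))
              where
              idle : ∀ x r → (if r then sw (lookup σ v) (lookup σ v) (lookup σ x) else lookup σ x) ≡ lookup σ x
              idle x false = refl
              idle x true with lookup σ x Finₚ.≟ lookup σ v
              ... | yes p = trans (cong (sw (lookup σ v) (lookup σ v)) p) (trans (sw-a _ _) (symm p))
              ... | no p = sw-∉ (λ { (inj₁ q) → p q ; (inj₂ q) → p q })
          own (no ne) = *-monoʳ (0≤sq _) (χ-mono {avail σ v b} {not (does (lookup σ v Finₚ.≟ b)) ∧ does (Root? (bi (lookup σ v) b σ) v)}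
            (λ h → cong₂ _∧_ (cong not (dec-false (lookup σ v Finₚ.≟ b) ne)) (does⁺ (Root? (bi (lookup σ v) b σ) v) (avail-root P (does⁻ (Avail? σ v b) h)))))
        rearrange : ∑ (allFin n) (λ v → ∑Ω (λ σ → ∑ (allFin k) (λ b → ∑ (allFin k) (λ a → atomᵃᵇ a b σ v)))) ≡
          ∑ (allFin k) (λ b → ∑ (allFin k) (λ a → ∑Ω (λ σ → ∑ (allFin n) (atomᵃᵇ a b σ))))
        rearrange = trans (symm (∑Ω-∑ (allFin n) _)) (trans (∑Ω-cong (λ σ _ → trans (∑-swap (allFin n) (allFin k) _) (∑-cong (allFin k) (λ b → ∑-swap (allFin n) (allFin k) _))))
          (trans (∑Ω-∑ (allFin k) _) (∑-cong (allFin k) (λ b → ∑Ω-∑ (allFin k) _))))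

  gap : ℕ → ℕ
  gap J = n *ℕ (n *ℕ (k *ℕ (k *ℕ (n *ℕ factor J))))

  -- `sweep n g` takes one value `c` on all proper colourings, and for a centred `g` subtracting a
  -- constant can only enlarge the sum of squares.
  poincaré : ∀ J → n ≤ℕ 2 ^ℕ J → ∀ {x} → Proper G x → ∀ g → ∑Ω g ≡ 0ℚ → ∑Ω (λ σ → sq (g σ)) ≤ ι (gap J) * L g
  poincaré J n≤ {x} Px g centred = ≤-trans below-c (≤-trans (≤-reflexive (∑Ω-cong (λ σ P → cong (λ y → sq (g σ - y)) (sweep-const g Px P))))
      (≤-trans (flip-poincaré g) (≤-trans (*-monoˡ (0≤ι n) (*-monoˡ (0≤ι n) (flipEnergy-bound g J n≤))) (≤-reflexive eq))))
    where
    c : ℚ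
    c = sweep n g x
    below-c : ∑Ω (λ σ → sq (g σ)) ≤ ∑Ω (λ σ → sq (g σ - c))
    below-c = ≤-diff (∑Ω (λ _ → sq c)) (0≤∑Ω (λ _ → 0≤sq c)) (trans (∑Ω-cong (λ σ _ → solve 2 (λ y c → (y :- c) :* (y :- c) := y :* y :+ (c :* c :+ (:- (con (+ 2) :* c)) :* y)) refl (g σ) c))
      (trans (∑Ω-+ _ _) (+ˡ (∑Ω (λ σ → sq (g σ))) (trans (∑Ω-+ _ _) (trans (+ˡ (∑Ω (λ _ → sq c)) (trans (∑Ω-*ˡ (- (ι 2 * c)) g) (trans (cong (- (ι 2 * c) *_) centred) (zeroʳ _)))) (+-identityʳ _))))))
    eq : ι n * (ι n * (ι k * (ι k * (ι n * (ι (factor J) * L g))))) ≡ ι (gap J) * L g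
    eq = trans (solve 4 (λ n k f l → n :* (n :* (k :* (k :* (n :* (f :* l))))) := (n :* (n :* (k :* (k :* (n :* f))))) :* l) refl (ι n) (ι k) (ι (factor J)) (L g))
      (cong (_* L g) (symm (trans (ι-* n _) (cong (ι n *_) (trans (ι-* n _) (cong (ι n *_) (trans (ι-* k _) (cong (ι k *_) (trans (ι-* k _) (cong (ι k *_) (ι-* n _)))))))))))

-- Exponents, parameters and the theorem

1≤1+ : ∀ {m} → 1 ≤ℕ suc m
1≤1+ = s≤s z≤n

n≤2^n : ∀ n → n ≤ℕ 2 ^ℕ n
n≤2^n zero = z≤n
n≤2^n (suc n) = ℕₚ.+-mono-≤ (ℕₚ.m^n>0 2 n) (ℕₚ.≤-trans (n≤2^n n) (ℕₚ.≤-reflexive (symm (ℕₚ.+-identityʳ (2 ^ℕ n)))))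

log₂-ceiling : ∀ n → ∃ λ J → suc n ≤ℕ 2 ^ℕ J × 2 ^ℕ J ≤ℕ 2 *ℕ suc n
log₂-ceiling zero = 0 , ℕₚ.≤-refl , s≤s z≤n
log₂-ceiling (suc n) with log₂-ceiling n
... | J , lo , hi with suc (suc n) ℕₚ.≤? 2 ^ℕ J
...   | yes p = J , p , ℕₚ.≤-trans hi (ℕₚ.*-monoʳ-≤ 2 (ℕₚ.n≤1+n (suc n)))
...   | no ¬p = suc J , ℕₚ.≤-trans (ℕₚ.+-monoʳ-≤ 1 lo) (ℕₚ.+-mono-≤ (ℕₚ.m^n>0 2 J) (ℕₚ.m≤m+n (2 ^ℕ J) 0)) ,
            ℕₚ.*-monoʳ-≤ 2 (ℕₚ.≤-trans (ℕₚ.≤-pred (ℕₚ.≰⇒> ¬p)) (ℕₚ.n≤1+n (suc n)))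

-- Upper bounds a ≤ n ^ i are combined by adding exponents; since n ≥ 2, a sum costs one extra factor n.
module Powers (n : ℕ) (2≤n : 2 ≤ℕ n) where

  1≤n : 1 ≤ℕ n
  1≤n = ℕₚ.≤-trans 1≤1+ 2≤n

  weaken : ∀ {a i j} → i ≤ℕ j → a ≤ℕ n ^ℕ i → a ≤ℕ n ^ℕ j
  weaken i≤j h = ℕₚ.≤-trans h (ℕₚ.^-monoʳ-≤ n {{>-nonZero 1≤n}} i≤j)

  mul : ∀ {a b i j} → a ≤ℕ n ^ℕ i → b ≤ℕ n ^ℕ j → a *ℕ b ≤ℕ n ^ℕ (i +ℕ j)
  mul {i = i} {j} ha hb = ℕₚ.≤-trans (ℕₚ.*-mono-≤ ha hb) (ℕₚ.≤-reflexive (symm (ℕₚ.^-distribˡ-+-* n i j)))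

  add : ∀ {a b i} → a ≤ℕ n ^ℕ i → b ≤ℕ n ^ℕ i → a +ℕ b ≤ℕ n ^ℕ (1 +ℕ i)
  add {i = i} ha hb = ℕₚ.≤-trans (ℕₚ.+-mono-≤ ha hb) (ℕₚ.≤-trans (ℕₚ.≤-reflexive (cong (n ^ℕ i +ℕ_) (symm (ℕₚ.+-identityʳ (n ^ℕ i))))) (ℕₚ.*-monoˡ-≤ (n ^ℕ i) 2≤n))

  self : n ≤ℕ n ^ℕ 1
  self = ℕₚ.≤-reflexive (symm (ℕₚ.*-identityʳ n))

  one : ∀ i → 1 ≤ℕ n ^ℕ i
  one i = ℕₚ.m^n>0 n {{>-nonZero 1≤n}} i

  two : 2 ≤ℕ n ^ℕ 1
  two = ℕₚ.≤-trans 2≤n self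

module FewColours {n} (G : Graph n) (O : PEO G) (k m e : ℕ) (2≤n : 2 ≤ℕ n) (1≤k : 1 ≤ℕ k) (k≤8n : k ≤ℕ 8 *ℕ n)
  (1≤e : 1 ≤ℕ e) (e≤ : e +ℕ suc (maxDegree G) ≤ℕ k) (k≤ : k ≤ℕ 2 ^ℕ m *ℕ e)
  (J : ℕ) (n≤2^J : n ≤ℕ 2 ^ℕ J) (2^J≤2n : 2 ^ℕ J ≤ℕ 2 *ℕ n) where
  open Powers n 2≤n
  open Poincaré G O k (2 ^ℕ m) e 1≤e e≤ k≤ using (M; factor; gap; poincaré)

  R : ℕ
  R = 2 ^ℕ (m +ℕ 2)

  factor-step : 1 +ℕ 2 *ℕ 2 ^ℕ m ≤ℕ R
  factor-step = ℕₚ.≤-trans (ℕₚ.+-monoˡ-≤ (2 *ℕ 2 ^ℕ m) (ℕₚ.m^n>0 2 m)) (ℕₚ.≤-trans (ℕₚ.m≤n+m _ (2 ^ℕ m))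
    (ℕₚ.≤-reflexive (trans (quadruple (2 ^ℕ m)) (symm (ℕₚ.^-distribˡ-+-* 2 m 2)))))
    where
    quadruple : ∀ p → p +ℕ (p +ℕ 2 *ℕ p) ≡ p *ℕ 4
    quadruple = solve-∀

  -- Unrolling the recursion, `M` is added `j` times and each copy is later multiplied by at most
  -- `R ^ j`.
  factor≤ : ∀ j → factor j ≤ℕ R ^ℕ j *ℕ (1 +ℕ j *ℕ M)
  factor≤ zero = ℕₚ.≤-refl
  factor≤ (suc j) = ℕₚ.≤-trans (ℕₚ.+-mono-≤ (ℕₚ.*-mono-≤ factor-step (factor≤ j)) (ℕₚ.m≤n*m M (R ^ℕ suc j) {{>-nonZero (ℕₚ.m^n>0 R {{>-nonZero (ℕₚ.m^n>0 2 (m +ℕ 2))}} (suc j))}}))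
    (ℕₚ.≤-reflexive (rearrange R (R ^ℕ j) (j *ℕ M) M))
    where
    rearrange : ∀ r p q M → r *ℕ (p *ℕ (1 +ℕ q)) +ℕ (r *ℕ p) *ℕ M ≡ (r *ℕ p) *ℕ (1 +ℕ (M +ℕ q))
    rearrange = solve-∀

  2^J≤n² : 2 ^ℕ J ≤ℕ n ^ℕ 2
  2^J≤n² = ℕₚ.≤-trans 2^J≤2n (mul {i = 1} {j = 1} two self)

  -- Exchanging the exponents in (2^(m+2))^J = (2^J)^(m+2) turns a constant loss per doubling into a
  -- power of `n` linear in `m`; the 2 comes from `2 * n ≤ n ^ 2`.
  R^J≤ : R ^ℕ J ≤ℕ n ^ℕ (2 *ℕ (m +ℕ 2))
  R^J≤ = ℕₚ.≤-trans (ℕₚ.≤-reflexive (trans (ℕₚ.^-*-assoc 2 (m +ℕ 2) J) (trans (cong (2 ^ℕ_) (ℕₚ.*-comm (m +ℕ 2) J)) (symm (ℕₚ.^-*-assoc 2 J (m +ℕ 2))))))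
    (ℕₚ.≤-trans (ℕₚ.^-monoˡ-≤ (m +ℕ 2) 2^J≤n²) (ℕₚ.≤-reflexive (ℕₚ.^-*-assoc n 2 (m +ℕ 2))))

  k≤n⁴ : k ≤ℕ n ^ℕ 4
  k≤n⁴ = ℕₚ.≤-trans k≤8n (mul {i = 3} {j = 1} (mul {i = 1} {j = 2} two (mul {i = 1} {j = 1} two two)) self)

  M≤ : M ≤ℕ n ^ℕ 10
  M≤ = mul {i = 1} {j = 9} two (add {i = 8} (weaken {i = 1} {j = 8} 1≤1+ self) (mul {i = 1} {j = 7} two (add {i = 6} (weaken {i = 5} {j = 6} (ℕₚ.n≤1+n 5) nk) (mul {i = 1} {j = 5} self nk))))
    where
    nk : n *ℕ k ≤ℕ n ^ℕ 5
    nk = mul {i = 1} {j = 4} self k≤n⁴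

  X : ℕ
  X = 2 *ℕ (m +ℕ 2) +ℕ 13

  factor-bound : factor J ≤ℕ n ^ℕ X
  factor-bound = ℕₚ.≤-trans (factor≤ J) (mul {i = 2 *ℕ (m +ℕ 2)} {j = 13} R^J≤ (add {i = 12} (one 12) (mul {i = 2} {j = 10} (ℕₚ.≤-trans (n≤2^n J) 2^J≤n²) M≤)))

  gap-bound : gap J ≤ℕ n ^ℕ (11 +ℕ X)
  gap-bound = mul {i = 1} {j = 10 +ℕ X} self (mul {i = 1} {j = 9 +ℕ X} self (mul {i = 4} {j = 5 +ℕ X} k≤n⁴ (mul {i = 4} {j = 1 +ℕ X} k≤n⁴ (mul {i = 1} {j = X} self factor-bound))))

  -- The crude `k ≤ 2 ^ k` replaces log k; as `k ≤ 8 * n`, this costs only a polynomial factor.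
  r : ℕ
  r = 2 +ℕ k *ℕ n

  4k^n≤2^r : 4 *ℕ k ^ℕ n ≤ℕ 2 ^ℕ r
  4k^n≤2^r = ℕₚ.≤-trans (ℕₚ.*-monoʳ-≤ 4 (ℕₚ.≤-trans (ℕₚ.^-monoˡ-≤ n (n≤2^n k)) (ℕₚ.≤-reflexive (ℕₚ.^-*-assoc 2 k n)))) (ℕₚ.≤-reflexive (ℕₚ.*-assoc 2 2 (2 ^ℕ (k *ℕ n))))

  B : ℕ
  B = suc (gap J *ℕ ((n *ℕ k) *ℕ suc k))

  time : ℕ
  time = r *ℕ B

  -- The exponents add up to `2 * m + 45`, which is at most `45 * (m + 1)`. This is the origin of
  -- the constant 45.
  time-bound : time ≤ℕ n ^ℕ (45 *ℕ suc m)
  time-bound = weaken {i = 6 +ℕ (1 +ℕ ((11 +ℕ X) +ℕ 10))} {j = 45 *ℕ suc m} (subst₂ _≤ℕ_ (symm (exponent m)) (total m) (ℕₚ.m≤m+n (2 *ℕ m +ℕ 45) (43 *ℕ m)))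
      (mul {i = 6} {j = 1 +ℕ ((11 +ℕ X) +ℕ 10)} (add {i = 5} (weaken {i = 1} {j = 5} 1≤1+ two) (mul {i = 4} {j = 1} k≤n⁴ self))
        (add {i = (11 +ℕ X) +ℕ 10} (one ((11 +ℕ X) +ℕ 10)) (mul {i = 11 +ℕ X} {j = 10} gap-bound (mul {i = 5} {j = 5} (mul {i = 1} {j = 4} self k≤n⁴) (add {i = 4} (one 4) k≤n⁴)))))
    where
    exponent : ∀ m → 6 +ℕ (1 +ℕ ((11 +ℕ (2 *ℕ (m +ℕ 2) +ℕ 13)) +ℕ 10)) ≡ 2 *ℕ m +ℕ 45
    exponent = solve-∀
    total : ∀ m → 2 *ℕ m +ℕ 45 +ℕ 43 *ℕ m ≡ 45 *ℕ suc m
    total = solve-∀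

  mixing-time : MixingTimeAtMost G k (n ^ℕ (45 *ℕ suc m))
  mixing-time = time , time-bound , λ x h → let P = proper⁻ G (trans (isProper≡ G x) h) in
    TotalVariation.FromPoincaré.mixes G k (ℕₚ.≤-trans 1≤1+ 2≤n) 1≤k (gap J) (λ g c → poincaré J n≤2^J P g c) r 4k^n≤2^r x P

many-colours : ∀ {n} (G : Graph n) k m → 2 ≤ℕ n → 1 ≤ℕ k → 8 *ℕ n ≤ℕ k → MixingTimeAtMost G k (n ^ℕ (45 *ℕ suc m))
many-colours {n} G k m 2≤n 1≤k 8n≤k = (2 +ℕ n) *ℕ (2 *ℕ n) ,
    weaken {i = 4} {j = 45 *ℕ suc m} (ℕₚ.≤-trans (ℕₚ.m≤m+n 4 41) (ℕₚ.m≤m*n 45 (suc m))) (mul {i = 2} {j = 2} (add {i = 1} two self) (mul {i = 1} {j = 1} two self)) ,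
    λ x h → mixes (2 +ℕ n) (ℕₚ.≤-trans (ℕₚ.*-monoʳ-≤ 4 (n≤2^n n)) (ℕₚ.≤-reflexive (ℕₚ.*-assoc 2 2 (2 ^ℕ n)))) x (proper⁻ G (trans (isProper≡ G x) h))
  where
  open Powers n 2≤n
  open ManyColours G k (ℕₚ.≤-trans 1≤1+ 2≤n) 1≤k 8n≤k using (mixes)

-- The sole vertex accepts every colour, so one step forgets the start. For `n = 1` the claimed
-- bound is 1, which leaves exactly this one step.
one-vertex : ∀ (G : Graph 1) k T → 1 ≤ℕ k → 1 ≤ℕ T → MixingTimeAtMost G k T
one-vertex G k T 1≤k 1≤T = 1 , 1≤T , λ x h → oscillation-mixes 1 x (proper⁻ G (trans (isProper≡ G x) h)) (λ s _ y _ →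
    ≤-trans (≤-reflexive (trans (cong (λ z → P s x - z) (cong (inv′ N *_) (∑M-cong (λ v c → cong s (trans (same y v c) (symm (same x v c))))))) (solve 1 (λ z → z :- z := con (+ 0)) refl (P s x)))) (0≤inv 2))
  where
  open Oscillation G k 1≤1+ 1≤k
  same : ∀ x v c → step G x v c ≡ c ∷ᵛ []ᵛ
  same (a ∷ᵛ []ᵛ) zero c = step-free G (mkFree (λ { zero adj → ⊥-elim (Adj-≢ {k = k} G adj refl) }))

-- For `n = 0` the claimed bound is 0 as well, and the empty colouring is already stationary at time
-- 0.
no-vertex : ∀ (G : Graph 0) k T → MixingTimeAtMost G k T
no-vertex G k T = 0 , z≤n , λ { []ᵛ _ → ℚ.*≤* (ℤ.+≤+ z≤n) }

module Parameters (ε : ℚ) (0<ε : 0ℚ < ε) (Δ k m : ℕ) (few : (1ℚ + ε) * ι (suc Δ) ≤ ι k) (log : 1ℚ + ε ≤ ι (2 ^ℕ m) * ε) where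

  -- Otherwise `k` is at most Δ + 1 and the hypothesis forces (Δ + 1) ε ≤ 0. Integrality thus yields
  -- at least one spare colour, however small ε is.
  Δ+2≤k : suc (suc Δ) ≤ℕ k
  Δ+2≤k with suc (suc Δ) ℕₚ.≤? k
  ... | yes h = h
  ... | no h = ⊥-elim (ℚₚ.<-irrefl refl (ℚₚ.<-≤-trans 0<ε (*-cancelˡ {ι (suc Δ)} (0<ι (suc Δ) 1≤1+) (≤-trans excess (≤-reflexive (symm (zeroʳ _)))))))
    where
    excess : ι (suc Δ) * ε ≤ 0ℚ
    excess = ≤-diff (ι (suc Δ) - (1ℚ + ε) * ι (suc Δ)) (diff-≤ (≤-trans few (ι-mono (ℕₚ.≤-pred (ℕₚ.≰⇒> h)))))
      (solve 2 (λ d e → con (+ 0) := d :* e :+ (d :- (con (+ 1) :+ e) :* d)) refl (ι (suc Δ)) ε)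

  e : ℕ
  e = k ∸ℕ suc Δ

  e+ : e +ℕ suc Δ ≡ k
  e+ = ℕₚ.m∸n+n≡m (ℕₚ.≤-trans (ℕₚ.n≤1+n (suc Δ)) Δ+2≤k)

  1≤e : 1 ≤ℕ e
  1≤e = ℕₚ.m<n⇒0<n∸m Δ+2≤k

  -- With d = Δ + 1, the ratio k/(k - d) decreases in k and equals 1 + 1/ε at k = (1 + ε) d. The
  -- remainder below expresses this without division, as two products of nonnegative factors.
  k≤2^m*e : k ≤ℕ 2 ^ℕ m *ℕ e
  k≤2^m*e = ι-cancel (≤-diff (d * (q * ε - (1ℚ + ε)) + (q - 1ℚ) * (κ - (1ℚ + ε) * d))
      (0≤+ (0≤* (0≤ι (suc Δ)) (diff-≤ log)) (0≤* (diff-≤ (ι-mono (ℕₚ.m^n>0 2 m))) (diff-≤ few)))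
      (trans (ι-* (2 ^ℕ m) e) (trans (cong (q *_) ιe) (solve 4 (λ q κ d ε → q :* (κ :- d) := κ :+ (d :* (q :* ε :- (con (+ 1) :+ ε)) :+ (q :- con (+ 1)) :* (κ :- (con (+ 1) :+ ε) :* d))) refl q κ d ε))))
    where
    d q κ : ℚ
    d = ι (suc Δ)
    q = ι (2 ^ℕ m)
    κ = ι k
    ιe : ι e ≡ κ - d
    ιe = trans (solve 2 (λ e d → e := (e :+ d) :- d) refl (ι e) d) (cong (_- d) (trans (symm (ι-+ e (suc Δ))) (cong ι e+)))

chordal-mixing : ∀ ε → 0ℚ < ε → ∀ n (G : Graph n) → Chordal G → ∀ k → (1ℚ + ε) * ι (suc (maxDegree G)) ≤ ι k →
  ∀ m → 1ℚ + ε ≤ ι (2 ^ℕ m) * ε → MixingTimeAtMost G k (n ^ℕ (45 *ℕ suc m))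
chordal-mixing ε 0<ε zero G chordal k few m log = no-vertex G k _
chordal-mixing ε 0<ε (suc zero) G chordal k few m log = one-vertex G k _ (ℕₚ.≤-trans 1≤1+ Δ+2≤k) (ℕₚ.m^n>0 1 (45 *ℕ suc m))
  where open Parameters ε 0<ε (maxDegree G) k m few log
chordal-mixing ε 0<ε n@(suc (suc n')) G chordal k few m log with 8 *ℕ n ℕₚ.≤? k
... | yes 8n≤k = many-colours G k m (s≤s (s≤s z≤n)) (ℕₚ.≤-trans 1≤1+ Δ+2≤k) 8n≤k
  where open Parameters ε 0<ε (maxDegree G) k m few log
... | no ¬8n≤k with log₂-ceiling (suc n')
...   | J , lo , hi = FewColours.mixing-time G (Elimination.peo G chordal) k m e (s≤s (s≤s z≤n)) (ℕₚ.≤-trans 1≤1+ Δ+2≤k)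
          (ℕₚ.<⇒≤ (ℕₚ.≰⇒> ¬8n≤k)) 1≤e (ℕₚ.≤-reflexive e+) k≤2^m*e J lo hi
  where open Parameters ε 0<ε (maxDegree G) k m few log

-- All estimates are stated with the abstract copies of the rational operations; the bridges carry
-- the hypotheses of the theorem over to them.
bridge-few : ∀ ε Δ k → (ℚ.1ℚ ℚ.+ ε) ℚ.* (+ suc Δ ℚ./ 1) ≤ (+ k ℚ./ 1) → (1ℚ + ε) * ι (suc Δ) ≤ ι k
bridge-few ε Δ k h = subst₂ _≤_ (symm (trans (*≡ _ _) (cong₂ ℚ._*_ (trans (+≡ _ _) (cong (ℚ._+ ε) (ιℤ≡ (+ 1)))) (ιℤ≡ (+ suc Δ))))) (symm (ιℤ≡ (+ k))) h

bridge-log : ∀ ε m → Log2Bound ε m → 1ℚ + ε ≤ ι (2 ^ℕ m) * ε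
bridge-log ε m h = subst₂ _≤_ (symm (trans (+≡ _ _) (cong (ℚ._+ ε) (ιℤ≡ (+ 1))))) (symm (trans (*≡ _ _) (cong (ℚ._* ε) (ιℤ≡ (+ (2 ^ℕ m)))))) h

bridge-pos : ∀ ε → ℚ.0ℚ < ε → 0ℚ < ε
bridge-pos ε = subst (_< ε) (symm (ιℤ≡ (+ 0)))

theorem2 : Σ ℕ λ C →
    (ε : ℚ) → ℚ.0ℚ < ε →
    (n : ℕ) (G : Graph n) → Chordal G →
    (k : ℕ) → (ℚ.1ℚ ℚ.+ ε) ℚ.* (+ suc (maxDegree G) ℚ./ 1) ≤ (+ k ℚ./ 1) →
    (m : ℕ) → Log2Bound ε m →
    MixingTimeAtMost G k (n ^ℕ (C *ℕ suc m))
theorem2 = 45 , λ ε 0<ε n G chordal k few m log →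
  chordal-mixing ε (bridge-pos ε 0<ε) n G chordal k (bridge-few ε (maxDegree G) k few) m (bridge-log ε m log)
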